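{- Any latin hypercuboid of order $4$ is completable to a latin hypercube. That is, let $\Sigma=\{0,1,2,3\}$, let $n\geq 1$ be an integer, let $\Sigma'\subseteq\Sigma$, and let $f:\Sigma^{n-1}\times\Sigma'\to\Sigma$ be a partial $n$-ary quasigroup. Then there exists an $n$-ary quasigroup $q:\Sigma^n\to\Sigma$ such that $q|_{\Sigma^{n-1}\times\Sigma'}=f$.
   Context: Let $\Sigma$ be a nonempty finite set. An operation $q:\Sigma^n\to\Sigma$ is called an $n$-ary quasigroup of order $|\Sigma|$ if in the equality $x_0=q(x_1,\ldots,x_n)$ knowledge of any $n$ of the elements $x_0,x_1,\ldots,x_n$ uniquely specifies the remaining one. The Hamming distance $d(\overline{x},\overline{y})$ between two words $\overline{x},\overline{y}\in\Sigma^n$ is the number of positions in which they differ. For $\Omega\subseteq\Sigma^n$, a function $f:\Omega\to\Sigma$ is called a partial $n$-ary quasigroup if $f(\overline{x})\neq f(\overline{y})$ for any $\overline{x},\overline{y}\in\Omega$ with $d(\overline{x},\overline{y})=1$. Only domains of the form $\Omega=\Sigma^{n-1}\times\Sigma'$ with $\Sigma'\subseteq\Sigma$ are considered. The table of values of an $n$-ary quasigroup is called a latin hypercube. The table of values of a partial $n$-ary quasigroup $f:\Sigma^{n-1}\times\Sigma'\to\Sigma$ is called a latin hypercuboid. Equivalently, with $N=|\Sigma|$ and $k=|\Sigma'|$, a latin hypercuboid of order $N$ is an $N\times\cdots\times N\times k$ array filled with symbols from $\{0,\ldots,N-1\}$ in such a way that every symbol occurs at most once in every line (a line being obtained by fixing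 all coordinates but one); if $k=N$, such an array is a latin hypercube. A latin hypercuboid is completable to a latin hypercube if the corresponding partial $n$-ary quasigroup $f$ is the restriction to $\Sigma^{n-1}\times\Sigma'$ of some $n$-ary quasigroup $q:\Sigma^n\to\Sigma$. -}

module Defs where

open import Level using (0ℓ)
open import Data.Nat using (ℕ; suc)
open import Data.Fin using (Fin; _≟_)
open import Data.Fin.Subset using (Subset; _∈_)
open import Data.Product using (Σ; ∃!; _×_; _,_)
open import Data.Vec using (Vec; head; tail; last; zip; count; _[_]≔_)
open import Data.Vec.Properties.WithK using ([]=-irrelevant)
open import Relation.Nullary using (Irrelevant)
open import Relation.Nullary.Decidable using (¬?)
open import Relation.Unary using (Pred)
open import Relation.Binary.PropositionalEquality using (_≡_; _≢_)

Word : ℕ → ℕ → Set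
Word N n = Vec (Fin N) n

hamming : ∀ {N n} → Word N n → Word N n → ℕ
hamming x y = count (λ (a , b) → ¬? (a ≟ b)) (zip x y)

-- The word w lists x₀, x₁, …, xₙ: whatever the other n entries are, exactly
-- one value a in position i makes x₀ = q(x₁, …, xₙ) hold.
IsQuasigroup : ∀ {N n} → (Word N n → Fin N) → Set
IsQuasigroup {N} {n} q =
  ∀ (i : Fin (suc n)) (w : Word N (suc n)) →
  ∃! _≡_ λ a → head (w [ i ]≔ a) ≡ q (tail (w [ i ]≔ a))

PartialOp : ∀ {N n} → Pred (Word N n) 0ℓ → Set
PartialOp {N} Ω = ∀ x → Ω x → Fin N

IsPartialQuasigroup : ∀ {N n} (Ω : Pred (Word N n) 0ℓ) → PartialOp Ω → Set
IsPartialQuasigroup Ω f =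
  ∀ x y (x∈Ω : Ω x) (y∈Ω : Ω y) → hamming x y ≡ 1 → f x x∈Ω ≢ f y y∈Ω

-- Σⁿ⁻¹ × Σ′ as a subset of Σⁿ, where n = suc m.
Cylinder : ∀ {N} m → Subset N → Pred (Word N (suc m)) 0ℓ
Cylinder m Σ′ x = last x ∈ Σ′

-- Hence a PartialOp on a cylinder is a function of the word alone.
Cylinder-irrelevant : ∀ {N} m (Σ′ : Subset N) x → Irrelevant (Cylinder m Σ′ x)
Cylinder-irrelevant m Σ′ x = []=-irrelevant

Completable : ∀ {N n} (Ω : Pred (Word N n) 0ℓ) → PartialOp Ω → Set
Completable {N} {n} Ω f =
  Σ (Word N n → Fin N) λ q → IsQuasigroup q × (∀ x (x∈Ω : Ω x) → q x ≡ f x x∈Ω)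

{-# OPTIONS --safe #-}
module Submission where

-- Identify Σ with V = F₂², and a hypercuboid with its layers. The hard case is to find a
-- quasigroup h disjoint from two given disjoint quasigroups f and g. Along a line, u = f ⊕ g
-- depends on the value of f through a transvection, whose vector p is the colour of the line.
-- By induction on the arity there are a nonzero functional κ · _ and a nontrivial set of
-- coordinates across which κ · f is additive. Then one of two things happens. Either all
-- nonconstant lines have one colour; then u omits a nonzero value q and h = f ⊕ q works. Or the
-- coordinates outside some set I act on the values of f and of g through the same permutations
-- of V; then a solution for the restrictions of f and g to the coordinates in I extends.

open import Data.Bool using (Bool; true; false; _∧_; _∨_; _xor_; not; if_then_else_; T)
import Data.Bool.Properties as Bool
open import Data.Empty using (⊥; ⊥-elim)
open import Data.Fin using (Fin; zero; suc; punchIn; punchOut; inject₁; fromℕ)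
open import Data.Fin.Patterns using (0F; 1F; 2F; 3F)
open import Data.Fin.Properties using (_≟_; any?; punchIn-punchOut)
open import Data.Fin.Subset using (Subset; _∈_)
open import Data.Fin.Subset.Properties using (_∈?_)
open import Data.Nat using (ℕ; zero; suc)
open import Data.Product using (Σ; ∃; _×_; _,_; proj₁; proj₂)
open import Data.Sum as Sum using (_⊎_; inj₁; inj₂)
open import Data.Vec using
  (Vec; []; _∷_; _∷ʳ_; lookup; tabulate; replicate; init; last; initLast; insertAt; removeAt; _[_]≔_)
open import Data.Vec.Properties using
  ( lookup∘update; lookup∘update′; []≔-idempotent; []≔-commutes; []≔-lookup
  ; lookup∘tabulate; tabulate∘lookup; tabulate-cong; init-∷ʳ; last-∷ʳ )
open import Function using (_∘_; id)
open import Relation.Binary.PropositionalEquality using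
  (_≡_; _≢_; refl; sym; trans; cong; cong₂; subst; subst₂; module ≡-Reasoning)
open import Relation.Nullary using (¬_; Dec; yes; no; does; contradiction)
open import Relation.Nullary.Decidable using (map′; ¬?; _×-dec_; _→-dec_; dec-true; dec-false; decidable-stable)
open import Relation.Nullary.Reflects using (Reflects; ofʸ; ofⁿ; ¬-reflects; _×-reflects_; _⊎-reflects_; _→-reflects_)
open import Relation.Unary using (Decidable)
open import Defs

-- The space V

-- The obstacle is that a colour belongs to a line and not to a direction: whether `κ · u` varies in
-- direction `i` depends on the point. What can be carried between points is a Boolean function that
-- is affine in `κ · f` along every line. Its derivatives are of the same kind, and those in
-- directions which no separated set divides agree. The twists across separated sets are such
-- functions, and so are some indicators of colours. A point with a wanted activity is therefore
-- moved, without losing the activity, to a place where such a function is true; this is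
-- `flip-lemma`. The safe moves exist because the form is alternating. If `κ · p` is true for the
-- colour `p` of a line, an increment `p` in another direction changes `κ · f`, yet it is orthogonal
-- to `p` and so leaves that colour alone on a flat plane. Since the kernel of `p · _` is spanned by
-- `p`, one nonzero vector can serve as twist, as colour and as functional.

V : Set
V = Fin 4

infixl 6 _⊕_
infix 7 _·_
infix 8 _⊛_

-- The Klein four-group, its alternating bilinear form, and scalar multiplication by F₂.
_⊕_ : V → V → V
0F ⊕ b  = b
1F ⊕ 0F = 1F
1F ⊕ 1F = 0F
1F ⊕ 2F = 3F
1F ⊕ 3F = 2F
2F ⊕ 0F = 2F
2F ⊕ 1F = 3F
2F ⊕ 2F = 0F
2F ⊕ 3F = 1F
3F ⊕ 0F = 3F
3F ⊕ 1F = 2F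
3F ⊕ 2F = 1F
3F ⊕ 3F = 0F

_·_ : V → V → Bool
0F · b  = false
1F · 0F = false
1F · 1F = false
1F · 2F = true
1F · 3F = true
2F · 0F = false
2F · 1F = true
2F · 2F = false
2F · 3F = true
3F · 0F = false
3F · 1F = true
3F · 2F = true
3F · 3F = false

_⊛_ : Bool → V → V
true  ⊛ a = a
false ⊛ a = 0F

-- A transvection minus the identity: `a ↦ a ⊕ shear p a` fixes `0F` and `p`, and adds `p` to the
-- other two vectors if `p` is nonzero.
shear : V → V → V
shear p a = (p · a) ⊛ p

twist : V → V → V → V
twist ν a b = (ν · a ∧ ν · b) ⊛ ν

infix 4 _==_
_==_ : V → V → Bool
0F == 0F = true
1F == 1F = true
2F == 2F = true
3F == 3F = true
_  == _  = false

bool-clash : ∀ {a} {A : Set} → a ≡ true → a ≡ false → A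
bool-clash {true} _ ()

bool-case : ∀ a → a ≡ true ⊎ a ≡ false
bool-case true  = inj₁ refl
bool-case false = inj₂ refl

not-true : ∀ {b} → b ≡ true → not b ≡ false
not-true refl = refl

not-false : ∀ {b} → b ≡ false → not b ≡ true
not-false refl = refl

not-true⁻¹ : ∀ {b} → not b ≡ true → b ≡ false
not-true⁻¹ {false} _ = refl

not-false⁻¹ : ∀ {b} → not b ≡ false → b ≡ true
not-false⁻¹ {true} _ = refl

∧-intro : ∀ {a b} → a ≡ true → b ≡ true → a ∧ b ≡ true
∧-intro refl refl = refl

∧-left : ∀ {a b} → a ∧ b ≡ true → a ≡ true
∧-left {true} _ = refl

∧-right : ∀ {a b} → a ∧ b ≡ true → b ≡ true
∧-right {true} h = h

==-reflects : ∀ a b → Reflects (a ≡ b) (a == b)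
==-reflects 0F 0F = ofʸ refl
==-reflects 0F 1F = ofⁿ λ ()
==-reflects 0F 2F = ofⁿ λ ()
==-reflects 0F 3F = ofⁿ λ ()
==-reflects 1F 0F = ofⁿ λ ()
==-reflects 1F 1F = ofʸ refl
==-reflects 1F 2F = ofⁿ λ ()
==-reflects 1F 3F = ofⁿ λ ()
==-reflects 2F 0F = ofⁿ λ ()
==-reflects 2F 1F = ofⁿ λ ()
==-reflects 2F 2F = ofʸ refl
==-reflects 2F 3F = ofⁿ λ ()
==-reflects 3F 0F = ofⁿ λ ()
==-reflects 3F 1F = ofⁿ λ ()
==-reflects 3F 2F = ofⁿ λ ()
==-reflects 3F 3F = ofʸ refl

-- A deep embedding, so that a finite statement is decided by evaluating one Boolean.
data Claim : Set where
  _≐_   : V → V → Claim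
  _≐ᵇ_  : Bool → Bool → Claim
  _∧ᶜ_  : Claim → Claim → Claim
  _∨ᶜ_  : Claim → Claim → Claim
  _⇒_   : Claim → Claim → Claim
  neg   : Claim → Claim
  all   : (V → Claim) → Claim
  allᵇ  : (Bool → Claim) → Claim

infix 4 _≐_ _≐ᵇ_
infixr 3 _∧ᶜ_ _∨ᶜ_
infixr 2 _⇒_

⟦_⟧ : Claim → Set
⟦ a ≐ b ⟧   = a ≡ b
⟦ a ≐ᵇ b ⟧  = a ≡ b
⟦ A ∧ᶜ B ⟧  = ⟦ A ⟧ × ⟦ B ⟧
⟦ A ∨ᶜ B ⟧  = ⟦ A ⟧ ⊎ ⟦ B ⟧
⟦ A ⇒ B ⟧   = ⟦ A ⟧ → ⟦ B ⟧
⟦ neg A ⟧   = ¬ ⟦ A ⟧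
⟦ all A ⟧   = ∀ v → ⟦ A v ⟧
⟦ allᵇ A ⟧  = ∀ b → ⟦ A b ⟧

⟦_⟧ᵇ : Claim → Bool
⟦ a ≐ b ⟧ᵇ  = a == b
⟦ a ≐ᵇ b ⟧ᵇ = not (a xor b)
⟦ A ∧ᶜ B ⟧ᵇ = ⟦ A ⟧ᵇ ∧ ⟦ B ⟧ᵇ
⟦ A ∨ᶜ B ⟧ᵇ = ⟦ A ⟧ᵇ ∨ ⟦ B ⟧ᵇ
⟦ A ⇒ B ⟧ᵇ  = not ⟦ A ⟧ᵇ ∨ ⟦ B ⟧ᵇ
⟦ neg A ⟧ᵇ  = not ⟦ A ⟧ᵇ
⟦ all A ⟧ᵇ  = ⟦ A 0F ⟧ᵇ ∧ (⟦ A 1F ⟧ᵇ ∧ (⟦ A 2F ⟧ᵇ ∧ ⟦ A 3F ⟧ᵇ))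
⟦ allᵇ A ⟧ᵇ = ⟦ A false ⟧ᵇ ∧ ⟦ A true ⟧ᵇ

⟦_⟧-reflects : ∀ A → Reflects ⟦ A ⟧ ⟦ A ⟧ᵇ
⟦ a ≐ b ⟧-reflects = ==-reflects a b
⟦ false ≐ᵇ false ⟧-reflects = ofʸ refl
⟦ false ≐ᵇ true ⟧-reflects = ofⁿ λ ()
⟦ true ≐ᵇ false ⟧-reflects = ofⁿ λ ()
⟦ true ≐ᵇ true ⟧-reflects = ofʸ refl
⟦ A ∧ᶜ B ⟧-reflects = ⟦ A ⟧-reflects ×-reflects ⟦ B ⟧-reflects
⟦ A ∨ᶜ B ⟧-reflects = ⟦ A ⟧-reflects ⊎-reflects ⟦ B ⟧-reflects
⟦ A ⇒ B ⟧-reflects = ⟦ A ⟧-reflects →-reflects ⟦ B ⟧-reflects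
⟦ neg A ⟧-reflects = ¬-reflects ⟦ A ⟧-reflects
⟦ all A ⟧-reflects with ⟦ A 0F ⟧ᵇ | ⟦ A 0F ⟧-reflects | ⟦ A 1F ⟧ᵇ | ⟦ A 1F ⟧-reflects
                      | ⟦ A 2F ⟧ᵇ | ⟦ A 2F ⟧-reflects | ⟦ A 3F ⟧ᵇ | ⟦ A 3F ⟧-reflects
... | false | ofⁿ n | _ | _ | _ | _ | _ | _ = ofⁿ λ h → n (h 0F)
... | true | _ | false | ofⁿ n | _ | _ | _ | _ = ofⁿ λ h → n (h 1F)
... | true | _ | true | _ | false | ofⁿ n | _ | _ = ofⁿ λ h → n (h 2F)
... | true | _ | true | _ | true | _ | false | ofⁿ n = ofⁿ λ h → n (h 3F)
... | true | ofʸ a | true | ofʸ b | true | ofʸ c | true | ofʸ d =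
  ofʸ λ { 0F → a ; 1F → b ; 2F → c ; 3F → d }
⟦ allᵇ A ⟧-reflects with ⟦ A false ⟧ᵇ | ⟦ A false ⟧-reflects | ⟦ A true ⟧ᵇ | ⟦ A true ⟧-reflects
... | false | ofⁿ n | _ | _ = ofⁿ λ h → n (h false)
... | true | _ | false | ofⁿ n = ofⁿ λ h → n (h true)
... | true | ofʸ a | true | ofʸ b = ofʸ λ { false → a ; true → b }

-- When evaluation succeeds, the implicit argument has the unit type and is filled in by eta, so
-- each use is a computation of the type checker.
prove : ∀ A → {T ⟦ A ⟧ᵇ} → ⟦ A ⟧
prove A {t} with ⟦ A ⟧ᵇ | ⟦ A ⟧-reflects
... | true | ofʸ a = a

⊕-comm : ∀ a b → a ⊕ b ≡ b ⊕ a
⊕-comm = prove (all λ a → all λ b → a ⊕ b ≐ b ⊕ a)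

⊕-assoc : ∀ a b c → (a ⊕ b) ⊕ c ≡ a ⊕ (b ⊕ c)
⊕-assoc = prove (all λ a → all λ b → all λ c → (a ⊕ b) ⊕ c ≐ a ⊕ (b ⊕ c))

⊕-self : ∀ a → a ⊕ a ≡ 0F
⊕-self = prove (all λ a → a ⊕ a ≐ 0F)

⊕-identityʳ : ∀ a → a ⊕ 0F ≡ a
⊕-identityʳ = prove (all λ a → a ⊕ 0F ≐ a)

⊕-involutive : ∀ a b → (a ⊕ b) ⊕ b ≡ a
⊕-involutive = prove (all λ a → all λ b → (a ⊕ b) ⊕ b ≐ a)

⊕-involutiveˡ : ∀ a b → a ⊕ (a ⊕ b) ≡ b
⊕-involutiveˡ = prove (all λ a → all λ b → a ⊕ (a ⊕ b) ≐ b)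

⊕-cancelˡ : ∀ a b c → a ⊕ b ≡ a ⊕ c → b ≡ c
⊕-cancelˡ = prove (all λ a → all λ b → all λ c → a ⊕ b ≐ a ⊕ c ⇒ b ≐ c)

⊕≡0⇒≡ : ∀ a b → a ⊕ b ≡ 0F → a ≡ b
⊕≡0⇒≡ = prove (all λ a → all λ b → a ⊕ b ≐ 0F ⇒ a ≐ b)

·-self : ∀ a → a · a ≡ false
·-self = prove (all λ a → a · a ≐ᵇ false)

·-zeroʳ : ∀ a → a · 0F ≡ false
·-zeroʳ = prove (all λ a → a · 0F ≐ᵇ false)

·-comm : ∀ a b → a · b ≡ b · a
·-comm = prove (all λ a → all λ b → a · b ≐ᵇ b · a)

·-⊕ : ∀ a b c → a · (b ⊕ c) ≡ (a · b) xor (a · c)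
·-⊕ = prove (all λ a → all λ b → all λ c → a · (b ⊕ c) ≐ᵇ (a · b) xor (a · c))

·-twist : ∀ κ ν a b → κ · ν ≡ false → κ · twist ν a b ≡ false
·-twist = prove (all λ κ → all λ ν → all λ a → all λ b → κ · ν ≐ᵇ false ⇒ κ · twist ν a b ≐ᵇ false)

-- A vector on which `κ · _` is true, used as the standard step along a line. The value at `0F` is a
-- placeholder.
unit : V → V
unit 0F = 0F
unit 1F = 2F
unit 2F = 1F
unit 3F = 1F

·-unit : ∀ κ → κ ≢ 0F → κ · unit κ ≡ true
·-unit = prove (all λ κ → neg (κ ≐ 0F) ⇒ κ · unit κ ≐ᵇ true)

tab : {A : Set} → A → A → A → A → V → A
tab a b c d 0F = a
tab a b c d 1F = b
tab a b c d 2F = c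
tab a b c d 3F = d

tab-correct : {A : Set} (h : V → A) (x : V) → h x ≡ tab (h 0F) (h 1F) (h 2F) (h 3F) x
tab-correct h 0F = refl
tab-correct h 1F = refl
tab-correct h 2F = refl
tab-correct h 3F = refl

InjV : (V → V) → Set
InjV h = ∀ v w → h v ≡ h w → v ≡ w

distinct : V → V → V → V → Claim
distinct a b c d = neg (a ≐ b) ∧ᶜ neg (a ≐ c) ∧ᶜ neg (b ≐ c) ∧ᶜ neg (a ≐ d) ∧ᶜ neg (b ≐ d) ∧ᶜ neg (c ≐ d)

inj⇒distinct : ∀ h → InjV h → ⟦ distinct (h 0F) (h 1F) (h 2F) (h 3F) ⟧
inj⇒distinct h inj = d (λ ()) , d (λ ()) , d (λ ()) , d (λ ()) , d (λ ()) , d (λ ())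
  where
  d : ∀ {v w} → v ≢ w → h v ≢ h w
  d v≢w = v≢w ∘ inj _ _

inverse : (V → V) → V → V
inverse h c = if h 0F == c then 0F else if h 1F == c then 1F else if h 2F == c then 2F else 3F

inverse-correct : ∀ h → InjV h → ∀ c → h (inverse h c) ≡ c
inverse-correct h inj c = trans (tab-correct h _) (prove (
  all λ h₀ → all λ h₁ → neg (h₀ ≐ h₁) ⇒ all λ h₂ → all λ h₃ → distinct h₀ h₁ h₂ h₃ ⇒
  all λ c → let h = tab h₀ h₁ h₂ h₃ in h (inverse h c) ≐ c)
  (h 0F) (h 1F) (proj₁ dis) (h 2F) (h 3F) dis c)
  where dis = inj⇒distinct h inj

-- The reduced latin squares of order 4 are the table of V and, for each ν ≢ 0F, the
-- table a ⊕ b ⊕ twist ν a b of the cyclic group with involution ν.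
classify : (V → V → V) → V
classify F = if F 1F 1F == 0F then F 2F 2F else F 1F 1F

classify-correct : ∀ F → (∀ a → F a 0F ≡ a) → (∀ b → F 0F b ≡ b) →
  (∀ a → InjV (F a)) → (∀ b → InjV (λ a → F a b)) →
  ∀ a b → F a b ≡ a ⊕ b ⊕ twist (classify F) a b
classify-correct F F-0 0-F row col a b = trans (tab² a b) (check
  (F 0F 0F) (F-0 0F) (F 0F 1F) (0-F 1F) (F 0F 2F) (0-F 2F) (F 0F 3F) (0-F 3F)
  (F 1F 0F) (F-0 1F) (F 2F 0F) (F-0 2F) (F 3F 0F) (F-0 3F)
  (F 1F 1F) (proj₁ row₁) (F 1F 2F) (F 1F 3F) row₁
  (F 2F 1F) (proj₁ row₂) (F 2F 2F) (F 2F 3F) row₂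
  (F 3F 1F) (inj⇒distinct _ (col 1F)) (F 3F 2F) (inj⇒distinct _ (col 2F))
  (F 3F 3F) (inj⇒distinct _ (col 3F)) (inj⇒distinct _ (row 3F)) a b)
  where
  row₁ = inj⇒distinct _ (row 1F)
  row₂ = inj⇒distinct _ (row 2F)
  tab² : ∀ a b → F a b ≡ tab (tab (F 0F 0F) (F 0F 1F) (F 0F 2F) (F 0F 3F))
      (tab (F 1F 0F) (F 1F 1F) (F 1F 2F) (F 1F 3F))
                             (tab (F 2F 0F) (F 2F 1F) (F 2F 2F) (F 2F 3F))
                                 (tab (F 3F 0F) (F 3F 1F) (F 3F 2F) (F 3F 3F)) a b
  tab² 0F = tab-correct (F 0F)
  tab² 1F = tab-correct (F 1F)
  tab² 2F = tab-correct (F 2F)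
  tab² 3F = tab-correct (F 3F)
  -- Each entry is followed at once by the hypotheses that constrain it, so evaluation abandons a
  -- wrong partial table early and never runs through all sixteen entries freely.
  check = prove (all λ a₀ → a₀ ≐ 0F ⇒ all λ a₁ → a₁ ≐ 1F ⇒ all λ a₂ → a₂ ≐ 2F ⇒ all λ a₃ → a₃ ≐ 3F ⇒
    all λ b₀ → b₀ ≐ 1F ⇒ all λ c₀ → c₀ ≐ 2F ⇒ all λ d₀ → d₀ ≐ 3F ⇒
    all λ b₁ → neg (b₀ ≐ b₁) ⇒ all λ b₂ → all λ b₃ → distinct b₀ b₁ b₂ b₃ ⇒
    all λ c₁ → neg (c₀ ≐ c₁) ⇒ all λ c₂ → all λ c₃ → distinct c₀ c₁ c₂ c₃ ⇒
    all λ d₁ → distinct a₁ b₁ c₁ d₁ ⇒ all λ d₂ → distinct a₂ b₂ c₂ d₂ ⇒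
    all λ d₃ → distinct a₃ b₃ c₃ d₃ ⇒ distinct d₀ d₁ d₂ d₃ ⇒
    let F = tab (tab a₀ a₁ a₂ a₃) (tab b₀ b₁ b₂ b₃) (tab c₀ c₁ c₂ c₃) (tab d₀ d₁ d₂ d₃) in
    all λ a → all λ b → F a b ≐ a ⊕ b ⊕ twist (classify F) a b)

-- If a ↦ a and a ↦ a ⊕ φ a are disjoint permutations of V, then φ takes at most two values,
-- and the colour is their difference.
colour : (V → V) → V
colour φ = if φ 0F == φ 1F then φ 0F ⊕ φ 2F else φ 0F ⊕ φ 1F

colour-correct : ∀ φ → (∀ a → φ a ≢ 0F) → InjV (λ a → a ⊕ φ a) → ∀ a → φ a ≡ φ 0F ⊕ shear (colour φ) a
colour-correct φ φ≢0 inj a = trans (tab-correct φ a) (prove (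
  all λ f₀ → neg (f₀ ≐ 0F) ⇒ all λ f₁ → neg (f₁ ≐ 0F) ⇒ all λ f₂ → neg (f₂ ≐ 0F) ⇒ all λ f₃ → neg (f₃ ≐ 0F) ⇒
  distinct f₀ (1F ⊕ f₁) (2F ⊕ f₂) (3F ⊕ f₃) ⇒ let φ = tab f₀ f₁ f₂ f₃ in
  all λ a → φ a ≐ φ 0F ⊕ shear (colour φ) a)
  _ (φ≢0 0F) _ (φ≢0 1F) _ (φ≢0 2F) _ (φ≢0 3F) (inj⇒distinct _ inj) a)

shear-unique : ∀ p q → (∀ a → shear p a ≡ shear q a) → p ≡ q
shear-unique p q h = prove (all λ p → all λ q → shear p 1F ≐ shear q 1F ∧ᶜ shear p 2F ≐ shear q 2F ⇒ p ≐ q) p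
    q (h 1F , h 2F)

twist-unique : ∀ μ ν → (∀ a b → twist μ a b ≡ twist ν a b) → μ ≡ ν
twist-unique μ ν h = prove (all λ p → all λ q → twist p 1F 1F ≐ twist q 1F 1F ∧ᶜ twist p 2F 2F ≐ twist q 2F
    2F ⇒ p ≐ q) μ ν (h 1F 1F , h 2F 2F)

==-sound : ∀ a b → (a == b) ≡ true → a ≡ b
==-sound = prove (all λ a → all λ b → (a == b) ≐ᵇ true ⇒ a ≐ b)

==-refl : ∀ a → (a == a) ≡ true
==-refl = prove (all λ a → (a == a) ≐ᵇ true)

-- The difference u of two operations on a plane is c at a base point; P η and Q ξ are the
-- colours of its lines. A cell compares the two ways of reaching the point (ξ , η).
cell : V → V → V → V → V → V → V → V → Claim
cell ν c p₀ q₀ ξ η p q =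
  shear p₀ ξ ⊕ shear q (η ⊕ twist ν ξ η) ≐ shear q₀ η ⊕ shear p (ξ ⊕ twist ν ξ η) ∧ᶜ
  neg (c ≐ shear p₀ ξ ⊕ shear q (η ⊕ twist ν ξ η))

Coloured : V → V → (V → V) → (V → V) → Set
Coloured ν c P Q = c ≢ 0F × (∀ ξ η → ⟦ cell ν c (P 0F) (Q 0F) ξ η (P η) (Q ξ) ⟧)

-- In effect, on a flat plane with `p₀` nonzero, `u` is `c` plus a multiple of `p₀`, and the
-- coefficient is a Boolean function of the bits `p₀ · ξ` and `p₀ · η`. The last rule concerns the
-- functions whose dependence on the first bit disappears when the second one flips.
flatRules : V → V → V → V → V → V → V → Claim
flatRules p₀ q₀ η θ pη pθ qθ = neg (p₀ ≐ 0F) ⇒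
  (pη ≐ p₀ ∨ᶜ pη ≐ 0F) ∧ᶜ
  (p₀ · η ≐ᵇ p₀ · θ ⇒ pη ≐ pθ) ∧ᶜ
  (neg (q₀ ≐ 0F) ⇒ p₀ ≐ q₀) ∧ᶜ
  (pη ≐ 0F ⇒ p₀ · θ ≐ᵇ true ⇒ (q₀ ≐ p₀ ∧ᶜ qθ ≐ 0F) ∨ᶜ (q₀ ≐ 0F ∧ᶜ qθ ≐ p₀))

-- Call a line active if `ν` is not orthogonal to its colour. If both base lines are active, all
-- lines of the plane have one colour. If only the first is, the parallel lines alternate between
-- `p₀` and `p₀ ⊕ ν`, while a line of the other direction has colour `ν` or `0F` according to the
-- bit `ν · u` where it meets the base line.
twistedRules : V → V → V → V → V → V → V → Claim
twistedRules ν c p₀ q₀ η pη qη = ν · p₀ ≐ᵇ true ⇒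
  (ν · pη ≐ᵇ true) ∧ᶜ
  (ν · q₀ ≐ᵇ true ⇒ pη ≐ p₀ ∧ᶜ qη ≐ p₀) ∧ᶜ
  (ν · q₀ ≐ᵇ false ⇒ pη ≐ p₀ ⊕ (ν · η) ⊛ ν ∧ᶜ qη ≐ (ν · (c ⊕ shear p₀ η)) ⊛ ν)

rules : V → V → V → V → V → V → V → V → V → V → Claim
rules ν c p₀ q₀ η θ pη pθ qη qθ =
  (ν ≐ 0F ⇒ flatRules p₀ q₀ η θ pη pθ qθ) ∧ᶜ (neg (ν ≐ 0F) ⇒ twistedRules ν c p₀ q₀ η pη qη)

coloured-rules : ∀ {ν c P Q} → Coloured ν c P Q → ∀ η θ → ⟦ rules ν c (P 0F) (Q 0F) η θ (P η) (P θ) (Q η)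
    (Q θ) ⟧
coloured-rules {ν} {c} {P} {Q} (c≢0 , cells) η θ
  rewrite tab-correct P η | tab-correct P θ | tab-correct Q η | tab-correct Q θ = prove (
  all λ ν → all λ c → neg (c ≐ 0F) ⇒
  all λ p₀ → let C = cell ν c p₀ in all λ q₀ →
  all λ p₁ → all λ q₁ → C q₀ 1F 1F p₁ q₁ ⇒ C q₀ 0F 1F p₁ q₀ ⇒ C q₀ 1F 0F p₀ q₁ ⇒
  all λ p₂ → C q₀ 1F 2F p₂ q₁ ⇒ C q₀ 0F 2F p₂ q₀ ⇒
  all λ q₂ → C q₀ 2F 1F p₁ q₂ ⇒ C q₀ 2F 2F p₂ q₂ ⇒ C q₀ 2F 0F p₀ q₂ ⇒
  all λ p₃ → C q₀ 1F 3F p₃ q₁ ⇒ C q₀ 2F 3F p₃ q₂ ⇒ C q₀ 0F 3F p₃ q₀ ⇒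
  all λ q₃ → C q₀ 3F 1F p₁ q₃ ⇒ C q₀ 3F 2F p₂ q₃ ⇒ C q₀ 3F 3F p₃ q₃ ⇒ C q₀ 3F 0F p₀ q₃ ⇒
  let P = tab p₀ p₁ p₂ p₃ ; Q = tab q₀ q₁ q₂ q₃ in
  all λ η → all λ θ → rules ν c p₀ q₀ η θ (P η) (P θ) (Q η) (Q θ))
  ν c c≢0 (P 0F) (Q 0F) (P 1F) (Q 1F) (cells 1F 1F) (cells 0F 1F) (cells 1F 0F)
  (P 2F) (cells 1F 2F) (cells 0F 2F) (Q 2F) (cells 2F 1F) (cells 2F 2F) (cells 2F 0F)
  (P 3F) (cells 1F 3F) (cells 2F 3F) (cells 0F 3F) (Q 3F) (cells 3F 1F) (cells 3F 2F) (cells 3F 3F)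
      (cells 3F 0F)
  η θ

-- F is a Boolean function on a plane, affine in κ · _ along every line, with slopes A and B.
slopes : ∀ κ ν (A B : V → Bool) → κ ≢ 0F →
  (∀ a b → (κ · a ∧ A 0F) xor (κ · (b ⊕ twist ν a b) ∧ B a) ≡ (κ · b ∧ B 0F) xor
      (κ · (a ⊕ twist ν a b) ∧ A b)) →
  let E = A (unit κ) xor A 0F in
  (∀ b → A b ≡ A 0F xor (κ · b ∧ E)) × (∀ a → B a ≡ B 0F xor (κ · a ∧ E)) ×
  (κ · ν ≡ true → A 0F ≡ B 0F)
slopes κ ν A B κ≢0 h =
  (λ b → trans (tab-correct A b) (trans (proj₁ check b) (cong (λ e → A 0F xor (κ · b ∧ e)) (sym E-tab)))) ,
  (λ a → trans (tab-correct B a)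
      (trans (proj₁ (proj₂ check) a) (cong (λ e → B 0F xor (κ · a ∧ e)) (sym E-tab)))) ,
  proj₂ (proj₂ check)
  where
  eqn : V → V → Bool → Bool → Bool → Bool → V → V → Claim
  eqn κ ν A₀ B₀ A B a b =
    (κ · a ∧ A₀) xor (κ · (b ⊕ twist ν a b) ∧ B) ≐ᵇ (κ · b ∧ B₀) xor (κ · (a ⊕ twist ν a b) ∧ A)
  check = prove (
    all λ κ → neg (κ ≐ 0F) ⇒ all λ ν → allᵇ λ A₀ → allᵇ λ B₀ → let e = eqn κ ν A₀ B₀ in
    allᵇ λ A₁ → e A₁ B₀ 0F 1F ⇒ allᵇ λ B₁ → e A₀ B₁ 1F 0F ⇒ e A₁ B₁ 1F 1F ⇒
    allᵇ λ A₂ → e A₂ B₁ 1F 2F ⇒ allᵇ λ B₂ → e A₁ B₂ 2F 1F ⇒ e A₂ B₂ 2F 2F ⇒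
    allᵇ λ A₃ → e A₃ B₁ 1F 3F ⇒ e A₃ B₂ 2F 3F ⇒ allᵇ λ B₃ → e A₁ B₃ 3F 1F ⇒ e A₂ B₃ 3F 2F ⇒ e A₃ B₃ 3F 3F ⇒
    let A = tab A₀ A₁ A₂ A₃ ; B = tab B₀ B₁ B₂ B₃ ; E = A (unit κ) xor A₀ in
    (all λ b → A b ≐ᵇ A₀ xor (κ · b ∧ E)) ∧ᶜ (all λ a → B a ≐ᵇ B₀ xor (κ · a ∧ E)) ∧ᶜ
        (κ · ν ≐ᵇ true ⇒ A₀ ≐ᵇ B₀))
    κ κ≢0 ν (A 0F) (B 0F) (A 1F) (h 0F 1F) (B 1F) (h 1F 0F) (h 1F 1F) (A 2F) (h 1F 2F) (B 2F) (h 2F 1F)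
        (h 2F 2F)
    (A 3F) (h 1F 3F) (h 2F 3F) (B 3F) (h 3F 1F) (h 3F 2F) (h 3F 3F)
  E-tab = cong (_xor A 0F) (tab-correct A (unit κ))

-- Points and lines

Pt : ℕ → Set
Pt = Vec V

Mask : ℕ → Set
Mask m = Fin m → Bool

∁ : ∀ {m} → Mask m → Mask m
∁ D l = not (D l)

same : ∀ {m} (i j : Fin m) → i ≡ j ⊎ i ≢ j
same i j with i ≟ j
... | yes i≡j = inj₁ i≡j
... | no i≢j  = inj₂ i≢j

module _ {A : Set} where

  -- A record, so that `D`, `x` and `y` can be inferred from a proof.
  record Agree {m} (D : Mask m) (x y : Vec A m) : Set where
    constructor agree
    field off : ∀ l → D l ≡ false → lookup x l ≡ lookup y l

  open Agree public

  -- The entries of `x` are replaced by those of `y` one coordinate at a time. Whatever must be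
  -- known about intermediate points has to be part of `P`.
  walk : ∀ {m} (D : Mask m) (P : Vec A m → Set) →
    (∀ x l v → D l ≡ true → P x → P (x [ l ]≔ v)) → ∀ x y → Agree D x y → P x → P y
  walk D P step [] [] _ p = p
  walk D P step (a ∷ x) (b ∷ y) x~y p =
    walk (D ∘ suc) (P ∘ (b ∷_)) (λ z l → step (b ∷ z) (suc l)) x y (agree (off x~y ∘ suc)) first
    where
    first : P (b ∷ x)
    first with bool-case (D zero)
    ... | inj₁ D0 = step (a ∷ x) zero b D0 p
    ... | inj₂ ¬D0 = subst (λ c → P (c ∷ x)) (off x~y zero ¬D0) p

  vec-ext : ∀ {m} (x y : Vec A m) → (∀ l → lookup x l ≡ lookup y l) → x ≡ y
  vec-ext x y h = trans (sym (tabulate∘lookup x)) (trans (tabulate-cong h) (tabulate∘lookup y))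

  merge : ∀ {m} → Mask m → Vec A m → Vec A m → Vec A m
  merge D x y = tabulate λ l → if D l then lookup x l else lookup y l

  merge-in : ∀ {m} (D : Mask m) x y l → D l ≡ true → lookup (merge D x y) l ≡ lookup x l
  merge-in D x y l Dl = trans (lookup∘tabulate _ l) (cong (λ b → if b then lookup x l else lookup y l) Dl)

  merge-out : ∀ {m} (D : Mask m) x y l → D l ≡ false → lookup (merge D x y) l ≡ lookup y l
  merge-out D x y l Dl = trans (lookup∘tabulate _ l) (cong (λ b → if b then lookup x l else lookup y l) Dl)

  merge-unique : ∀ {m} (D : Mask m) x y z → (∀ l → D l ≡ true → lookup z l ≡ lookup x l) →
    (∀ l → D l ≡ false → lookup z l ≡ lookup y l) → merge D x y ≡ z
  merge-unique D x y z z-in z-out = vec-ext (merge D x y) z λ l → at l (bool-case (D l))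
    where
    at : ∀ l → D l ≡ true ⊎ D l ≡ false → lookup (merge D x y) l ≡ lookup z l
    at l (inj₁ Dl) = trans (merge-in D x y l Dl) (sym (z-in l Dl))
    at l (inj₂ Dl) = trans (merge-out D x y l Dl) (sym (z-out l Dl))

  merge-self : ∀ {m} (D : Mask m) x → merge D x x ≡ x
  merge-self D x = merge-unique D x x x (λ _ _ → refl) (λ _ _ → refl)

  merge-merge : ∀ {m} (D : Mask m) x y → merge D (merge D x y) x ≡ x
  merge-merge D x y = merge-unique D (merge D x y) x x (λ l Dl → sym (merge-in D x y l Dl)) (λ _ _ → refl)

  lookup-update-cong : ∀ {m} (x y : Vec A m) i l v → lookup x i ≡ lookup y i → lookup (x [ l ]≔ v) i ≡ lookup
      (y [ l ]≔ v) i
  lookup-update-cong x y i l v h with same i l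
  ... | inj₁ refl = trans (lookup∘update i x v) (sym (lookup∘update i y v))
  ... | inj₂ i≢l  = trans (lookup∘update′ i≢l x v) (trans h (sym (lookup∘update′ i≢l y v)))

  mask-≢ : ∀ {m} {D : Mask m} {i j} → D i ≡ true → D j ≡ false → i ≢ j
  mask-≢ Di Dj refl = bool-clash Di Dj

  merge-update : ∀ {m} (D : Mask m) x y l v → D l ≡ true → merge D (x [ l ]≔ v) y ≡ merge D x y [ l ]≔ v
  merge-update D x y l v Dl = merge-unique D (x [ l ]≔ v) y (merge D x y [ l ]≔ v)
    (λ i Di → lookup-update-cong (merge D x y) x i l v (merge-in D x y i Di))
    (λ i Di → trans (lookup∘update′ (mask-≢ {D = D} Dl Di ∘ sym) (merge D x y) v) (merge-out D x y i Di))

  merge-updateʳ : ∀ {m} (D : Mask m) x y l v → D l ≡ false → merge D x (y [ l ]≔ v) ≡ merge D x y [ l ]≔ v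
  merge-updateʳ D x y l v Dl = merge-unique D x (y [ l ]≔ v) (merge D x y [ l ]≔ v)
    (λ i Di → trans (lookup∘update′ (mask-≢ {D = D} Di Dl) (merge D x y) v) (merge-in D x y i Di))
    (λ i Di → lookup-update-cong (merge D x y) y i l v (merge-out D x y i Di))

  merge-ignoreˡ : ∀ {m} (D : Mask m) x y l v → D l ≡ false → merge D (x [ l ]≔ v) y ≡ merge D x y
  merge-ignoreˡ D x y l v Dl = merge-unique D (x [ l ]≔ v) y (merge D x y)
    (λ i Di → trans (merge-in D x y i Di) (sym (lookup∘update′ (mask-≢ {D = D} Di Dl) x v))) (merge-out D x y)

  merge-ignoreʳ : ∀ {m} (D : Mask m) x y l v → D l ≡ true → merge D x (y [ l ]≔ v) ≡ merge D x y
  merge-ignoreʳ D x y l v Dl = merge-unique D x (y [ l ]≔ v) (merge D x y) (merge-in D x y)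
    (λ i Di → trans (merge-out D x y i Di) (sym (lookup∘update′ (mask-≢ {D = D} Dl Di ∘ sym) y v)))

  merge-agreed : ∀ {m} (D : Mask m) x y → Agree D x y → merge D y x ≡ y
  merge-agreed D x y x~y = merge-unique D y x y (λ _ _ → refl) (λ l Dl → sym (off x~y l Dl))

  merge-agree : ∀ {m} (D : Mask m) x y → Agree (∁ D) x (merge D x y)
  merge-agree D x y = agree λ l Dl → sym (merge-in D x y l (not-false⁻¹ Dl))

  agree-refl : ∀ {m} (D : Mask m) x → Agree D x x
  agree-refl D x = agree λ l _ → refl

  agree-sym : ∀ {m} {D : Mask m} {x y} → Agree D x y → Agree D y x
  agree-sym h = agree λ l Dl → sym (off h l Dl)

  agree-trans : ∀ {m} {D : Mask m} {x y z} → Agree D x y → Agree D y z → Agree D x z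
  agree-trans h k = agree λ l Dl → trans (off h l Dl) (off k l Dl)

  agree-update : ∀ {m} {D : Mask m} {x y} l v → D l ≡ true → Agree D x y → Agree D x (y [ l ]≔ v)
  agree-update {D = D} {x} {y} l v Dl h = agree λ k Dk → trans (off h k Dk)
      (sym (lookup∘update′ (k≢l Dk) y v))
    where
    k≢l : ∀ {k} → D k ≡ false → k ≢ l
    k≢l Dk refl = bool-clash Dl Dk

  agree-merge : ∀ {m} (D : Mask m) x y → Agree D y (merge D x y)
  agree-merge D x y = agree λ l Dl → sym (merge-out D x y l Dl)

  update-lookup : ∀ {m} (x : Vec A m) i {v} → v ≡ lookup x i → x [ i ]≔ v ≡ x
  update-lookup x i refl = []≔-lookup x i

  everywhere : ∀ {m} (P : Vec A m → Set) → (∀ x l v → P x → P (x [ l ]≔ v)) → ∀ x y → P x → P y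
  everywhere P step x y = walk (λ _ → true) P (λ x l v _ → step x l v) x y (agree λ _ ())

Injective : ∀ {m} → (Pt m → V) → Set
Injective f = ∀ i x v w → f (x [ i ]≔ v) ≡ f (x [ i ]≔ w) → v ≡ w

module Quasi {m : ℕ} (f : Pt m → V) (f-inj : Injective f) where

  diff : Fin m → V → Pt m → V
  diff i v x = f x ⊕ f (x [ i ]≔ v)

  opaque
    -- Points of a line are named by the increment of `f`, not by their entry. In these terms `mv i`
    -- is an action of `V` whose orbits are the lines in direction `i`.
    pos : Fin m → V → Pt m → V
    pos i d x = inverse (λ v → f (x [ i ]≔ v)) (f x ⊕ d)

    mv : Fin m → V → Pt m → Pt m
    mv i d x = x [ i ]≔ pos i d x

    mv-def : ∀ i d x → mv i d x ≡ x [ i ]≔ pos i d x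
    mv-def i d x = refl

    f-mv : ∀ i d x → f (mv i d x) ≡ f x ⊕ d
    f-mv i d x = inverse-correct (λ v → f (x [ i ]≔ v)) (f-inj i x) (f x ⊕ d)

    pos-unique : ∀ i d x v → f (x [ i ]≔ v) ≡ f x ⊕ d → v ≡ pos i d x
    pos-unique i d x v h = f-inj i x _ _ (trans h (sym (f-mv i d x)))

    mv-unique : ∀ i d x v → f (x [ i ]≔ v) ≡ f x ⊕ d → x [ i ]≔ v ≡ mv i d x
    mv-unique i d x v h = cong (x [ i ]≔_) (pos-unique i d x v h)

    update-mv : ∀ i v x → x [ i ]≔ v ≡ mv i (diff i v x) x
    update-mv i v x = mv-unique i _ x v (sym (⊕-involutiveˡ (f x) _))

    pos-0 : ∀ i x → pos i 0F x ≡ lookup x i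
    pos-0 i x = sym (pos-unique i 0F x _ (trans (cong f ([]≔-lookup x i)) (sym (⊕-identityʳ (f x)))))

    mv-0 : ∀ i x → mv i 0F x ≡ x
    mv-0 i x = update-lookup x i (pos-0 i x)

    mv-mv : ∀ i d e x → mv i d (mv i e x) ≡ mv i (e ⊕ d) x
    mv-mv i d e x = trans ([]≔-idempotent x i) (mv-unique i (e ⊕ d) x _ (begin
      f (x [ i ]≔ pos i d (mv i e x)) ≡⟨ cong f (sym ([]≔-idempotent x i)) ⟩
      f (mv i d (mv i e x))           ≡⟨ f-mv i d (mv i e x) ⟩
      f (mv i e x) ⊕ d                ≡⟨ cong (_⊕ d) (f-mv i e x) ⟩
      f x ⊕ e ⊕ d                     ≡⟨ ⊕-assoc (f x) e d ⟩
      f x ⊕ (e ⊕ d)                   ∎))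
      where open ≡-Reasoning

    mv-back : ∀ i d x → mv i d (mv i d x) ≡ x
    mv-back i d x = trans (mv-mv i d d x) (trans (cong (λ e → mv i e x) (⊕-self d)) (mv-0 i x))

    lookup-mv : ∀ {i j} d x → j ≢ i → lookup (mv i d x) j ≡ lookup x j
    lookup-mv d x j≢i = lookup∘update′ j≢i x _

  record IsTwist (i j : Fin m) (x : Pt m) (ν : V) : Set where
    constructor twisted
    field law : ∀ v w →
            f ((x [ i ]≔ v) [ j ]≔ w) ≡ f (x [ i ]≔ v) ⊕ f (x [ j ]≔ w) ⊕ f x ⊕ twist ν (diff i v x)
                (diff j w x)

  open IsTwist public

  opaque
    unfolding mv

    diff-pos : ∀ i a x → diff i (pos i a x) x ≡ a
    diff-pos i a x = trans (cong (f x ⊕_) (f-mv i a x)) (⊕-involutiveˡ (f x) a)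

    -- The plane through x in the directions i ≢ j is the table twisted by ν i j x; on the
    -- diagonal ν is 0F by convention.
    ν : Fin m → Fin m → Pt m → V
    ν i j x with i ≟ j
    ... | yes _ = 0F
    ... | no _ = classify λ a b → f x ⊕ f (mv i a x [ j ]≔ pos j b x)

    ν-twist : ∀ {i j} → i ≢ j → ∀ x → IsTwist i j x (ν i j x)
    ν-twist {i} {j} i≢j x with i ≟ j
    ... | yes i≡j = contradiction i≡j i≢j
    ... | no _ = twisted λ v w → begin
      f ((x [ i ]≔ v) [ j ]≔ w)
        ≡⟨ cong₂ (λ v w → f ((x [ i ]≔ v) [ j ]≔ w)) (pos-unique i _ x v (sym (⊕-involutiveˡ (f x) _)))
             (pos-unique j _ x w (sym (⊕-involutiveˡ (f x) _))) ⟩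
      f (mv i (diff i v x) x [ j ]≔ pos j (diff j w x) x)
        ≡⟨ sym (⊕-involutiveˡ (f x) _) ⟩
      f x ⊕ F (diff i v x) (diff j w x)
        ≡⟨ cong (f x ⊕_) (classify-correct F F-0 0-F row col _ _) ⟩
      f x ⊕ (diff i v x ⊕ diff j w x ⊕ twist (classify F) (diff i v x) (diff j w x))
        ≡⟨ prove (all λ a → all λ b → all λ c → all λ t →
             a ⊕ ((a ⊕ b) ⊕ (a ⊕ c) ⊕ t) ≐ b ⊕ c ⊕ a ⊕ t) (f x) (f (x [ i ]≔ v)) (f (x [ j ]≔ w)) _ ⟩
      f (x [ i ]≔ v) ⊕ f (x [ j ]≔ w) ⊕ f x ⊕ twist (classify F) (diff i v x) (diff j w x) ∎
      where
      open ≡-Reasoning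
      -- Increments as coordinates and the subtraction of `f x` turn the plane into a reduced latin
      -- square.
      F : V → V → V
      F a b = f x ⊕ f (mv i a x [ j ]≔ pos j b x)
      F-0 : ∀ a → F a 0F ≡ a
      F-0 a = trans (cong (λ y → f x ⊕ f y) (update-lookup (mv i a x) j
        (trans (pos-0 j x) (sym (lookup-mv a x (i≢j ∘ sym))))))
        (trans (cong (f x ⊕_) (f-mv i a x)) (⊕-involutiveˡ (f x) a))
      0-F : ∀ b → F 0F b ≡ b
      0-F b = trans (cong (λ y → f x ⊕ f (y [ j ]≔ pos j b x)) (mv-0 i x))
        (trans (cong (f x ⊕_) (f-mv j b x)) (⊕-involutiveˡ (f x) b))
      pos-inj : ∀ k a b → pos k a x ≡ pos k b x → a ≡ b
      pos-inj k a b h = ⊕-cancelˡ (f x) a b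
        (trans (sym (f-mv k a x)) (trans (cong (λ p → f (x [ k ]≔ p)) h) (f-mv k b x)))
      row : ∀ a → InjV (F a)
      row a b b′ h = pos-inj j b b′ (f-inj j (mv i a x) _ _ (⊕-cancelˡ (f x) _ _ h))
      col : ∀ b → InjV (λ a → F a b)
      col b a a′ h = pos-inj i a a′ (f-inj i (x [ j ]≔ pos j b x) _ _
        (trans (cong f ([]≔-commutes x j i (i≢j ∘ sym)))
        (trans (⊕-cancelˡ (f x) _ _ h) (cong f ([]≔-commutes x i j i≢j)))))

    ν-diag : ∀ i x → ν i i x ≡ 0F
    ν-diag i x with i ≟ i
    ... | yes _  = refl
    ... | no i≢i = contradiction refl i≢i

  IsTwist-unique : ∀ {i j x μ ν} → IsTwist i j x μ → IsTwist i j x ν → μ ≡ ν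
  IsTwist-unique {i} {j} {x} {μ} {ν} h k = twist-unique μ ν λ a b →
    subst₂ (λ a b → twist μ a b ≡ twist ν a b) (diff-pos i a x) (diff-pos j b x)
    (⊕-cancelˡ _ _ _ (trans (sym (law h _ _)) (law k _ _)))

  IsTwist-sym : ∀ {i j x μ} → i ≢ j → IsTwist i j x μ → IsTwist j i x μ
  IsTwist-sym {i} {j} {x} {μ} i≢j h = twisted λ v w → trans (cong f ([]≔-commutes x j i (i≢j ∘ sym)))
    (trans (law h w v) (prove (all λ μ → all λ a → all λ b → all λ c →
      b ⊕ c ⊕ a ⊕ twist μ (a ⊕ b) (a ⊕ c) ≐ c ⊕ b ⊕ a ⊕ twist μ (a ⊕ c) (a ⊕ b))
      μ (f x) (f (x [ i ]≔ w)) (f (x [ j ]≔ v))))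

  -- A group table re-based at another element is a table of the same group with the same twist;
  -- evaluation confirms it. Hence `ν i j` depends only on the coordinates other than `i` and `j`.
  IsTwist-update : ∀ {i j x μ} → i ≢ j → IsTwist i j x μ → ∀ v → IsTwist i j (x [ i ]≔ v) μ
  IsTwist-update {i} {j} {x} {μ} i≢j h v = twisted λ v′ w →
    trans (cong (λ y → f (y [ j ]≔ w)) ([]≔-idempotent x i))
    (trans (law h v′ w)
    (trans (prove (all λ μ → all λ c → all λ a → all λ a′ → all λ b →
      let b′ = a ⊕ b ⊕ c ⊕ twist μ (c ⊕ a) (c ⊕ b) in
      a′ ⊕ b ⊕ c ⊕ twist μ (c ⊕ a′) (c ⊕ b) ≐ a′ ⊕ b′ ⊕ a ⊕ twist μ (a ⊕ a′) (a ⊕ b′))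
      μ (f x) (f (x [ i ]≔ v)) (f (x [ i ]≔ v′)) (f (x [ j ]≔ w)))
    (cong₂ (λ p q → p ⊕ q ⊕ f (x [ i ]≔ v) ⊕ twist μ (f (x [ i ]≔ v) ⊕ p) (f (x [ i ]≔ v) ⊕ q))
      (cong f (sym ([]≔-idempotent x i))) (sym (law h v w)))))

  ν-unique : ∀ {i j} → i ≢ j → ∀ x {μ} → IsTwist i j x μ → ν i j x ≡ μ
  ν-unique i≢j x h = IsTwist-unique (ν-twist i≢j x) h

  ν-sym : ∀ i j x → ν i j x ≡ ν j i x
  ν-sym i j x with same i j
  ... | inj₁ refl = refl
  ... | inj₂ i≢j  = ν-unique i≢j x (IsTwist-sym (i≢j ∘ sym) (ν-twist (i≢j ∘ sym) x))

  ν-updateˡ : ∀ i j x v → ν i j (x [ i ]≔ v) ≡ ν i j x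
  ν-updateˡ i j x v with same i j
  ... | inj₁ refl = trans (ν-diag i _) (sym (ν-diag i x))
  ... | inj₂ i≢j  = ν-unique i≢j (x [ i ]≔ v) (IsTwist-update i≢j (ν-twist i≢j x) v)

  ν-updateʳ : ∀ i j x v → ν i j (x [ j ]≔ v) ≡ ν i j x
  ν-updateʳ i j x v = trans (ν-sym i j _) (trans (ν-updateˡ j i x v) (ν-sym j i x))

  opaque
    unfolding mv

    corner : ∀ {i j} → i ≢ j → ∀ x a b →
      mv i a x [ j ]≔ pos j b x ≡ mv j (b ⊕ twist (ν i j x) a b) (mv i a x)
    corner {i} {j} i≢j x a b = mv-unique j _ (mv i a x) _ (trans (law (ν-twist i≢j x) _ _)
      (trans (cong₂ (λ a′ b′ → f (mv i a x) ⊕ f (mv j b x) ⊕ f x ⊕ twist (ν i j x) a′ b′) (diff-pos i a x)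
          (diff-pos j b x))
      (trans (cong (λ c → f (mv i a x) ⊕ c ⊕ f x ⊕ twist (ν i j x) a b) (f-mv j b x))
      (prove (all λ a → all λ b → all λ c → all λ t → a ⊕ (c ⊕ b) ⊕ c ⊕ t ≐ a ⊕ (b ⊕ t)) (f (mv i a x)) b
          (f x) _))))

    -- Both sides are one corner of the plane, reached in the two orders. The twist is the failure
    -- of two actions of `V` to commute.
    mv-comm : ∀ {i j} → i ≢ j → ∀ x a b →
      let t = twist (ν i j x) a b in mv j (b ⊕ t) (mv i a x) ≡ mv i (a ⊕ t) (mv j b x)
    mv-comm {i} {j} i≢j x a b = trans (sym (corner i≢j x a b)) (trans ([]≔-commutes x i j i≢j)
      (trans (corner (i≢j ∘ sym) x b a)
      (cong (λ t → mv i (a ⊕ t) (mv j b x)) (trans (cong (λ n → twist n b a) (ν-sym j i x))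
          (twist-comm (ν i j x) b a)))))
      where
      twist-comm : ∀ n a b → twist n a b ≡ twist n b a
      twist-comm = prove (all λ n → all λ a → all λ b → twist n a b ≐ twist n b a)

  mv-comm₀ : ∀ {i j} → i ≢ j → ∀ x a b → twist (ν i j x) a b ≡ 0F → mv j b (mv i a x) ≡ mv i a (mv j b x)
  mv-comm₀ {i} {j} i≢j x a b h = subst₂ (λ a′ b′ → mv j b′ (mv i a x) ≡ mv i a′ (mv j b x))
    (trans (cong (a ⊕_) h) (⊕-identityʳ a)) (trans (cong (b ⊕_) h) (⊕-identityʳ b)) (mv-comm i≢j x a b)

-- Separated sets and derivatives

xor-true : ∀ {a b} → a xor b ≡ true → a ≢ b
xor-true {true} {false} _ ()
xor-true {false} {true} _ ()

xor-false : ∀ {a b} → a xor b ≡ false → a ≡ b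
xor-false {true} {true} _ = refl
xor-false {false} {false} _ = refl

-- For a fixed κ ≢ 0F the functional κ · _ plays the role of a coordinate of V.
module Functional {m : ℕ} (f : Pt m → V) (f-inj : Injective f) (κ : V) (κ≢0 : κ ≢ 0F) where

  open Quasi f f-inj

  record Sep (D : Mask m) : Set where
    constructor separated
    field additive : ∀ i j x → D i ≡ true → D j ≡ false → κ · ν i j x ≡ false

  open Sep public

  sep-≢ : ∀ {D : Mask m} {i j} → D i ≡ true → D j ≡ false → i ≢ j
  sep-≢ Di Dj refl = bool-clash Di Dj

  Sep-∁ : ∀ {D} → Sep D → Sep (∁ D)
  Sep-∁ sep = separated λ i j x Di Dj →
    trans (cong (κ ·_) (ν-sym i j x)) (additive sep j i x (not-false⁻¹ Dj) (not-true⁻¹ Di))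

  cross : Fin m → Fin m → V → V → Pt m → Bool
  cross i j v w x = κ · (f ((x [ i ]≔ v) [ j ]≔ w) ⊕ f (x [ i ]≔ v) ⊕ f (x [ j ]≔ w) ⊕ f x)

  cross-twist : ∀ {i j} → i ≢ j → ∀ v w x → cross i j v w x ≡ κ · twist (ν i j x) (diff i v x) (diff j w x)
  cross-twist {i} {j} i≢j v w x =
      cong (κ ·_) (trans (cong (λ a → a ⊕ f (x [ i ]≔ v) ⊕ f (x [ j ]≔ w) ⊕ f x) (law (ν-twist i≢j x) v w))
    (prove (all λ a → all λ b → all λ c → all λ t → a ⊕ b ⊕ c ⊕ t ⊕ a ⊕ b ⊕ c ≐ t) (f (x [ i ]≔ v))
        (f (x [ j ]≔ w)) (f x) (twist (ν i j x) (diff i v x) (diff j w x))))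

  cross-add : ∀ {i j} → i ≢ j → ∀ v w x → κ · ν i j x ≡ false → cross i j v w x ≡ false
  cross-add {i} {j} i≢j v w x h = trans (cross-twist i≢j v w x)
      (·-twist κ (ν i j x) (diff i v x) (diff j w x) h)

  cross⇒additive : ∀ {i j} → i ≢ j → ∀ x → (∀ v w → cross i j v w x ≡ false) → κ · ν i j x ≡ false
  cross⇒additive {i} {j} i≢j x h with bool-case (κ · ν i j x)
  ... | inj₂ additive = additive
  ... | inj₁ nonadd = bool-clash (trans (cross-twist i≢j v w x) (trans
      (cong₂ (λ a b → κ · twist n a b) (diff-pos i (unit n) x) (diff-pos j (unit n) x))
      (prove (all λ κ → all λ n → κ · n ≐ᵇ true ⇒ κ · twist n (unit n) (unit n) ≐ᵇ true) κ n nonadd))) (h v w)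
    where
    n = ν i j x
    -- As `n · unit n` is true, the increments `unit n` in both directions make the twist equal to
    -- `n` itself, and `κ · n` is true.
    v = pos i (unit n) x
    w = pos j (unit n) x

  -- The third difference of `κ · f` is the change along `i` of the second difference in directions
  -- `j` and `l`, which vanishes.
  cross-const : ∀ {i j l} → i ≢ j → i ≢ l → j ≢ l → ∀ v w u x → (∀ y → κ · ν i l y ≡ false) →
      (∀ y → κ · ν j l y ≡ false) →
    cross i j v w (x [ l ]≔ u) ≡ cross i j v w x
  cross-const {i} {j} {l} i≢j i≢l j≢l v w u x il jl =
    trans (cong₂ (λ a b → κ · (f a ⊕ f b ⊕ f ((x [ l ]≔ u) [ j ]≔ w) ⊕ f (x [ l ]≔ u)))
      (trans (cong (_[ j ]≔ w) (commute i≢l x)) (commute j≢l _)) (commute i≢l x))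
    (trans (cong (λ a → κ · (f (((x [ i ]≔ v) [ j ]≔ w) [ l ]≔ u) ⊕ f ((x [ i ]≔ v) [ l ]≔ u) ⊕ f a ⊕ f
        (x [ l ]≔ u)))
      (commute j≢l x))
    (combine κ (f (((x [ i ]≔ v) [ j ]≔ w) [ l ]≔ u)) (f ((x [ i ]≔ v) [ j ]≔ w)) (f ((x [ i ]≔ v) [ l ]≔ u))
        (f (x [ i ]≔ v))
      (f ((x [ j ]≔ w) [ l ]≔ u)) (f (x [ j ]≔ w)) (f (x [ l ]≔ u)) (f x)
          (cross-add j≢l w u (x [ i ]≔ v) (jl _)) (cross-add j≢l w u x (jl _))))
    where
    commute : ∀ {k w} → k ≢ l → ∀ y → (y [ l ]≔ u) [ k ]≔ w ≡ (y [ k ]≔ w) [ l ]≔ u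
    commute {k} k≢l y = []≔-commutes y l k (k≢l ∘ sym)
    combine : ∀ κ a b c d a′ b′ c′ d′ → κ · (a ⊕ b ⊕ c ⊕ d) ≡ false → κ · (a′ ⊕ b′ ⊕ c′ ⊕ d′) ≡ false →
      κ · (a ⊕ c ⊕ a′ ⊕ c′) ≡ κ · (b ⊕ d ⊕ b′ ⊕ d′)
    combine κ a b c d a′ b′ c′ d′ h h′ = trans (expand a c a′ c′)
      (trans (xors (κ · a) (κ · b) (κ · c) (κ · d) (κ · a′) (κ · b′) (κ · c′) (κ · d′)
          (trans (sym (expand a b c d)) h) (trans (sym (expand a′ b′ c′ d′)) h′)) (sym (expand b d b′ d′)))
      where
      expand : ∀ a b c d → κ · (a ⊕ b ⊕ c ⊕ d) ≡ ((κ · a xor κ · b) xor κ · c) xor κ · d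
      expand a b c d = trans (·-⊕ κ (a ⊕ b ⊕ c) d)
          (cong (_xor κ · d) (trans (·-⊕ κ (a ⊕ b) c) (cong (_xor κ · c) (·-⊕ κ a b))))
      xors : ∀ a b c d a′ b′ c′ d′ → ((a xor b) xor c) xor d ≡ false → ((a′ xor b′) xor c′) xor d′ ≡ false →
        ((a xor c) xor a′) xor c′ ≡ ((b xor d) xor b′) xor d′
      xors = prove (allᵇ λ a → allᵇ λ b → allᵇ λ c → allᵇ λ d → allᵇ λ a′ → allᵇ λ b′ → allᵇ λ c′ →
          allᵇ λ d′ →
        ((a xor b) xor c) xor d ≐ᵇ false ⇒ ((a′ xor b′) xor c′) xor d′ ≐ᵇ false ⇒
        ((a xor c) xor a′) xor c′ ≐ᵇ ((b xor d) xor b′) xor d′)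

  nonadditive-update : ∀ {i j l} → i ≢ l → j ≢ l → (∀ y → κ · ν i l y ≡ false) → (∀ y → κ · ν j l y ≡ false) →
    ∀ u x → κ · ν i j x ≡ true → κ · ν i j (x [ l ]≔ u) ≡ true
  nonadditive-update {i} {j} {l} i≢l j≢l il jl u x h with bool-case (κ · ν i j (x [ l ]≔ u)) | same i j
  ... | inj₁ t | _ = t
  ... | inj₂ _ | inj₁ refl = bool-clash h (trans (cong (κ ·_) (ν-diag i x)) (·-zeroʳ κ))
  ... | inj₂ ad | inj₂ i≢j = bool-clash h (cross⇒additive i≢j x λ v w →
      trans (sym (cross-const i≢j i≢l j≢l v w u x il jl)) (cross-add i≢j v w _ ad))

  -- This carries a nonadditive plane, wherever it was found, into any slice obtained by changing
  -- the coordinates of the other side.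
  Sep-nonadditive : ∀ {D} → Sep D → ∀ {i j} → D i ≡ D j → ∀ u l x → D l ≡ not (D i) →
    κ · ν i j x ≡ true → κ · ν i j (x [ l ]≔ u) ≡ true
  Sep-nonadditive {D} sep {i} {j} Dij u l x Dl h with bool-case (D i)
  ... | inj₁ Di = nonadditive-update (sep-≢ {D} Di ¬Dl) (sep-≢ {D} Dj ¬Dl) (λ y → additive sep _ _ y Di ¬Dl)
      (λ y → additive sep _ _ y Dj ¬Dl) u x h
    where
    ¬Dl = trans Dl (not-true Di)
    Dj = trans (sym Dij) Di
  ... | inj₂ ¬Di = nonadditive-update (sep-≢ {D} D-l ¬Di ∘ sym) (sep-≢ {D} D-l ¬Dj ∘ sym) (λ y → flip i y ¬Di)
      (λ y → flip j y ¬Dj) u x h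
    where
    D-l = trans Dl (not-false ¬Di)
    ¬Dj = trans (sym Dij) ¬Di
    flip : ∀ k y → D k ≡ false → κ · ν k l y ≡ false
    flip k y ¬Dk = trans (cong (κ ·_) (ν-sym k l y)) (additive sep l k y D-l ¬Dk)

  -- Derivatives of Boolean functions which are affine in κ · f along the lines of D
  -- through the slice Agree D x.
  opaque
    ∂ : Fin m → (Pt m → Bool) → Pt m → Bool
    ∂ l F y = F y xor F (mv l (unit κ) y)

    ∂-def : ∀ l F y → ∂ l F y ≡ F y xor F (mv l (unit κ) y)
    ∂-def l F y = refl

  record InvAt (l : Fin m) (F : Pt m → Bool) (y : Pt m) : Set where
    constructor invAt
    field change : ∀ d → F (mv l d y) ≡ F y xor (κ · d ∧ ∂ l F y)

  open InvAt public

  record Inv (D : Mask m) (x : Pt m) (F : Pt m → Bool) : Set where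
    constructor inv
    field invariant : ∀ y l → Agree D x y → D l ≡ true → InvAt l F y

  open Inv public

  ∂-same : ∀ {i F y} → InvAt i F y → ∀ d → ∂ i F (mv i d y) ≡ ∂ i F y
  ∂-same {i} {F} {y} h d = trans (∂-def i F _)
    (trans (cong₂ _xor_ (change h d) (trans (cong F (mv-mv i (unit κ) d y)) (change h _)))
    (prove (all λ κ → neg (κ ≐ 0F) ⇒ all λ d → allᵇ λ b → allᵇ λ e →
      (b xor (κ · d ∧ e)) xor (b xor (κ · (d ⊕ unit κ) ∧ e)) ≐ᵇ e) κ κ≢0 d (F y) (∂ i F y)))

  -- `F` is evaluated at one corner along the two paths of `mv-comm`, and the resulting equation is
  -- the hypothesis of `slopes`.
  plane-slopes : ∀ {i j F y} → i ≢ j → (∀ b → InvAt i F (mv j b y)) → (∀ a → InvAt j F (mv i a y)) →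
    let E = ∂ j (∂ i F) y in
    (∀ b → ∂ i F (mv j b y) ≡ ∂ i F y xor (κ · b ∧ E)) ×
    (∀ a → ∂ j F (mv i a y) ≡ ∂ j F y xor (κ · a ∧ E)) ×
    (κ · ν i j y ≡ true → ∂ i F y ≡ ∂ j F y)
  plane-slopes {i} {j} {F} {y} i≢j invᵢ invⱼ =
    (λ b → trans (proj₁ s b) (cong₂ (λ a e → a xor (κ · b ∧ e)) A₀ E≡)) ,
    (λ a → trans (proj₁ (proj₂ s) a) (cong₂ (λ b e → b xor (κ · a ∧ e)) B₀ E≡)) ,
    (λ t → trans (sym A₀) (trans (proj₂ (proj₂ s) t) B₀))
    where
    A B : V → Bool
    A b = ∂ i F (mv j b y)
    B a = ∂ j F (mv i a y)
    A₀ : A 0F ≡ ∂ i F y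
    A₀ = cong (∂ i F) (mv-0 j y)
    B₀ : B 0F ≡ ∂ j F y
    B₀ = cong (∂ j F) (mv-0 i y)
    E≡ : A (unit κ) xor A 0F ≡ ∂ j (∂ i F) y
    E≡ = trans (Bool.xor-comm (A (unit κ)) _) (trans (cong (_xor A (unit κ)) A₀) (sym (∂-def j (∂ i F) y)))
    invᵢ₀ : InvAt i F y
    invᵢ₀ = subst (InvAt i F) (mv-0 j y) (invᵢ 0F)
    invⱼ₀ : InvAt j F y
    invⱼ₀ = subst (InvAt j F) (mv-0 i y) (invⱼ 0F)
    s = slopes κ (ν i j y) A B κ≢0 λ a b → let t = twist (ν i j y) a b in
      cancel (F y) (κ · a ∧ A 0F) (κ · (b ⊕ t) ∧ B a) (κ · b ∧ B 0F) (κ · (a ⊕ t) ∧ A b) (begin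
        (F y xor (κ · a ∧ A 0F)) xor (κ · (b ⊕ t) ∧ B a)
          ≡⟨ cong (λ e → (F y xor (κ · a ∧ e)) xor (κ · (b ⊕ t) ∧ B a)) A₀ ⟩
        (F y xor (κ · a ∧ ∂ i F y)) xor (κ · (b ⊕ t) ∧ B a)
          ≡⟨ cong (_xor (κ · (b ⊕ t) ∧ B a)) (sym (change invᵢ₀ a)) ⟩
        F (mv i a y) xor (κ · (b ⊕ t) ∧ B a)
          ≡⟨ sym (change (invⱼ a) (b ⊕ t)) ⟩
        F (mv j (b ⊕ t) (mv i a y))
          ≡⟨ cong F (mv-comm i≢j y a b) ⟩
        F (mv i (a ⊕ t) (mv j b y))
          ≡⟨ change (invᵢ b) (a ⊕ t) ⟩
        F (mv j b y) xor (κ · (a ⊕ t) ∧ A b)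
          ≡⟨ cong (_xor (κ · (a ⊕ t) ∧ A b)) (change invⱼ₀ b) ⟩
        (F y xor (κ · b ∧ ∂ j F y)) xor (κ · (a ⊕ t) ∧ A b)
          ≡⟨ cong (λ e → (F y xor (κ · b ∧ e)) xor (κ · (a ⊕ t) ∧ A b)) (sym B₀) ⟩
        (F y xor (κ · b ∧ B 0F)) xor (κ · (a ⊕ t) ∧ A b) ∎)
      where
      open ≡-Reasoning
      cancel : ∀ c p q p′ q′ → (c xor p) xor q ≡ (c xor p′) xor q′ → p xor q ≡ p′ xor q′
      cancel = prove (allᵇ λ c → allᵇ λ p → allᵇ λ q → allᵇ λ p′ → allᵇ λ q′ →
        (c xor p) xor q ≐ᵇ (c xor p′) xor q′ ⇒ p xor q ≐ᵇ p′ xor q′)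

  agree-mv : ∀ {D : Mask m} {x y} l d → D l ≡ true → Agree D x y → Agree D x (mv l d y)
  agree-mv {D} {x} {y} l d Dl x~y = subst (Agree D x) (sym (mv-def l d y)) (agree-update l (pos l d y) Dl x~y)

  module _ {D : Mask m} {x : Pt m} where

    private
      plane : ∀ {F} → Inv D x F → ∀ {i j} → D i ≡ true → D j ≡ true → ∀ y → Agree D x y → i ≢ j →
        (∀ b → ∂ i F (mv j b y) ≡ ∂ i F y xor (κ · b ∧ ∂ j (∂ i F) y)) ×
        (∀ a → ∂ j F (mv i a y) ≡ ∂ j F y xor (κ · a ∧ ∂ j (∂ i F) y)) ×
        (κ · ν i j y ≡ true → ∂ i F y ≡ ∂ j F y)
      plane h {i} {j} Di Dj y x~y i≢j = plane-slopes i≢j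
        (λ b → invariant h _ i (agree-mv j b Dj x~y) Di) (λ a → invariant h _ j (agree-mv i a Di x~y) Dj)

    ∂-move : ∀ {F} → Inv D x F → ∀ {i j} → D i ≡ true → D j ≡ true → ∀ y → Agree D x y → ∀ b →
      ∂ i F (mv j b y) ≡ ∂ i F y xor (κ · b ∧ ∂ j (∂ i F) y)
    ∂-move {F} h {i} {j} Di Dj y x~y b with same i j
    ... | inj₂ i≢j = proj₁ (plane h Di Dj y x~y i≢j) b
    ... | inj₁ refl = trans (const b)
        (trans (prove (allᵇ λ e → allᵇ λ k → e ≐ᵇ e xor (k ∧ (e xor e))) (∂ i F y) (κ · b))
        (cong (λ e → ∂ i F y xor (κ · b ∧ e)) (trans (cong (∂ i F y xor_) (sym (const (unit κ))))
            (sym (∂-def i (∂ i F) y)))))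
      where
      const : ∀ d → ∂ i F (mv i d y) ≡ ∂ i F y
      const = ∂-same (invariant h y i x~y Di)

    Inv-∂ : ∀ {F} → Inv D x F → ∀ {l} → D l ≡ true → Inv D x (∂ l F)
    Inv-∂ h Dl = inv λ y i x~y Di → invAt λ d → ∂-move h Dl Di y x~y d

    ∂-comm : ∀ {F} → Inv D x F → ∀ {i j} → D i ≡ true → D j ≡ true → ∀ y → Agree D x y →
      ∂ i (∂ j F) y ≡ ∂ j (∂ i F) y
    ∂-comm {F} h {i} {j} Di Dj y x~y with same i j
    ... | inj₁ refl = refl
    ... | inj₂ i≢j = trans (∂-def i (∂ j F) y)
        (trans (cong (∂ j F y xor_) (proj₁ (proj₂ (plane h Di Dj y x~y i≢j)) (unit κ)))
      (trans (cong (λ k → ∂ j F y xor (∂ j F y xor (k ∧ ∂ j (∂ i F) y))) (·-unit κ κ≢0))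
      (prove (allᵇ λ a → allᵇ λ b → a xor (a xor b) ≐ᵇ b) (∂ j F y) (∂ j (∂ i F) y))))

    -- Where the two actions commute only up to some `t` with `κ · t` true, one path of `mv-comm`
    -- charges `t` to `∂ j F` and the other to `∂ i F`.
    ∂-nonadditive : ∀ {F} → Inv D x F → ∀ {i j} → D i ≡ true → D j ≡ true → ∀ y → Agree D x y →
      κ · ν i j y ≡ true → ∂ i F y ≡ ∂ j F y
    ∂-nonadditive h {i} {j} Di Dj y x~y nonadd with same i j
    ... | inj₁ refl = refl
    ... | inj₂ i≢j = proj₂ (proj₂ (plane h Di Dj y x~y i≢j)) nonadd

  -- If ∂ i F and ∂ j F differ at a point, then after moving in a direction l they still
  -- differ, or those of ∂ l F do; on a nonadditive plane of directions i, j nothing can differ.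
  ∂-linked : ∀ {D x F} → Sep D → Inv D x F → ∀ {i j} → D i ≡ true → D j ≡ true → ∀ z →
    κ · ν i j z ≡ true → ∂ i F x ≡ ∂ j F x
  ∂-linked {D} {x} {F} sep h {i} {j} Di Dj z nonadd with bool-case (∂ i F x xor ∂ j F x)
  ... | inj₂ eq = xor-false eq
  ... | inj₁ mixed = contradiction (∂-nonadditive inv′ Di Dj z′ x~z′ nonadd′) (xor-true mixed′)
    where
    z′ = merge D z x
    nonadd′ : κ · ν i j z′ ≡ true
    nonadd′ = walk (∁ D) (λ y → κ · ν i j y ≡ true)
      (λ y l v Dl → Sep-nonadditive sep (trans Di (sym Dj)) v l y (trans (not-true⁻¹ Dl) (sym (not-true Di))))
      z z′ (agree λ l Dl → sym (merge-in D z x l (not-false⁻¹ Dl))) nonadd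
    Mixed : Pt m → Set
    Mixed y = Agree D x y × Σ (Pt m → Bool) λ G → Inv D x G × ∂ i G y xor ∂ j G y ≡ true
    step : ∀ y l v → D l ≡ true → Mixed y → Mixed (y [ l ]≔ v)
    step y l v Dl (x~y , G , invG , mix) = agree-update l v Dl x~y , new
      where
      d = diff l v y
      move : ∀ {k} → D k ≡ true → ∂ k G (y [ l ]≔ v) ≡ ∂ k G y xor (κ · d ∧ ∂ l (∂ k G) y)
      move {k} Dk = trans (cong (∂ k G) (update-mv l v y)) (∂-move invG Dk Dl y x~y d)
      move∂ : ∀ {k} → D k ≡ true → ∂ k (∂ l G) (y [ l ]≔ v) ≡ ∂ l (∂ k G) y
      move∂ {k} Dk = trans (∂-comm invG Dk Dl _ (agree-update l v Dl x~y))
        (trans (cong (∂ l (∂ k G)) (update-mv l v y)) (∂-same (invariant (Inv-∂ invG Dk) y l x~y Dl) d))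
      new : Σ (Pt m → Bool) λ G → Inv D x G × ∂ i G (y [ l ]≔ v) xor ∂ j G (y [ l ]≔ v) ≡ true
      new with bool-case (∂ i G (y [ l ]≔ v) xor ∂ j G (y [ l ]≔ v))
      ... | inj₁ t = G , invG , t
      ... | inj₂ n = ∂ l G , Inv-∂ invG Dl , trans (cong₂ _xor_ (move∂ Di) (move∂ Dj))
        (prove (allᵇ λ a → allᵇ λ b → allᵇ λ k → allᵇ λ p → allᵇ λ q → a xor b ≐ᵇ true ⇒
          (a xor (k ∧ p)) xor (b xor (k ∧ q)) ≐ᵇ false ⇒ p xor q ≐ᵇ true)
          (∂ i G y) (∂ j G y) (κ · d) (∂ l (∂ i G) y) (∂ l (∂ j G) y) mix
              (trans (sym (cong₂ _xor_ (move Di) (move Dj))) n))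
    end : Mixed z′
    end = walk D Mixed step x z′ (agree-merge D z x) (agree-refl D x , F , h , mixed)
    x~z′ = proj₁ end
    inv′ = proj₁ (proj₂ (proj₂ end))
    mixed′ = proj₂ (proj₂ (proj₂ end))

  data Derived (D : Mask m) (G : Pt m → Bool) : (Pt m → Bool) → Set where
    self  : Derived D G G
    deriv : ∀ {H} l → D l ≡ true → Derived D G H → Derived D G (∂ l H)

  Derived-Inv : ∀ {D x G H} → Inv D x G → Derived D G H → Inv D x H
  Derived-Inv h self = h
  Derived-Inv h (deriv l Dl der) = Inv-∂ (Derived-Inv h der) Dl

  -- y′ is as good as the point next to y in direction l, for all invariant functions.
  Flipped : Mask m → Pt m → Fin m → Pt m → Pt m → Set
  Flipped D x l y y′ = Agree D x y′ × (∀ H → Inv D x H → H y′ ≡ H y xor ∂ l H y)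

  -- On the way from z to y₀ some iterated derivative of G stays true; flips of good points
  -- integrate it back.
  flip-lemma : ∀ {D x G} (Good : Pt m → Set) →
    (∀ y l → Agree D x y → D l ≡ true → Good y → ∃ λ y′ → Good y′ × Flipped D x l y y′) →
    Inv D x G → ∀ {z} → Agree D x z → G z ≡ true → ∀ {y₀} → Agree D x y₀ → Good y₀ →
    ∃ λ y → Agree D x y × Good y × G y ≡ true
  flip-lemma {D} {x} {G} Good flip h {z} x~z Gz {y₀} x~y₀ good₀ =
    descend (proj₁ (proj₂ end)) y₀ x~y₀ good₀ (proj₂ (proj₂ end))
    where
    descend : ∀ {H} → Derived D G H → ∀ y → Agree D x y → Good y → H y ≡ true →
      ∃ λ y → Agree D x y × Good y × G y ≡ true
    descend self y x~y good Gy = y , x~y , good , Gy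
    descend (deriv {H} l Dl der) y x~y good Hy′ with bool-case (H y)
    ... | inj₁ Hy = descend der y x~y good Hy
    ... | inj₂ ¬Hy with flip y l x~y Dl good
    ... | y′ , good′ , x~y′ , flips = descend der y′ x~y′ good′
          (trans (flips H (Derived-Inv h der)) (cong₂ _xor_ ¬Hy Hy′))
    Level : Pt m → Set
    Level y = Σ (Pt m → Bool) λ H → Derived D G H × H y ≡ true
    end : Level y₀
    end = proj₂ (walk D (λ y → Agree D x y × Level y) step z y₀ (agree-trans (agree-sym x~z) x~y₀)
        (x~z , G , self , Gz))
      where
      step : ∀ y l v → D l ≡ true → Agree D x y × Level y → Agree D x (y [ l ]≔ v) × Level (y [ l ]≔ v)
      step y l v Dl (x~y , H , der , Hy) with bool-case (H (y [ l ]≔ v))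
      ... | inj₁ t = agree-update l v Dl x~y , H , der , t
      ... | inj₂ n = agree-update l v Dl x~y , ∂ l H , deriv l Dl der ,
        trans (cong (∂ l H) (update-mv l v y)) (trans (∂-same (invariant invH y l x~y Dl) d)
        (prove (allᵇ λ h → allᵇ λ k → allᵇ λ e → h ≐ᵇ true ⇒ h xor (k ∧ e) ≐ᵇ false ⇒ e ≐ᵇ true)
          (H y) (κ · d) (∂ l H y) Hy (trans (sym (change (invariant invH y l x~y Dl) d))
              (trans (cong H (sym (update-mv l v y))) n))))
        where
        d = diff l v y
        invH = Derived-Inv h der

-- Search over finite types

Searchable : Set → Set₁
Searchable A = ∀ {P : A → Set} → Decidable P → Dec (∃ P)

search-Bool : Searchable Bool
search-Bool P? with P? true | P? false
... | yes t | _     = yes (true , t)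
... | no _  | yes f = yes (false , f)
... | no ¬t | no ¬f = no λ { (true , t) → ¬t t ; (false , f) → ¬f f }

search-Vec : ∀ {A} → Searchable A → ∀ {m} → Searchable (Vec A m)
search-Vec search {zero} P? = map′ ([] ,_) (λ { ([] , p) → p }) (P? [])
search-Vec search {suc m} P? = map′ (λ { (a , x , p) → a ∷ x , p }) (λ { (a ∷ x , p) → a , x , p })
  (search λ a → search-Vec search λ x → P? (a ∷ x))

search-Pt : ∀ {m} → Searchable (Pt m)
search-Pt = search-Vec any?

does-yes : ∀ {P : Set} (P? : Dec P) → does P? ≡ true → P
does-yes (yes p) _ = p

does-no : ∀ {P : Set} (P? : Dec P) → does P? ≡ false → ¬ P
does-no (no ¬p) _ = ¬p

forall? : ∀ {A} → Searchable A → {P : A → Set} → Decidable P → Dec (∀ a → P a)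
forall? s P? with s (λ a → ¬? (P? a))
... | yes (a , ¬p) = no λ h → ¬p (h a)
... | no none      = yes λ a → decidable-stable (P? a) λ ¬p → none (a , ¬p)

-- Classes of coordinates that no separated set divides

module Classes {m : ℕ} (f : Pt m → V) (f-inj : Injective f) (κ : V) (κ≢0 : κ ≢ 0F) where

  open Quasi f f-inj
  open Functional f f-inj κ κ≢0 public

  Sep? : (D : Mask m) → Dec (Sep D)
  Sep? D = map′ separated additive (forall? any? λ i → forall? any? λ j → forall? search-Pt λ x →
    (D i Bool.≟ true) →-dec ((D j Bool.≟ false) →-dec ((κ · ν i j x) Bool.≟ false)))

  Sep-cong : ∀ {D E : Mask m} → (∀ l → D l ≡ E l) → Sep D → Sep E
  Sep-cong D≗E sep = separated λ i j x Ei Ej → additive sep i j x (trans (D≗E i) Ei) (trans (D≗E j) Ej)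

  infix 4 _#_ _#?_
  record _#_ (i j : Fin m) : Set where
    constructor cut
    field
      side     : Vec Bool m
      side-Sep : Sep (lookup side)
      side-≢   : lookup side i ≢ lookup side j

  opaque
    _#?_ : ∀ i j → Dec (i # j)
    i #? j = map′ (λ { (W , sep , W≢) → cut W sep W≢ }) (λ { (cut W sep W≢) → W , sep , W≢ })
      (search-Vec search-Bool λ W → Sep? (lookup W) ×-dec ¬? (lookup W i Bool.≟ lookup W j))

  Sep-# : ∀ {D i j} → Sep D → D i ≢ D j → i # j
  Sep-# {D} {i} {j} sep D≢ = cut (tabulate D) (Sep-cong (λ l → sym (lookup∘tabulate D l)) sep)
    (λ eq → D≢ (trans (sym (lookup∘tabulate D i)) (trans eq (lookup∘tabulate D j))))

  Sep-#′ : ∀ {D i j} → Sep D → D i ≡ true → D j ≡ false → i # j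
  Sep-#′ sep Di Dj = Sep-# sep (λ eq → bool-clash Di (trans eq Dj))

  #-sym : ∀ {i j} → i # j → j # i
  #-sym (cut W sep W≢) = cut W sep (W≢ ∘ sym)

  #⇒≢ : ∀ {i j} → i # j → i ≢ j
  #⇒≢ (cut W sep W≢) refl = W≢ refl

  #-split : ∀ {i j} → i # j → ∀ l → l # i ⊎ l # j
  #-split {i} {j} (cut W sep W≢) l with lookup W l Bool.≟ lookup W i
  ... | yes eq = inj₂ (cut W sep λ eq′ → W≢ (trans (sym eq) eq′))
  ... | no neq = inj₁ (cut W sep neq)

  #-additive : ∀ {i j} → i # j → ∀ x → κ · ν i j x ≡ false
  #-additive {i} {j} (cut W sep W≢) x with bool-case (lookup W i) | bool-case (lookup W j)
  ... | inj₁ Wi | inj₂ Wj = additive sep i j x Wi Wj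
  ... | inj₂ Wi | inj₁ Wj = trans (cong (κ ·_) (ν-sym i j x)) (additive sep j i x Wj Wi)
  ... | inj₁ Wi | inj₁ Wj = contradiction (trans Wi (sym Wj)) W≢
  ... | inj₂ Wi | inj₂ Wj = contradiction (trans Wi (sym Wj)) W≢

  away : Fin m → Mask m
  away j l = does (l #? j)

  away⇒# : ∀ {j l} → away j l ≡ true → l # j
  away⇒# = does-yes (_ #? _)

  #⇒away : ∀ {j l} → l # j → away j l ≡ true
  #⇒away = dec-true (_ #? _)

  away-Sep : ∀ j → Sep (away j)
  away-Sep j = separated λ i l x i∈ l∉ → go i l x (away⇒# i∈) (does-no (l #? j) l∉)
    where
    go : ∀ i l x → i # j → ¬ l # j → κ · ν i l x ≡ false
    go i l x i#j ¬l#j with #-split i#j l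
    ... | inj₁ l#i = #-additive (#-sym l#i) x
    ... | inj₂ l#j = contradiction l#j ¬l#j

  -- The smallest separated set containing `j`: the classes are the atoms of the Boolean algebra of
  -- separated sets.
  class : Fin m → Mask m
  class j = ∁ (away j)

  class-Sep : ∀ j → Sep (class j)
  class-Sep j = Sep-∁ (away-Sep j)

  class⇒¬# : ∀ {j l} → class j l ≡ true → ¬ l # j
  class⇒¬# h = does-no (_ #? _) (not-true⁻¹ h)

  ¬#⇒class : ∀ {j l} → ¬ l # j → class j l ≡ true
  ¬#⇒class h = not-false (dec-false (_ #? _) h)

  ¬#-refl : ∀ {i} → ¬ i # i
  ¬#-refl i#i = #⇒≢ i#i refl

  self-class : ∀ l → class l l ≡ true
  self-class l = ¬#⇒class ¬#-refl

  class-# : ∀ {j l i} → class j l ≡ true → i # j → i # l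
  class-# {j} {l} {i} h i#j with #-split i#j l
  ... | inj₁ l#i = #-sym l#i
  ... | inj₂ l#j = contradiction l#j (class⇒¬# h)

  class-trans : ∀ {a b c} → class a b ≡ true → class b c ≡ true → class a c ≡ true
  class-trans ab bc = ¬#⇒class λ c#a → class⇒¬# bc (class-# ab c#a)

  Inv-rebase : ∀ {D x y F} → Agree D x y → Inv D x F → Inv D y F
  Inv-rebase x~y h = inv λ z l y~z → invariant h z l (agree-trans x~y y~z)

  -- Let `Z` consist of the directions of `D` in which `F` has, all over the slice, the same
  -- derivative as in direction `j`. It is separated: `∂-linked` excludes a nonadditive plane that
  -- leaves `Z` inside `D`, and `sep` one that leaves `D`. So it cannot divide `j` from `i`.
  ∂-class : ∀ {D x F} → Sep D → Inv D x F → ∀ {i j} → D i ≡ true → D j ≡ true → ¬ i # j → ∂ i F x ≡ ∂ j F x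
  ∂-class {D} {x} {F} sep h {i} {j} Di Dj ¬i#j = subst (λ y → ∂ i F y ≡ ∂ j F y) (merge-self D x)
    (does-yes (equal? i) (∧-right {D i} (Z-const (∧-intro Dj (dec-true (equal? j) λ _ → refl)))) x)
    where
    equal? : ∀ l → Dec (∀ y → ∂ l F (merge D y x) ≡ ∂ j F (merge D y x))
    equal? l = forall? search-Pt λ y → ∂ l F (merge D y x) Bool.≟ ∂ j F (merge D y x)
    Z : Mask m
    Z l = D l ∧ does (equal? l)
    Z-out : ∀ l → Z l ≡ false → D l ≡ true → does (equal? l) ≡ false
    Z-out l Zl Dl rewrite Dl = Zl
    Z-Sep : Sep Z
    Z-Sep = separated λ a b z Za Zb → go a b z Za Zb (bool-case (D b))
      where
      go : ∀ a b z → Z a ≡ true → Z b ≡ false → D b ≡ true ⊎ D b ≡ false → κ · ν a b z ≡ false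
      go a b z Za Zb (inj₂ ¬Db) = additive sep a b z (∧-left Za) ¬Db
      go a b z Za Zb (inj₁ Db) with bool-case (κ · ν a b z)
      ... | inj₂ ad = ad
      ... | inj₁ nonadd = contradiction
        (λ y → trans (sym (∂-linked sep (Inv-rebase (agree-merge D y x) h) (∧-left Za) Db z nonadd))
                     (does-yes (equal? a) (∧-right {D a} Za) y))
        (does-no (equal? b) (Z-out b Zb Db))
    Z-const : Z j ≡ true → Z i ≡ true
    Z-const Zj with bool-case (Z i)
    ... | inj₁ Zi = Zi
    ... | inj₂ Zi = contradiction (#-sym (Sep-#′ Z-Sep Zj Zi)) ¬i#j

  invAt-intro : ∀ {l F y} e → (∀ d → F (mv l d y) ≡ F y xor (κ · d ∧ e)) → InvAt l F y × ∂ l F y ≡ e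
  invAt-intro {l} {F} {y} e h = invAt (λ d → trans (h d) (cong (λ e → F y xor (κ · d ∧ e)) (sym slope))) ,
      slope
    where
    slope : ∂ l F y ≡ e
    slope = trans (∂-def l F y)
        (trans (cong (F y xor_) (trans (h (unit κ)) (cong (λ k → F y xor (k ∧ e)) (·-unit κ κ≢0))))
      (prove (allᵇ λ a → allᵇ λ b → a xor (a xor b) ≐ᵇ b) (F y) e))

  -- For directions that are apart, the twist is `0F` or `κ`, so this bit determines it (`ν-N`).
  N : Fin m → Fin m → Pt m → Bool
  N i j x = ν i j x == κ

  N-sym : ∀ i j x → N i j x ≡ N j i x
  N-sym i j x = cong (_== κ) (ν-sym i j x)

  ν-mvˡ : ∀ i j d x → ν i j (mv i d x) ≡ ν i j x
  ν-mvˡ i j d x = trans (cong (ν i j) (mv-def i d x)) (ν-updateˡ i j x _)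

  ν-mvʳ : ∀ i j d x → ν i j (mv j d x) ≡ ν i j x
  ν-mvʳ i j d x = trans (cong (ν i j) (mv-def j d x)) (ν-updateʳ i j x _)

  ν-N : ∀ {i j} → i # j → ∀ x → ν i j x ≡ N i j x ⊛ κ
  ν-N {i} {j} i#j x = prove (all λ κ → neg (κ ≐ 0F) ⇒ all λ n → κ · n ≐ᵇ false ⇒ n ≐ (n == κ) ⊛ κ)
    κ κ≢0 (ν i j x) (#-additive i#j x)

  module _ (j : Fin m) (x : Pt m) where

    private
      D = away j
      v = lookup x j
      w = pos j (unit κ) x

      -- `F` and `gap` are two components of the difference of `f` between the hyperplanes with
      -- entries `v` and `w` at `j`. On the slice `gap` stays true, and this gives `F` the slope
      -- `N i j` in direction `i`: the twists with `j` become the derivatives of one function.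
      F : Pt m → Bool
      F y = unit κ · (f (y [ j ]≔ v) ⊕ f (y [ j ]≔ w))

      gap : Pt m → Bool
      gap y = κ · (f (y [ j ]≔ v) ⊕ f (y [ j ]≔ w))

      gap-x : gap x ≡ true
      gap-x = trans (cong₂ (λ a b → κ · (f a ⊕ b)) ([]≔-lookup x j)
          (trans (cong f (sym (mv-def j (unit κ) x))) (f-mv j (unit κ) x)))
        (trans (cong (κ ·_) (⊕-involutiveˡ (f x) (unit κ))) (·-unit κ κ≢0))

      gap-y : ∀ y → Agree D x y → gap y ≡ true
      gap-y y x~y = walk D (λ y → gap y ≡ true) step x y x~y gap-x
        where
        step : ∀ y l u → D l ≡ true → gap y ≡ true → gap (y [ l ]≔ u) ≡ true
        step y l u Dl = trans (eqn κ (f ((y [ l ]≔ u) [ j ]≔ v)) (f (y [ j ]≔ v)) (f ((y [ l ]≔ u) [ j ]≔ w))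
            (f (y [ j ]≔ w)) (f (y [ l ]≔ u)) (f y) (add v) (add w))
          where
          add : ∀ v → κ · (f ((y [ l ]≔ u) [ j ]≔ v) ⊕ f (y [ l ]≔ u) ⊕ f (y [ j ]≔ v) ⊕ f y) ≡ false
          add v = cross-add (#⇒≢ (away⇒# Dl)) u v y (#-additive (away⇒# Dl) y)
          assoc : ∀ a b c d → a ⊕ b ⊕ c ⊕ d ≡ a ⊕ (b ⊕ d) ⊕ c
          assoc = prove (all λ a → all λ b → all λ c → all λ d → a ⊕ b ⊕ c ⊕ d ≐ a ⊕ (b ⊕ d) ⊕ c)
          eqn : ∀ κ a c a′ c′ b d → κ · (a ⊕ b ⊕ c ⊕ d) ≡ false → κ · (a′ ⊕ b ⊕ c′ ⊕ d) ≡ false →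
            κ · (a ⊕ a′) ≡ κ · (c ⊕ c′)
          eqn κ a c a′ c′ b d h h′ = prove (all λ κ → all λ a → all λ c → all λ e → κ · (a ⊕ e ⊕ c) ≐ᵇ false ⇒
            all λ a′ → all λ c′ → κ · (a′ ⊕ e ⊕ c′) ≐ᵇ false ⇒ κ · (a ⊕ a′) ≐ᵇ κ · (c ⊕ c′))
            κ a c (b ⊕ d) (trans (cong (κ ·_) (sym (assoc a b c d))) h)
            a′ c′ (trans (cong (κ ·_) (sym (assoc a′ b c′ d))) h′)

      shift : ∀ {i} → i # j → ∀ y d v →
        f (mv i d y [ j ]≔ v) ≡ f y ⊕ d ⊕ f (y [ j ]≔ v) ⊕ f y ⊕ twist (N i j y ⊛ κ) d (f y ⊕ f (y [ j ]≔ v))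
      shift {i} i#j y d v = trans (cong (λ z → f (z [ j ]≔ v)) (mv-def i d y))
        (trans (law (ν-twist (#⇒≢ i#j) y) (pos i d y) v)
        (cong₂ (λ a t → a ⊕ f (y [ j ]≔ v) ⊕ f y ⊕ t) (trans (cong f (sym (mv-def i d y))) (f-mv i d y))
          (cong₂ (λ n e → twist n e (diff j v y)) (ν-N i#j y) (diff-pos i d y))))

      F-slope : ∀ i y → i # j → Agree D x y → InvAt i F y × ∂ i F y ≡ N i j y
      F-slope i y i#j x~y = invAt-intro (N i j y) λ d →
        trans (cong₂ (λ a b → unit κ · (a ⊕ b)) (shift i#j y d v) (shift i#j y d w))
        (prove (all λ κ → neg (κ ≐ 0F) ⇒ all λ a → all λ b → κ · (a ⊕ b) ≐ᵇ true ⇒ all λ c → all λ d →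
            allᵇ λ n →
          unit κ · ((c ⊕ d ⊕ a ⊕ c ⊕ twist (n ⊛ κ) d (c ⊕ a)) ⊕ (c ⊕ d ⊕ b ⊕ c ⊕ twist (n ⊛ κ) d (c ⊕ b))) ≐ᵇ
          unit κ · (a ⊕ b) xor (κ · d ∧ n))
          κ κ≢0 (f (y [ j ]≔ v)) (f (y [ j ]≔ w)) (gap-y y x~y) (f y) d (N i j y))

      F-Inv : Inv D x F
      F-Inv = inv λ y l x~y Dl → proj₁ (F-slope l y (away⇒# Dl) x~y)

      slope-at : ∀ {i y} → i # j → Agree D x y → ∂ i F y ≡ N i j y
      slope-at i#j x~y = proj₂ (F-slope _ _ i#j x~y)

      ∂N : ∀ {i l} → i # j → l # j → ∂ l (∂ i F) x ≡ ∂ l (N i j) x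
      ∂N {i} {l} i#j l#j = trans (∂-def l (∂ i F) x) (trans (cong₂ _xor_ (slope-at i#j (agree-refl D x))
        (slope-at i#j (agree-mv l (unit κ) (#⇒away l#j) (agree-refl D x)))) (sym (∂-def l (N i j) x)))

    N-change : ∀ {i l} → i # j → l # j → InvAt l (N i j) x
    N-change {i} {l} i#j l#j = invAt λ d →
        trans (sym (slope-at i#j (agree-mv l d (#⇒away l#j) (agree-refl D x))))
      (trans (∂-move F-Inv (#⇒away i#j) (#⇒away l#j) x (agree-refl D x) d)
      (cong₂ (λ n e → n xor (κ · d ∧ e)) (slope-at i#j (agree-refl D x)) (∂N i#j l#j)))

    -- Both sides are second derivatives of `F`, taken in the two orders.
    ∂-N-swap : ∀ {i l} → i # j → l # j → ∂ l (N i j) x ≡ ∂ i (N l j) x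
    ∂-N-swap i#j l#j = trans (sym (∂N i#j l#j))
      (trans (∂-comm F-Inv (#⇒away l#j) (#⇒away i#j) x (agree-refl D x)) (∂N l#j i#j))

    N-class : ∀ {i i′} → i # j → i′ # j → ¬ i # i′ → N i j x ≡ N i′ j x
    N-class i#j i′#j ¬i#i′ = trans (sym (slope-at i#j (agree-refl D x)))
      (trans (∂-class (away-Sep j) F-Inv (#⇒away i#j) (#⇒away i′#j) ¬i#i′) (slope-at i′#j (agree-refl D x)))

  full : Mask m
  full _ = true

  -- By cotransitivity every direction is apart from `i` or from `j`, and `N-change` applies at that
  -- end.
  N-Inv : ∀ {i j} → i # j → ∀ x → Inv full x (N i j)
  N-Inv {i} {j} i#j x = inv λ y l _ _ → at y l (#-split i#j l)
    where
    at : ∀ y l → l # i ⊎ l # j → InvAt l (N i j) y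
    at y l (inj₂ l#j) = N-change j y i#j l#j
    at y l (inj₁ l#i) = invAt λ d → trans (N-sym i j _) (trans (change h d)
      (cong₂ (λ n e → n xor (κ · d ∧ e)) (N-sym j i y) (trans (∂-def l (N j i) y)
        (trans (cong₂ _xor_ (N-sym j i y) (N-sym j i _)) (sym (∂-def l (N i j) y))))))
      where h = N-change i y (#-sym i#j) l#i

  agree-full : ∀ (x y : Pt m) → Agree full x y
  agree-full x y = agree λ _ ()

  Zero : (Pt m → Bool) → Set
  Zero F = ∀ x → F x ≡ false

  -- By `∂-N-swap` the derivative of `N i k` in direction `j` is that of `N j k` in direction `i`,
  -- which vanishes.
  N-fixed : ∀ {i j k} → i # k → j # k → Zero (N j k) → ∀ d x → N i k (mv j d x) ≡ N i k x
  N-fixed {i} {j} {k} i#k j#k Njk0 d x = trans (change (N-change k x i#k j#k) d)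
    (trans (cong (λ e → N i k x xor (κ · d ∧ e)) (trans (∂-N-swap k x i#k j#k) (trans (∂-def i (N j k) x)
      (cong₂ _xor_ (Njk0 x) (Njk0 _)))))
    (prove (allᵇ λ a → allᵇ λ b → a xor (b ∧ false) ≐ᵇ a) (N i k x) (κ · d)))

-- Colours of lines

module Pair {m : ℕ} (f : Pt m → V) (f-inj : Injective f) (g : Pt m → V) (g-inj : Injective g)
            (f≢g : ∀ x → f x ≢ g x) where

  open Quasi f f-inj

  u : Pt m → V
  u x = f x ⊕ g x

  u≢0 : ∀ x → u x ≢ 0F
  u≢0 x = f≢g x ∘ ⊕≡0⇒≡ _ _

  opaque
    col : Fin m → Pt m → V
    col i x = colour λ d → u (mv i d x)

    u-mv : ∀ i d x → u (mv i d x) ≡ u x ⊕ shear (col i x) d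
    u-mv i d x = trans (colour-correct _ (λ d → u≢0 (mv i d x)) inj d)
      (cong (λ y → u y ⊕ shear (col i x) d) (mv-0 i x))
      where
      inj : InjV (λ d → d ⊕ u (mv i d x))
      inj d e h = ⊕-cancelˡ (f x) d e (trans (sym (f-mv i d x)) (trans (cong f same-pt) (f-mv i e x)))
        where
        val : ∀ d → g (x [ i ]≔ pos i d x) ≡ f x ⊕ (d ⊕ u (mv i d x))
        val d = trans (cong g (sym (mv-def i d x))) (trans (sym (⊕-involutiveˡ (f (mv i d x)) (g (mv i d x))))
          (trans (cong (_⊕ u (mv i d x)) (f-mv i d x)) (⊕-assoc (f x) d (u (mv i d x)))))
        same-pt : mv i d x ≡ mv i e x
        same-pt = trans (mv-def i d x) (trans (cong (x [ i ]≔_) (g-inj i x _ _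
          (trans (val d) (trans (cong (f x ⊕_) h) (sym (val e)))))) (sym (mv-def i e x)))

  col-unique : ∀ i x p → (∀ d → u (mv i d x) ≡ u x ⊕ shear p d) → col i x ≡ p
  col-unique i x p h = shear-unique _ _ λ d → ⊕-cancelˡ (u x) _ _ (trans (sym (u-mv i d x)) (h d))

  col-mv : ∀ i d x → col i (mv i d x) ≡ col i x
  col-mv i d x = col-unique i (mv i d x) (col i x) λ e → trans (cong u (mv-mv i e d x))
      (trans (u-mv i (d ⊕ e) x)
    (trans (prove (all λ c → all λ p → all λ d → all λ e → c ⊕ shear p (d ⊕ e) ≐ c ⊕ shear p d ⊕ shear p e)
      (u x) (col i x) d e) (cong (_⊕ shear (col i x) e) (sym (u-mv i d x)))))

  plane-rules : ∀ {i j} → i ≢ j → ∀ x η θ →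
    ⟦ rules (ν i j x) (u x) (col i x) (col j x) η θ (col i (mv j η x)) (col i (mv j θ x)) (col j (mv i η x))
        (col j (mv i θ x)) ⟧
  plane-rules {i} {j} i≢j x η θ =
    subst₂ (λ p q → ⟦ rules (ν i j x) (u x) p q η θ (P η) (P θ) (Q η) (Q θ) ⟧) P₀ Q₀
      (coloured-rules (u≢0 x , cells) η θ)
    where
    P Q : V → V
    P η = col i (mv j η x)
    Q ξ = col j (mv i ξ x)
    P₀ : P 0F ≡ col i x
    P₀ = cong (col i) (mv-0 j x)
    Q₀ : Q 0F ≡ col j x
    Q₀ = cong (col j) (mv-0 i x)
    cells : ∀ ξ η → ⟦ cell (ν i j x) (u x) (P 0F) (Q 0F) ξ η (P η) (Q ξ) ⟧
    cells ξ η rewrite P₀ | Q₀ =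
      ⊕-cancelˡ (u x) _ _ (trans (sym via-i) (trans (cong u (mv-comm i≢j x ξ η)) via-j)) ,
      λ eq → u≢0 _ (trans via-i (trans (cong (u x ⊕_) (sym eq)) (⊕-self (u x))))
      where
      t = twist (ν i j x) ξ η
      via-i : u (mv j (η ⊕ t) (mv i ξ x)) ≡ u x ⊕ (shear (col i x) ξ ⊕ shear (Q ξ) (η ⊕ t))
      via-i = trans (u-mv j (η ⊕ t) _) (trans (cong (_⊕ shear (Q ξ) (η ⊕ t)) (u-mv i ξ x))
          (⊕-assoc (u x) _ _))
      via-j : u (mv i (ξ ⊕ t) (mv j η x)) ≡ u x ⊕ (shear (col j x) η ⊕ shear (P η) (ξ ⊕ t))
      via-j = trans (u-mv i (ξ ⊕ t) _) (trans (cong (_⊕ shear (P η) (ξ ⊕ t)) (u-mv j η x))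
          (⊕-assoc (u x) _ _))

  module _ {i j : Fin m} {x : Pt m} (i≢j : i ≢ j) (flat : ν i j x ≡ 0F) (col≢0 : col i x ≢ 0F) where

    private
      flat-rules : ∀ η θ → ⟦ flatRules (col i x) (col j x) η θ (col i (mv j η x)) (col i (mv j θ x))
          (col j (mv i θ x)) ⟧
      flat-rules η θ = proj₁ (plane-rules i≢j x η θ) flat

    flat-values : ∀ η → col i (mv j η x) ≡ col i x ⊎ col i (mv j η x) ≡ 0F
    flat-values η = proj₁ (flat-rules η η col≢0)

    flat-same : ∀ η θ → col i x · η ≡ col i x · θ → col i (mv j η x) ≡ col i (mv j θ x)
    flat-same η θ = proj₁ (proj₂ (flat-rules η θ col≢0))

    flat-keep : ∀ η → col i x · η ≡ false → col i (mv j η x) ≡ col i x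
    flat-keep η h = trans (flat-same η 0F (trans h (sym (·-zeroʳ _)))) (cong (col i) (mv-0 j x))

    flat-equal : col j x ≢ 0F → col i x ≡ col j x
    flat-equal = proj₁ (proj₂ (proj₂ (flat-rules 0F 0F col≢0)))

    flat-toggle : ∀ η → col i (mv j η x) ≡ 0F → ∀ ξ → col i x · ξ ≡ true →
      (col j x ≡ col i x × col j (mv i ξ x) ≡ 0F) ⊎ (col j x ≡ 0F × col j (mv i ξ x) ≡ col i x)
    flat-toggle η h ξ = proj₂ (proj₂ (proj₂ (flat-rules η ξ col≢0))) h

  module WithFunctional (κ : V) (κ≢0 : κ ≢ 0F) where

    open Classes f f-inj κ κ≢0

    -- κ · u is nonconstant on the line through x in direction i.
    act : Fin m → Pt m → Bool
    act i x = κ · col i x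

    act⇒≢0 : ∀ {i x} → act i x ≡ true → col i x ≢ 0F
    act⇒≢0 {i} {x} h eq = bool-clash h (trans (cong (κ ·_) eq) (·-zeroʳ κ))

    act-mv : ∀ i d x → act i (mv i d x) ≡ act i x
    act-mv i d x = cong (κ ·_) (col-mv i d x)

    N-true : ∀ {i j x} → N i j x ≡ true → ν i j x ≡ κ
    N-true {i} {j} {x} h = prove (all λ a → all λ b → (a == b) ≐ᵇ true ⇒ a ≐ b) (ν i j x) κ h

    N-false : ∀ {i j x} → κ · ν i j x ≡ false → N i j x ≡ false → ν i j x ≡ 0F
    N-false {i} {j} {x} = prove (all λ κ → neg (κ ≐ 0F) ⇒ all λ n → κ · n ≐ᵇ false ⇒ (n == κ) ≐ᵇ false ⇒
        n ≐ 0F) κ κ≢0 (ν i j x)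

    N⇒≢ : ∀ {i j x} → N i j x ≡ true → i ≢ j
    N⇒≢ {i} {x = x} h refl = κ≢0 (trans (sym (N-true h)) (ν-diag i x))

    module _ {i j : Fin m} {x : Pt m} (Nij : N i j x ≡ true) (act-i : act i x ≡ true) where

      private
        twisted-rules : ∀ η → ⟦ twistedRules κ (u x) (col i x) (col j x) η (col i (mv j η x))
            (col j (mv i η x)) ⟧
        twisted-rules η = subst (λ n → ⟦ twistedRules n (u x) (col i x) (col j x) η (col i (mv j η x))
            (col j (mv i η x)) ⟧)
          (N-true Nij) (proj₂ (plane-rules (N⇒≢ Nij) x η η) (κ≢0 ∘ trans (sym (N-true Nij))))

      twisted-act : ∀ η → act i (mv j η x) ≡ true
      twisted-act η = proj₁ (twisted-rules η act-i)

      twisted-both : act j x ≡ true → ∀ η → col i (mv j η x) ≡ col i x × col j (mv i η x) ≡ col i x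
      twisted-both act-j η = proj₁ (proj₂ (twisted-rules η act-i)) act-j

      twisted-one : act j x ≡ false → ∀ η → col i (mv j η x) ≡ col i x ⊕ (κ · η) ⊛ κ ×
        col j (mv i η x) ≡ (κ · (u x ⊕ shear (col i x) η)) ⊛ κ
      twisted-one ¬act-j η = proj₂ (proj₂ (twisted-rules η act-i)) ¬act-j

    act-equal : ∀ {i j x} → i # j → act i x ≡ true → act j x ≡ true → col i x ≡ col j x
    act-equal {i} {j} {x} i#j ai aj with bool-case (N i j x)
    ... | inj₁ n = sym (trans (cong (col j) (sym (mv-0 i x))) (proj₂ (twisted-both n ai aj 0F)))
    ... | inj₂ n = flat-equal (#⇒≢ i#j) (N-false (#-additive i#j x) n) (act⇒≢0 ai) (act⇒≢0 aj)

    -- A plane of twist `κ` preserves activity under every move. On a flat plane the increment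
    -- `col i x` preserves the colour itself, being orthogonal to it; it is also a step to the other
    -- level of `κ · f`, which `flipped` needs.
    act-keep : ∀ {i l x} → κ · ν i l x ≡ false → act i x ≡ true → act i (mv l (col i x) x) ≡ true
    act-keep {i} {l} {x} add ai with same i l | bool-case (N i l x)
    ... | inj₁ refl | _      = trans (act-mv i _ x) ai
    ... | inj₂ i≢l  | inj₁ n = twisted-act n ai _
    ... | inj₂ i≢l  | inj₂ n =
        trans (cong (κ ·_) (flat-keep i≢l (N-false add n) (act⇒≢0 ai) _ (·-self (col i x)))) ai

    -- Otherwise i and k would both be active, with different colours, after one more move along l.
    inactive-keep : ∀ {i k l x} → i # k → i ≢ l → k ≢ l → κ · ν i l x ≡ false → κ · ν k l x ≡ false →
      act i x ≡ true → act k x ≡ false → act k (mv l (col i x) x) ≡ false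
    inactive-keep {i} {k} {l} {x} i#k i≢l k≢l il kl ai ¬ak = Bool.¬-not impossible
      where
      p = col i x
      x′ = mv l p x
      x″ = mv l (p ⊕ col k x′) x
      impossible : act k x′ ≢ true
      impossible ak′ with bool-case (N k l x)
      ... | inj₁ n = bool-clash (trans (cong (act k) (sym (mv-back l p x))) (twisted-act n′ ak′ p)) ¬ak
        where
        n′ : N k l x′ ≡ true
        n′ = trans (cong (_== κ) (ν-mvʳ k l p x)) n
      ... | inj₂ n with bool-case (col k x′ · p)
      ...   | inj₂ orth = bool-clash ak ¬ak
        where
        flat : ν k l x′ ≡ 0F
        flat = trans (ν-mvʳ k l p x) (N-false kl n)
        ak : act k x ≡ true
        ak = trans (cong (act k) (sym (mv-back l p x)))
            (trans (cong (κ ·_) (flat-keep k≢l flat (act⇒≢0 ak′) p orth)) ak′)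
      ...   | inj₁ skew = by-il (bool-case (N i l x)) (bool-case (act l x))
        where
        flat : ν k l x′ ≡ 0F
        flat = trans (ν-mvʳ k l p x) (N-false kl n)
        col-i : col i x′ ≡ col k x′
        col-i = act-equal i#k (act-keep il ai) ak′
        differ : ∀ {A : Set} → col k x′ ≡ p → A
        differ eq = bool-clash skew (trans (cong (_· p) eq) (·-self p))
        x″-def : mv l (col k x′) x′ ≡ x″
        x″-def = mv-mv l (col k x′) p x
        col-k″ : col k x″ ≡ col k x′
        col-k″ = trans (cong (col k) (sym x″-def)) (flat-keep k≢l flat (act⇒≢0 ak′) _ (·-self _))
        by-il : N i l x ≡ true ⊎ N i l x ≡ false → act l x ≡ true ⊎ act l x ≡ false → _
        by-il (inj₂ ¬n) _ = differ
            (trans (sym col-i) (flat-keep i≢l (N-false il ¬n) (act⇒≢0 ai) p (·-self p)))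
        by-il (inj₁ n) (inj₁ al) = differ (trans (sym col-i) (proj₁ (twisted-both n ai al p)))
        by-il (inj₁ n) (inj₂ ¬al) = differ (trans (sym col-k″) (trans (sym (act-equal i#k ai″ ak″)) col-i″))
          where
          col-i″ : col i x″ ≡ p
          col-i″ = trans (proj₁ (twisted-one n ai ¬al _))
            (prove (all λ κ → all λ p → κ · p ≐ᵇ true ⇒ all λ q → κ · q ≐ᵇ true ⇒ p ⊕ (κ · (p ⊕ q)) ⊛ κ ≐ p) κ
                p ai _ ak′)
          ai″ : act i x″ ≡ true
          ai″ = trans (cong (κ ·_) col-i″) ai
          ak″ : act k x″ ≡ true
          ak″ = trans (cong (κ ·_) col-k″) ak′

    -- On a plane of twist `κ` the colour of `k` is a multiple of `κ`. On a flat plane an active `k`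
    -- would have the colour of `i`, and the move back by this very vector would keep it active.
    inactive-keepˡ : ∀ {i k x} → i # k → act i x ≡ true → act k x ≡ false → act k (mv i (col i x) x) ≡ false
    inactive-keepˡ {i} {k} {x} i#k ai ¬ak with bool-case (N i k x)
    ... | inj₁ n = trans (cong (κ ·_) (proj₂ (twisted-one n ai ¬ak _)))
      (prove (all λ κ → allᵇ λ b → κ · b ⊛ κ ≐ᵇ false) κ _)
    ... | inj₂ n = Bool.¬-not λ ak′ → bool-clash (back ak′) ¬ak
      where
      p = col i x
      x′ = mv i p x
      flat : ν k i x′ ≡ 0F
      flat = trans (ν-mvʳ k i p x) (trans (ν-sym k i x) (N-false (#-additive i#k x) n))
      back : act k x′ ≡ true → act k x ≡ true
      back ak′ = trans (cong (act k) (sym (mv-back i p x))) (trans (cong (κ ·_)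
        (flat-keep (#⇒≢ (#-sym i#k)) flat (act⇒≢0 ak′) p
          (trans (cong (_· p) (trans (act-equal (#-sym i#k) ak′ (trans (act-mv i p x) ai)) (col-mv i p x)))
              (·-self p)))) ak′)

    flipped : ∀ {D x l y p} → Agree D x y → D l ≡ true → κ · p ≡ true → Flipped D x l y (mv l p y)
    flipped {l = l} {y} {p} x~y Dl κp = agree-mv l p Dl x~y , λ H h →
      trans (change (invariant h y l x~y Dl) p) (cong (λ k → H y xor (k ∧ ∂ l H y)) κp)

    -- On a nonadditive plane the derivatives in the two directions agree, so a move along `i` can
    -- stand in for one along `l`.
    flipped-linked : ∀ {D x l i y p} → Agree D x y → D l ≡ true → D i ≡ true → κ · p ≡ true →
      κ · ν i l y ≡ true → Flipped D x l y (mv i p y)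
    flipped-linked {l = l} {i} {y} x~y Dl Di κp nonadd = proj₁ fl , λ H h →
      trans (proj₂ fl H h) (cong (H y xor_) (∂-nonadditive h Di Dl y x~y nonadd))
      where fl = flipped x~y Di κp

    Split : Fin m → Fin m → Pt m → Set
    Split i k x = act i x ≡ true × act k x ≡ false

    Both : Fin m → Fin m → Pt m → Set
    Both i k x = act i x ≡ true × act k x ≡ true

    ν-additive-sym : ∀ {i j} x {b} → κ · ν i j x ≡ b → κ · ν j i x ≡ b
    ν-additive-sym x h = trans (cong (κ ·_) (ν-sym _ _ x)) h

    -- The increment is always the colour of `i`. The move is along `i` or `k` if `l` equals it or
    -- is nonadditive with it, and along `l` otherwise.
    flip-split : ∀ {i k} → i # k → ∀ x y l → Split i k y → ∃ λ y′ → Split i k y′ × Flipped full x l y y′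
    flip-split {i} {k} i#k x y l (ai , ¬ak) = cases (same i l) (same k l) (bool-case (κ · ν i l y))
        (bool-case (κ · ν k l y))
      where
      p = col i y
      x~y = agree-full x y
      via-i : Split i k (mv i p y)
      via-i = trans (act-mv i p y) ai , inactive-keepˡ i#k ai ¬ak
      via-k : Split i k (mv k p y)
      via-k = act-keep (#-additive i#k y) ai , trans (act-mv k p y) ¬ak
      cases : i ≡ l ⊎ i ≢ l → k ≡ l ⊎ k ≢ l → κ · ν i l y ≡ true ⊎ κ · ν i l y ≡ false →
        κ · ν k l y ≡ true ⊎ κ · ν k l y ≡ false → ∃ λ y′ → Split i k y′ × Flipped full x l y y′
      cases (inj₁ refl) _ _ _ = mv i p y , via-i , flipped x~y refl ai
      cases _ (inj₁ refl) _ _ = mv k p y , via-k , flipped x~y refl ai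
      cases _ _ (inj₁ nonadd) _ = mv i p y , via-i , flipped-linked x~y refl refl ai nonadd
      cases _ _ _ (inj₁ nonadd) = mv k p y , via-k , flipped-linked x~y refl refl ai nonadd
      cases (inj₂ i≢l) (inj₂ k≢l) (inj₂ il) (inj₂ kl) =
        mv l p y , (act-keep il ai , inactive-keep i#k i≢l k≢l il kl ai ¬ak) , flipped x~y refl ai

    flip-both : ∀ {i k} → i # k → ∀ x y l → Both i k y → ∃ λ y′ → Both i k y′ × Flipped full x l y y′
    flip-both {i} {k} i#k x y l (ai , ak) = cases (bool-case (κ · ν i l y)) (bool-case (κ · ν k l y))
      where
      p = col i y
      x~y = agree-full x y
      keep : ∀ {l} → κ · ν i l y ≡ false → κ · ν k l y ≡ false → Both i k (mv l p y)
      keep il kl = act-keep il ai , subst (λ q → act k (mv _ q y) ≡ true) (sym (act-equal i#k ai ak))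
          (act-keep kl ak)
      diag : ∀ i → κ · ν i i y ≡ false
      diag i = trans (cong (κ ·_) (ν-diag i y)) (·-zeroʳ κ)
      cases : κ · ν i l y ≡ true ⊎ κ · ν i l y ≡ false → κ · ν k l y ≡ true ⊎ κ · ν k l y ≡ false →
        ∃ λ y′ → Both i k y′ × Flipped full x l y y′
      cases (inj₁ nonadd) _ = mv i p y , keep (diag i) (ν-additive-sym y (#-additive i#k y)) , flipped-linked
          x~y refl refl ai nonadd
      cases _ (inj₁ nonadd) = mv k p y , keep (#-additive i#k y) (diag k) , flipped-linked x~y refl refl ai
          nonadd
      cases (inj₂ il) (inj₂ kl) = mv l p y , keep il kl , flipped x~y refl ai

    Linked : Fin m → Fin m → Set
    Linked i k = ∃ λ x → N i k x ≡ true

    -- This is `flip-lemma` for the function `N i k`, with the split points as the good ones.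
    split-linked : ∀ {i k y} → i # k → Linked i k → Split i k y → ∃ λ x → N i k x ≡ true × Split i k x
    split-linked {i} {k} {y} i#k (z , n) s = proj₁ end , proj₂ (proj₂ (proj₂ end)) , proj₁ (proj₂ (proj₂ end))
      where
      end = flip-lemma (Split i k) (λ z l _ _ → flip-split i#k y z l) (N-Inv i#k y) (agree-full y z) n
          (agree-full y y) s

-- Active lines

module Activity {m : ℕ} (f : Pt m → V) (f-inj : Injective f) (g : Pt m → V) (g-inj : Injective g)
                (f≢g : ∀ x → f x ≢ g x) (κ : V) (κ≢0 : κ ≢ 0F) where

  open Quasi f f-inj
  open Classes f f-inj κ κ≢0
  open Pair f f-inj g g-inj f≢g public
  open WithFunctional κ κ≢0 public

  -- An additive plane has twist `0F` or `κ`, and both are orthogonal to the increment `κ`.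
  twist-κ : ∀ ν a → κ · ν ≡ false → twist ν a κ ≡ 0F
  twist-κ = prove (all λ κ → all λ ν → all λ a → κ · ν ≐ᵇ false ⇒ twist ν a κ ≐ 0F) κ

  mv-comm-κ : ∀ {i j} → i ≢ j → ∀ x a → κ · ν i j x ≡ false → mv j κ (mv i a x) ≡ mv i a (mv j κ x)
  mv-comm-κ i≢j x a h = mv-comm₀ i≢j x a κ (twist-κ (ν _ _ x) a h)

  -- If `l` is apart from `k`, additivity is automatic. Otherwise `k` and `l` lie in one class and
  -- `j` outside it, so nonadditivity after the move would persist under the move back.
  nonadditive-back : ∀ {k l j} d y → j # k → κ · ν k l y ≡ false → κ · ν k l (mv j d y) ≡ false
  nonadditive-back {k} {l} {j} d y j#k h with bool-case (away k l)
  ... | inj₁ l#k = ν-additive-sym _ (#-additive (away⇒# l#k) _)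
  ... | inj₂ l∈  = Bool.¬-not λ nonadd →
      bool-clash (trans (cong (λ z → κ · ν k l z) (trans (sym (mv-back j d y)) (mv-def j d _)))
      (Sep-nonadditive (class-Sep k) (trans k∈ (sym (not-false l∈))) _ j _
          (trans (not-true (#⇒away j#k)) (sym (not-true k∈))) nonadd)) h
    where
    k∈ : class k k ≡ true
    k∈ = ¬#⇒class ¬#-refl

  module _ {j k : Fin m} (j#k : j # k) where

    private
      k#j = #-sym j#k

      -- A loss of activity in normal form. On a flat plane the loss depends on the increment `d`
      -- only through the bit `col k y · d`, and `κ` is not orthogonal to an active colour, so `κ`
      -- can replace any increment that causes it. Moves by `κ` also commute with the moves across
      -- additive planes.
      Tight : Pt m → Set
      Tight y = Both k j y × act k (mv j κ y) ≡ false

      flip-tight : ∀ x y l → Tight y → ∃ λ y′ → Tight y′ × Flipped full x l y y′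
      flip-tight x y l ((ak , aj) , ¬ak) = cases (same l j) (same l k) (bool-case (κ · ν j l y))
          (bool-case (κ · ν k l y))
        where
        p = col j y
        z = mv j κ y
        x~y = agree-full x y
        p-k : p ≡ col k y
        p-k = act-equal j#k aj ak
        aj-z : act j z ≡ true
        aj-z = trans (act-mv j κ y) aj
        col-z : ∀ {l} → act k (mv l (col j z) z) ≡ false → act k (mv l p z) ≡ false
        col-z {l} = subst (λ q → act k (mv l q z) ≡ false) (col-mv j κ y)
        tight : ∀ {l} → κ · ν j l y ≡ false → κ · ν k l y ≡ false → mv j κ (mv l p y) ≡ mv l p z →
          act k (mv l p z) ≡ false → Tight (mv l p y)
        tight jl kl eq h = (subst (λ q → act k (mv _ q y) ≡ true) (sym p-k) (act-keep kl ak) ,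
            act-keep jl aj) , trans (cong (act k) eq) h
        diag : ∀ i → κ · ν i i y ≡ false
        diag i = trans (cong (κ ·_) (ν-diag i y)) (·-zeroʳ κ)
        via-j : Tight (mv j p y)
        via-j = tight (diag j) (#-additive k#j y)
          (trans (mv-mv j κ p y) (trans (cong (λ d → mv j d y) (⊕-comm p κ)) (sym (mv-mv j p κ y))))
          (col-z (inactive-keepˡ j#k aj-z ¬ak))
        via-k : Tight (mv k p y)
        via-k = tight (#-additive j#k y) (diag k) (mv-comm-κ (#⇒≢ k#j) y p (#-additive k#j y))
            (trans (act-mv k p z) ¬ak)
        cases : l ≡ j ⊎ l ≢ j → l ≡ k ⊎ l ≢ k → κ · ν j l y ≡ true ⊎ κ · ν j l y ≡ false →
          κ · ν k l y ≡ true ⊎ κ · ν k l y ≡ false → ∃ λ y′ → Tight y′ × Flipped full x l y y′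
        cases (inj₁ refl) _ _ _ = mv j p y , via-j , flipped x~y refl aj
        cases _ (inj₁ refl) _ _ = mv k p y , via-k , flipped x~y refl aj
        cases _ _ (inj₁ nonadd) _ = mv j p y , via-j , flipped-linked x~y refl refl aj nonadd
        cases _ _ _ (inj₁ nonadd) = mv k p y , via-k , flipped-linked x~y refl refl aj nonadd
        cases (inj₂ l≢j) (inj₂ l≢k) (inj₂ jl) (inj₂ kl) = mv l p y ,
          tight jl kl (mv-comm-κ l≢j y p (ν-additive-sym y jl))
            (col-z (inactive-keep j#k (l≢j ∘ sym) (l≢k ∘ sym) (trans (cong (κ ·_) (ν-mvˡ j l κ y)) jl)
              (nonadditive-back κ y j#k kl) aj-z ¬ak)) ,
          flipped x~y refl aj

    -- A plane of twist `κ` preserves activity. A loss on a flat plane yields a tight point, which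
    -- flips carry to a point where `N k j` is true; there `twisted-act` forbids the loss.
    rigid : Linked k j → ∀ d y → act k y ≡ true → act k (mv j d y) ≡ true
    rigid (z , Nz) d y ak with bool-case (act k (mv j d y))
    ... | inj₁ t = t
    ... | inj₂ ¬ak with bool-case (N k j y)
    ...   | inj₁ n = twisted-act n ak d
    ...   | inj₂ n = no-tight (tight (flat-values k≢j flat (act⇒≢0 ak) d))
      where
      k≢j = #⇒≢ k#j
      p = col k y
      flat : ν k j y ≡ 0F
      flat = N-false (#-additive k#j y) n
      no-tight : ∃ Tight → _
      no-tight (y₀ , t₀)
        with flip-lemma Tight (λ y l _ _ → flip-tight y₀ y l) (N-Inv k#j y₀) (agree-full y₀ z) Nz (agree-refl full y₀) t₀
      ... | y , _ , ((ak , _) , ¬ak) , n = bool-clash (twisted-act n ak κ) ¬ak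
      p·κ : p · κ ≡ true
      p·κ = trans (·-comm p κ) ak
      ¬ak-κ : col k (mv j d y) ≡ 0F → act k (mv j κ y) ≡ false
      ¬ak-κ col0 with bool-case (p · d)
      ... | inj₁ skew = trans (cong (κ ·_) (trans (flat-same k≢j flat (act⇒≢0 ak) κ d (trans p·κ (sym skew)))
          col0)) (·-zeroʳ κ)
      ... | inj₂ orth = contradiction (trans (sym (flat-keep k≢j flat (act⇒≢0 ak) d orth)) col0) (act⇒≢0 ak)
      tight : col k (mv j d y) ≡ p ⊎ col k (mv j d y) ≡ 0F → ∃ Tight
      tight (inj₁ eq) = bool-clash (trans (cong (κ ·_) eq) ak) ¬ak
      -- Direction `j` is active either here or after a move of `k` by `κ`.
      tight (inj₂ col0) with flat-toggle k≢j flat (act⇒≢0 ak) d col0 κ p·κ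
      ... | inj₁ (col-j , _) = y , (ak , trans (cong (κ ·_) col-j) ak) , ¬ak-κ col0
      ... | inj₂ (_ , col-j) = mv k κ y , (trans (act-mv k κ y) ak , trans (cong (κ ·_) col-j) ak) ,
          trans (cong (act k) (mv-comm-κ k≢j y κ (#-additive k#j y))) (trans (act-mv k κ _) (¬ak-κ col0))

  module ClassSlice {i k : Fin m} (i#k : i # k) {x : Pt m} (Nik : N i k x ≡ true) (ai : act i x ≡ true) where

    private
      D = class k
      p = col i x

      N-slice : ∀ {l} → D l ≡ true → ∀ y → N i l y ≡ N i k y
      N-slice {l} Dl y = trans (N-sym i l y)
          (trans (N-class i y (#-sym (class-# Dl i#k)) (#-sym i#k) (class⇒¬# Dl)) (N-sym k i y))

    Near : Pt m → Set
    Near y = N i k y ≡ true × (col i y ≡ p ⊎ col i y ≡ p ⊕ κ)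

    near-act : ∀ {y} → Near y → act i y ≡ true
    near-act (_ , inj₁ eq) = trans (cong (κ ·_) eq) ai
    near-act (_ , inj₂ eq) = trans (cong (κ ·_) eq)
        (prove (all λ κ → all λ p → κ · p ≐ᵇ true ⇒ κ · (p ⊕ κ) ≐ᵇ true) κ p ai)

    near-col : ∀ {l y} → D l ≡ true → Near y → ∀ d → col i (mv l d y) ≡ col i y ⊕ (κ · d ∧ not (act l y)) ⊛ κ
    near-col {l} {y} Dl near d with bool-case (act l y)
    ... | inj₁ al = trans (proj₁ (twisted-both (trans (N-slice Dl y) (proj₁ near)) (near-act near) al d))
        (sym (trans (cong (λ a → col i y ⊕ (κ · d ∧ not a) ⊛ κ) al)
            (prove (all λ c → all λ κ → allᵇ λ b → c ⊕ (b ∧ false) ⊛ κ ≐ c) (col i y) κ (κ · d))))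
    ... | inj₂ ¬al = trans (proj₁ (twisted-one (trans (N-slice Dl y) (proj₁ near)) (near-act near) ¬al d))
        (sym (trans (cong (λ a → col i y ⊕ (κ · d ∧ not a) ⊛ κ) ¬al)
            (prove (all λ c → all λ κ → allᵇ λ b → c ⊕ (b ∧ true) ⊛ κ ≐ c ⊕ b ⊛ κ) (col i y) κ (κ · d))))

    near-mv : ∀ {l y} → D l ≡ true → Near y → ∀ d → Near (mv l d y)
    near-mv {l} {y} Dl near d =
      trans (sym (N-slice Dl _)) (trans (cong (_== κ) (ν-mvʳ i l d y)) (trans (N-slice Dl y) (proj₁ near))) ,
      step (col i y) (κ · d ∧ not (act l y)) (near-col Dl near d) (proj₂ near)
      where
      step : ∀ c b {c′} → c′ ≡ c ⊕ b ⊛ κ → c ≡ p ⊎ c ≡ p ⊕ κ → c′ ≡ p ⊎ c′ ≡ p ⊕ κ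
      step c false refl = subst (λ c → c ≡ p ⊎ c ≡ p ⊕ κ) (sym (⊕-identityʳ c))
      step c true refl (inj₁ refl) = inj₂ refl
      step c true refl (inj₂ refl) = inj₁ (⊕-involutive p κ)

    near-slice : ∀ y → Agree D x y → Near y
    near-slice y x~y = walk D Near (λ z l v Dl near → subst Near (sym (update-mv l v z)) (near-mv Dl near _))
        x y x~y (Nik , inj₁ refl)

    private
      F : Pt m → Bool
      F y = col i y == p

      F-slope : ∀ {l y} → D l ≡ true → Near y → InvAt l F y × ∂ l F y ≡ not (act l y)
      F-slope {l} {y} Dl near = invAt-intro _ λ d → trans (cong (_== p) (near-col Dl near d))
          (toggle (κ · d) (not (act l y)) (proj₂ near))
        where
        toggle : ∀ a b → col i y ≡ p ⊎ col i y ≡ p ⊕ κ → (col i y ⊕ (a ∧ b) ⊛ κ == p) ≡ (col i y == p) xor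
            (a ∧ b)
        toggle a b = prove (all λ κ → neg (κ ≐ 0F) ⇒ all λ p → all λ c → allᵇ λ a → allᵇ λ b →
            c ≐ p ∨ᶜ c ≐ p ⊕ κ ⇒
          (c ⊕ (a ∧ b) ⊛ κ == p) ≐ᵇ (c == p) xor (a ∧ b)) κ κ≢0 p (col i y) a b

    -- On the slice the colour of `i` is `p` or `p ⊕ κ`, and moves along `l` can change it exactly
    -- where `l` is inactive. So the derivatives of `F` are the negated activities, and `∂-class`
    -- equates them.
    act-class : ∀ {l} → D l ≡ true → ∀ y → Agree D x y → act l y ≡ act k y
    act-class {l} Dl y x~y = not-injective (trans (sym (proj₂ (F-slope Dl near))) (trans
      (∂-class (class-Sep k) (Inv-rebase x~y F-Inv) Dl k∈ (class⇒¬# Dl)) (proj₂ (F-slope k∈ near))))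
      where
      near = near-slice y x~y
      k∈ : D k ≡ true
      k∈ = ¬#⇒class ¬#-refl
      F-Inv : Inv D x F
      F-Inv = inv λ y l x~y Dl → proj₁ (F-slope Dl (near-slice y x~y))
      not-injective : ∀ {a b} → not a ≡ not b → a ≡ b
      not-injective {false} {false} _ = refl
      not-injective {true} {true} _ = refl

    linked-class : ∀ {l} → D l ≡ true → N i l x ≡ true
    linked-class Dl = trans (N-slice Dl x) Nik

  Split₁ : Fin m → Fin m → Pt m → Set
  Split₁ i k x = N i k x ≡ true × Split i k x

  split-class : ∀ {i k x} → i # k → Split₁ i k x → ∀ {l} → class k l ≡ true → ∀ d → Split₁ i k (mv l d x)
  split-class {i} {k} {x} i#k (n , ai , ¬ak) {l} Dl d =
    proj₁ near , near-act near , trans (sym (act-class Dl _ x~x′))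
        (trans (act-mv l d x) (trans (act-class Dl x (agree-refl _ x)) ¬ak))
    where
    open ClassSlice i#k n ai
    x~x′ : Agree (class k) x (mv l d x)
    x~x′ = agree-mv l d Dl (agree-refl _ x)
    near = near-slice _ x~x′

  module _ {i j k : Fin m} {x : Pt m} (i#k : i # k) (j#k : j # k) (Njk : Zero (N j k)) (s : Split₁ i k x)
      where

    private
      n = proj₁ s ; ai = proj₁ (proj₂ s) ; ¬ak = proj₂ (proj₂ s)
      p = col i x
      Nkj : Zero (N k j)
      Nkj y = trans (N-sym k j y) (Njk y)
      flat-jk : ∀ y → ν j k y ≡ 0F
      flat-jk y = N-false (#-additive j#k y) (Njk y)
      flat-kj : ∀ y → ν k j y ≡ 0F
      flat-kj y = trans (ν-sym k j y) (flat-jk y)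
      k≢j = #⇒≢ (#-sym j#k)
      commute : ∀ a b y → mv j b (mv k a y) ≡ mv k a (mv j b y)
      commute a b y = mv-comm₀ k≢j y a b (cong (λ ν → twist ν a b) (flat-kj y))

      i#j : i # j
      i#j with #-split i#k j
      ... | inj₁ j#i = #-sym j#i
      ... | inj₂ _ with i #? j
      ...   | yes i#j = i#j
      ...   | no ¬i#j = bool-clash n (trans (N-class k x i#k j#k ¬i#j) (Njk x))

      n-mv : ∀ d → N i k (mv j d x) ≡ true
      n-mv d = trans (N-fixed i#k j#k Njk d x) n

      act-mv-j : ∀ d → act i (mv j d x) ≡ true
      act-mv-j d with bool-case (N i j x)
      ... | inj₁ nij = twisted-act nij ai d
      ... | inj₂ nij = cases (bool-case (p · d)) (bool-case ((p ⊕ κ) · d))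
        where
        i≢j = #⇒≢ i#j
        flat : ν i j x ≡ 0F
        flat = N-false (#-additive i#j x) nij
        -- A move of `k` by `q` turns the colour of `i` into `p ⊕ κ`, so increments orthogonal to
        -- `p ⊕ κ` are as harmless as those orthogonal to `p`. By `flat-same`, an increment
        -- orthogonal to neither acts like `p ⊕ κ`.
        q = unit κ
        x₁ = mv k q x
        flat₁ : ν i j x₁ ≡ 0F
        flat₁ = N-false (#-additive i#j x₁) (trans (N-fixed i#j (#-sym j#k) Nkj q x) nij)
        col₁ : col i x₁ ≡ p ⊕ κ
        col₁ = trans (proj₁ (twisted-one n ai ¬ak q)) (cong (λ b → p ⊕ b ⊛ κ) (·-unit κ κ≢0))
        ai₁ : act i x₁ ≡ true
        ai₁ = trans (cong (κ ·_) col₁) (prove (all λ κ → all λ p → κ · p ≐ᵇ true ⇒ κ · (p ⊕ κ) ≐ᵇ true) κ p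
            ai)
        shifted : ∀ d → (p ⊕ κ) · d ≡ false → act i (mv j d x) ≡ true
        shifted d h = trans (cong (act i) (sym (mv-back k q (mv j d x)))) (twisted-act
          (trans (cong (_== κ) (ν-mvʳ i k q _)) (n-mv d))
          (trans (cong (act i) (sym (commute q d x)))
              (trans (cong (κ ·_) (flat-keep i≢j flat₁ (act⇒≢0 ai₁) d (trans (cong (_· d) col₁) h))) ai₁)) q)
        cases : p · d ≡ true ⊎ p · d ≡ false → (p ⊕ κ) · d ≡ true ⊎ (p ⊕ κ) · d ≡ false →
            act i (mv j d x) ≡ true
        cases (inj₂ h) _ = trans (cong (κ ·_) (flat-keep i≢j flat (act⇒≢0 ai) d h)) ai
        cases _ (inj₂ h) = shifted d h
        cases (inj₁ h) (inj₁ _) = trans (cong (κ ·_) (flat-same i≢j flat (act⇒≢0 ai) d (p ⊕ κ)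
            (trans h (sym (prove (all λ κ → all λ p → κ · p ≐ᵇ true ⇒ p · (p ⊕ κ) ≐ᵇ true) κ p ai)))))
          (shifted (p ⊕ κ) (·-self (p ⊕ κ)))

      -- If k became active, then i and j would be active at a point near x, with colours
      -- that a move along k changes differently.
      ¬act-mv-j : ∀ d → act k (mv j d x) ≡ false
      ¬act-mv-j d = Bool.¬-not λ ak′ → impossible ak′ (flat-values k≢j (flat-kj _) (act⇒≢0 ak′) d)
        where
        x′ = mv j d x
        c = col k x′
        clash : act k x′ ≡ true → ∀ y → N i k y ≡ true → act i y ≡ true → act k y ≡ false → col j y ≡ c → ⊥
        clash ak′ y ny aiy ¬aky cj =
            κ≢0 (prove (all λ κ → all λ c → κ · c ≐ᵇ true ⇒ c ⊕ (κ · c) ⊛ κ ≐ c ⇒ κ ≐ 0F) κ c ak′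
            (trans (sym coli) (trans eq colj)))
          where
          ajy : act j y ≡ true
          ajy = trans (cong (κ ·_) cj) ak′
          ci : col i y ≡ c
          ci = trans (act-equal i#j aiy ajy) cj
          y₁ = mv k c y
          colj : col j y₁ ≡ c
          colj = trans (flat-keep (#⇒≢ j#k) (flat-jk y) (act⇒≢0 ajy) c (trans (cong (_· c) cj) (·-self c))) cj
          coli : col i y₁ ≡ c ⊕ (κ · c) ⊛ κ
          coli = trans (proj₁ (twisted-one ny aiy ¬aky c)) (cong (_⊕ (κ · c) ⊛ κ) ci)
          eq : col i y₁ ≡ col j y₁
          eq = act-equal i#j (twisted-act ny aiy c) (trans (cong (κ ·_) colj) ak′)
        impossible : act k x′ ≡ true → col k (mv j d x′) ≡ c ⊎ col k (mv j d x′) ≡ 0F → ⊥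
        impossible ak′ (inj₁ eq) = bool-clash (trans (cong (act k) (sym (mv-back j d x)))
            (trans (cong (κ ·_) eq) ak′)) ¬ak
        impossible ak′ (inj₂ eq) with flat-toggle k≢j (flat-kj x′) (act⇒≢0 ak′) d eq κ (trans (·-comm c κ) ak′)
        ... | inj₁ (cj , _) = clash ak′ x n ai ¬ak (trans (sym (col-mv j d x)) cj)
        ... | inj₂ (_ , cj) = clash ak′ (mv k κ x) (trans (cong (_== κ) (ν-mvʳ i k κ x)) n)
            (twisted-act n ai κ)
          (trans (act-mv k κ x) ¬ak) (trans (sym (trans (cong (col j) (sym (commute κ d x))) (col-mv j d _)))
              cj)

    split-unlinked : ∀ d → Split₁ i k (mv j d x)
    split-unlinked d = n-mv d , act-mv-j d , ¬act-mv-j d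

-- Points that serve two partners of `f` at once

module Meeting {m : ℕ} (f : Pt m → V) (f-inj : Injective f) (κ : V) (κ≢0 : κ ≢ 0F)
  (g₁ : Pt m → V) (g₁-inj : Injective g₁) (f≢g₁ : ∀ x → f x ≢ g₁ x)
  (g₂ : Pt m → V) (g₂-inj : Injective g₂) (f≢g₂ : ∀ x → f x ≢ g₂ x) where

  open Quasi f f-inj
  open Classes f f-inj κ κ≢0
  private
    module A = Activity f f-inj g₁ g₁-inj f≢g₁ κ κ≢0
    module B = Activity f f-inj g₂ g₂-inj f≢g₂ κ κ≢0

  -- The meeting point takes from z the coordinates that cannot spoil Split₁ i k, and from x
  -- the coordinates that cannot spoil the activity of k.
  meet : ∀ {i k} → i # k → ∀ {x} → A.Split₁ i k x → ∀ {z} → B.act k z ≡ true →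
    ∃ λ w → A.Split₁ i k w × B.act k w ≡ true
  meet {i} {k} i#k {x} s {z} b = w , from-x , from-z
    where
    linked? : ∀ l → Dec (∃ λ y → N k l y ≡ true)
    linked? l = search-Pt λ y → N k l y Bool.≟ true
    -- `M` holds the directions apart from `k` and somewhere linked to it, to which `rigid` applies.
    -- Every other direction is in the class of `k` or nowhere linked to it, which is what
    -- `split-class` and `split-unlinked` require.
    M : Mask m
    M l = away k l ∧ does (linked? l)
    w = merge M x z
    ¬M : ∀ l → M l ≡ false → away k l ≡ true → does (linked? l) ≡ false
    ¬M l h a rewrite a = h
    from-z : B.act k w ≡ true
    from-z = walk M (λ y → B.act k y ≡ true)
      (λ y l v Ml h → trans (cong (B.act k) (update-mv l v y))
        (B.rigid (away⇒# (∧-left Ml)) (does-yes (linked? l) (∧-right {away k l} Ml)) (diff l v y) y h))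
      z w (agree-merge M x z) b
    from-x : A.Split₁ i k w
    from-x = walk (∁ M) (A.Split₁ i k)
      (λ y l v Ml h → subst (A.Split₁ i k) (sym (update-mv l v y))
          (step y l (not-true⁻¹ Ml) (bool-case (away k l)) h (diff l v y)))
      x w (agree λ l Ml → sym (merge-in M x z l (not-false⁻¹ Ml))) s
      where
      step : ∀ y l → M l ≡ false → away k l ≡ true ⊎ away k l ≡ false → A.Split₁ i k y → ∀ d →
          A.Split₁ i k (mv l d y)
      step y l Ml (inj₂ l∈) h d = A.split-class i#k h (not-false l∈) d
      step y l Ml (inj₁ l#k) h d = A.split-unlinked i#k (away⇒# l#k)
        (λ y → Bool.¬-not λ n → does-no (linked? l) (¬M l Ml l#k) (y , trans (N-sym k l y) n)) h d

-- Classes with and without active lines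

module Touching {m : ℕ} (f : Pt m → V) (f-inj : Injective f) (g : Pt m → V) (g-inj : Injective g)
                (f≢g : ∀ x → f x ≢ g x) (κ : V) (κ≢0 : κ ≢ 0F) where

  open Quasi f f-inj
  open Classes f f-inj κ κ≢0
  open Activity f f-inj g g-inj f≢g κ κ≢0 public

  Untouched : Mask m → Set
  Untouched D = ∀ l → D l ≡ true → ∀ x → act l x ≡ false

  untouched? : ∀ D → Dec (Untouched D)
  untouched? D = forall? any? λ l → (D l Bool.≟ true) →-dec forall? search-Pt λ x → act l x Bool.≟ false

  Touched : Mask m → Set
  Touched D = ∃ λ l → ∃ λ x → D l ≡ true × act l x ≡ true

  touch : ∀ {D} → ¬ Untouched D → Touched D
  touch {D} ¬un with any? (λ l → search-Pt λ x → (D l Bool.≟ true) ×-dec (act l x Bool.≟ true))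
  ... | yes t = t
  ... | no ¬t = contradiction (λ l Dl x → Bool.¬-not λ a → ¬t (l , x , Dl , a)) ¬un

  touched-apart : ∀ a b → ¬ Untouched (class a) → Untouched (class b) → a # b
  touched-apart a b ¬ua ub with a #? b
  ... | yes a#b = a#b
  ... | no ¬a#b = contradiction (λ l l∈ → ub l (class-trans (¬#⇒class ¬a#b) l∈)) ¬ua

  -- This is `meet` with both partners equal to `g`: an active line in a direction of the class
  -- would lead to a point where that direction is both active and inactive.
  split-untouched : ∀ {i k x} → i # k → Split₁ i k x → Untouched (class k)
  split-untouched {i} {k} {x} i#k (n , ai , ¬ak) l Dl z = Bool.¬-not λ al →
    let open ClassSlice i#k n ai
        s = linked-class Dl , ai , trans (act-class Dl x (agree-refl _ x)) ¬ak
        w , (_ , _ , ¬al) , al′ = Meeting.meet f f-inj κ κ≢0 g g-inj f≢g g g-inj f≢g (class-# Dl i#k) s al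
    in bool-clash al′ ¬al

  spread : ∀ {i k y} → i # k → Linked i k → act i y ≡ true → act k y ≡ true ⊎ Untouched (class k)
  spread {i} {k} {y} i#k lnk ai with bool-case (act k y)
  ... | inj₁ ak = inj₁ ak
  ... | inj₂ ¬ak = inj₂ (let x , s = split-linked i#k lnk (ai , ¬ak) in split-untouched i#k s)

  θ : Pt m → Bool
  θ x = κ · u x

  θ-mv : ∀ i d x → θ (mv i d x) ≡ θ x xor ((col i x · d) ∧ act i x)
  θ-mv i d x = trans (cong (κ ·_) (u-mv i d x)) (prove (all λ κ → all λ c → all λ p → all λ d →
    κ · (c ⊕ shear p d) ≐ᵇ κ · c xor ((p · d) ∧ κ · p)) κ (u x) (col i x) d)

  θ-inactive : ∀ {i x} → act i x ≡ false → ∀ v → θ (x [ i ]≔ v) ≡ θ x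
  θ-inactive {i} {x} ¬a v = trans (cong θ (update-mv i v x))
      (trans (θ-mv i _ x) (trans (cong (λ a → θ x xor (_ ∧ a)) ¬a)
    (prove (allᵇ λ t → allᵇ λ s → t xor (s ∧ false) ≐ᵇ t) (θ x) (col i x · diff i v x))))

  θ-active : ∀ {i x} → act i x ≡ true → ∃ λ v → θ (x [ i ]≔ v) ≢ θ x
  θ-active {i} {x} a = pos i d x , λ eq → bool-clash (·-unit (col i x) (act⇒≢0 a))
      (cancel (θ x) (col i x · d) (trans (cong (λ a → θ x xor ((col i x · d) ∧ a)) (sym a))
        (trans (sym (θ-mv i d x)) (trans (cong θ (mv-def i d x)) eq))))
    where
    d = unit (col i x)
    cancel : ∀ t s → t xor (s ∧ true) ≡ t → s ≡ false
    cancel = prove (allᵇ λ t → allᵇ λ s → t xor (s ∧ true) ≐ᵇ t ⇒ s ≐ᵇ false)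

  θ-changes : ∀ {i x v} → θ (x [ i ]≔ v) ≢ θ x → act i x ≡ true
  θ-changes {i} {x} {v} h with bool-case (act i x)
  ... | inj₁ a = a
  ... | inj₂ ¬a = contradiction (θ-inactive ¬a v) h

  act-update : ∀ i x v → act i (x [ i ]≔ v) ≡ act i x
  act-update i x v = trans (cong (act i) (update-mv i v x)) (act-mv i _ x)

  -- `θ` changes along the line of `i` through `x`. On this whole line `i` is active, hence `k`
  -- inactive, so a step along `k` preserves `θ` at each of its points and the change survives.
  act-persist : ∀ {i k} → i ≢ k → (∀ x → act i x ≡ true → act k x ≡ false) → ∀ x v → act i x ≡ true →
      act i (x [ k ]≔ v) ≡ true
  act-persist {i} {k} i≢k excl x v ai = let a , h = θ-active ai in θ-changes {v = a} λ eq →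
    h (trans (sym (θ-inactive (excl _ (trans (act-update i x a) ai)) v))
      (trans (cong θ ([]≔-commutes x i k i≢k)) (trans eq (θ-inactive (excl x ai) v))))

  -- Otherwise the two active lines could be carried to a common point.
  one-sided : ∀ (U : Mask m) → (∀ i k x → U i ≡ true → U k ≡ false → act i x ≡ true → act k x ≡ false) →
    ∀ {i k x y} → U i ≡ true → U k ≡ false → act i x ≡ true → act k y ≡ true → ⊥
  one-sided U never {i} {k} {x} {y} Ui Uk ai ak = bool-clash ak-end (never i k _ Ui Uk ai-end)
    where
    ai-end : act i (merge U x y) ≡ true
    ai-end = walk (∁ U) (λ z → act i z ≡ true)
      (λ z l v Ul → act-persist (λ { refl → bool-clash Ui (not-true⁻¹ Ul) })
          (λ z → never i l z Ui (not-true⁻¹ Ul)) z v)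
      x (merge U x y) (agree λ l Ul → sym (merge-in U x y l (not-false⁻¹ Ul))) ai
    never′ : ∀ i k x → U i ≡ true → U k ≡ false → act k x ≡ true → act i x ≡ false
    never′ i k x Ui Uk ak = Bool.¬-not λ ai → bool-clash ak (never i k x Ui Uk ai)
    ak-end : act k (merge U x y) ≡ true
    ak-end = walk U (λ z → act k z ≡ true)
      (λ z l v Ul → act-persist (λ { refl → bool-clash Ul Uk }) (λ z → never′ l k z Ul Uk) z v)
      y (merge U x y) (agree-merge U x y) ak

  Crossing : Mask m → Set
  Crossing W = ∃ λ i → ∃ λ j → W i ≡ true × W j ≡ false × Linked i j

  module Monochrome (crossing : ∀ W → Sep W → ∀ a b → W a ≡ true → W b ≡ false → Crossing W)
    (a₀ b₀ : Fin m) (a₀#b₀ : a₀ # b₀) (touched : ∀ k → ¬ Untouched (class k)) (i₀ : Fin m) (x₀ : Pt m)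
        (act₀ : act i₀ x₀ ≡ true) where

    other : ∀ l → ∃ λ k → k # l
    other l with #-split a₀#b₀ l
    ... | inj₁ l#a = a₀ , #-sym l#a
    ... | inj₂ l#b = b₀ , #-sym l#b

    linked-sym : ∀ {i k} → Linked i k → Linked k i
    linked-sym (x , n) = x , trans (N-sym _ _ x) n

    -- By `N-class` a class shares its links to `k`. Activity can thus pass through `k` between two
    -- directions of one class, which are not apart.
    neighbour : ∀ l → ∃ λ k → k # l × (∀ l′ → ¬ l′ # l → l′ # k × Linked l′ k)
    neighbour l
      with crossing (class l) (class-Sep l) l (proj₁ (other l)) (self-class l) (not-true (#⇒away (proj₂ (other l))))
    ... | a , k , a∈ , k∉ , y , n = k , k#l , λ l′ h → let l′#k = #-sym (class-# (¬#⇒class h) k#l) in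
        l′#k , y , trans (trans (N-class k y l′#k (#-sym k#l) h)
            (sym (N-class k y a#k (#-sym k#l) (class⇒¬# a∈)))) n
      where
      k#l : k # l
      k#l = away⇒# (not-false⁻¹ k∉)
      a#k : a # k
      a#k = #-sym (class-# a∈ k#l)

    spread′ : ∀ {i k x} → i # k → Linked i k → act i x ≡ true → act k x ≡ true
    spread′ {k = k} i#k lnk ai with spread i#k lnk ai
    ... | inj₁ ak = ak
    ... | inj₂ un = contradiction un (touched k)

    -- The directions active at `x` form a separated set, because activity passes within each class
    -- by way of a `neighbour`. Were this set proper, a link across it would spread activity beyond
    -- it.
    all-active : ∀ {i x} → act i x ≡ true → ∀ k → act k x ≡ true
    all-active {i} {x} ai k with bool-case (act k x)
    ... | inj₁ ak = ak
    ... | inj₂ ¬ak = let a , b , Ua , Ub , lnk = crossing U U-Sep i k ai ¬ak in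
        bool-clash (spread′ (apart a b Ua Ub) lnk Ua) Ub
      where
      U : Mask m
      U l = act l x
      apart : ∀ a b → U a ≡ true → U b ≡ false → a # b
      apart a b Ua Ub with a #? b
      ... | yes a#b = a#b
      ... | no ¬a#b = let c , c#a , near = neighbour a
                          a#c , lnk = near a ¬#-refl
                          b#c , lnk′ = near b (¬a#b ∘ #-sym)
                      in bool-clash (spread′ (#-sym b#c) (linked-sym lnk′) (spread′ a#c lnk Ua)) Ub
      U-Sep : Sep U
      U-Sep = separated λ a b z Ua Ub → #-additive (apart a b Ua Ub) z

    equal : ∀ {x} → (∀ k → act k x ≡ true) → ∀ i j → col i x ≡ col j x
    equal {x} h i j with i #? j
    ... | yes i#j = act-equal i#j (h i) (h j)
    ... | no ¬i#j = let k , k#j = other j in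
      trans (act-equal (#-sym (class-# (¬#⇒class ¬i#j) k#j)) (h i) (h k)) (act-equal k#j (h k) (h j))

    monochrome : ∃ λ p → κ · p ≡ true × (∀ i x → col i x ≡ p)
    monochrome = p , act₀ , λ i x → proj₂ (everywhere P step x₀ x start) i
      where
      p = col i₀ x₀
      P : Pt m → Set
      P x = (∀ k → act k x ≡ true) × (∀ k → col k x ≡ p)
      start : P x₀
      start = all-active act₀ , λ k → equal (all-active act₀) k i₀
      step : ∀ x l v → P x → P (x [ l ]≔ v)
      step x l v (h , c) rewrite update-mv l v x = h′ , λ k → trans (equal h′ k l)
          (trans (col-mv l _ x) (c l))
        where h′ = all-active {l} (trans (act-mv l _ x) (h l))

-- Additive cuts

module AdditiveCut {m : ℕ} (f : Pt m → V) (f-inj : Injective f) (W : Mask m) where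

  open Quasi f f-inj

  Additive : Set
  Additive = ∀ i j x → W i ≡ true → W j ≡ false → ν i j x ≡ 0F

  pos-flat : ∀ {l j} → l ≢ j → ∀ d y v → ν l j y ≡ 0F → pos l d (y [ j ]≔ v) ≡ pos l d y
  pos-flat {l} {j} l≢j d y v flat = sym (pos-unique l d (y [ j ]≔ v) (pos l d y) (begin
    f ((y [ j ]≔ v) [ l ]≔ pos l d y)
      ≡⟨ cong f ([]≔-commutes y j l (l≢j ∘ sym)) ⟩
    f ((y [ l ]≔ pos l d y) [ j ]≔ v)
      ≡⟨ law (ν-twist l≢j y) (pos l d y) v ⟩
    f (y [ l ]≔ pos l d y) ⊕ f (y [ j ]≔ v) ⊕ f y ⊕ twist (ν l j y) (diff l (pos l d y) y) (diff j v y)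
      ≡⟨ cong₂ (λ a n → a ⊕ f (y [ j ]≔ v) ⊕ f y ⊕ twist n (diff l (pos l d y) y) (diff j v y))
          (trans (cong f (sym (mv-def l d y))) (f-mv l d y)) flat ⟩
    f y ⊕ d ⊕ f (y [ j ]≔ v) ⊕ f y ⊕ 0F
      ≡⟨ prove (all λ a → all λ d → all λ b → a ⊕ d ⊕ b ⊕ a ⊕ 0F ≐ b ⊕ d) (f y) d (f (y [ j ]≔ v)) ⟩
    f (y [ j ]≔ v) ⊕ d ∎))
    where open ≡-Reasoning

  pos-agree : Additive → ∀ {l} → W l ≡ true → ∀ d {x y} → Agree (∁ W) x y → pos l d y ≡ pos l d x
  pos-agree add {l} Wl d {x} {y} x~y = walk (∁ W) (λ y → pos l d y ≡ pos l d x)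
    (λ y j v Wj h → trans (pos-flat (λ { refl → bool-clash Wl (not-true⁻¹ Wj) }) d y v
        (add l j y Wl (not-true⁻¹ Wj))) h)
    x y x~y refl

  merge-mv : Additive → ∀ {l} → W l ≡ true → ∀ d x z → merge W (mv l d x) z ≡ mv l d (merge W x z)
  merge-mv add {l} Wl d x z = trans (cong (λ y → merge W y z) (mv-def l d x))
      (trans (merge-update W x z l (pos l d x) Wl)
    (trans (cong (merge W x z [ l ]≔_) (sym (pos-agree add Wl d (merge-agree W x z))))
        (sym (mv-def l d (merge W x z)))))

module CutColours {m : ℕ} (f : Pt m → V) (f-inj : Injective f) (g : Pt m → V) (g-inj : Injective g)
                  (f≢g : ∀ x → f x ≢ g x) where

  open Quasi f f-inj
  open Pair f f-inj g g-inj f≢g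

  module _ (κ : V) (κ≢0 : κ ≢ 0F) (D : Mask m) (flat : ∀ i j x → D i ≡ true → D j ≡ false → ν i j x ≡ 0F)
      where

    open Classes f f-inj κ κ≢0
    open WithFunctional κ κ≢0

    -- A Boolean function of the single bit `κ · d` is affine in it.
    invAt-level : ∀ {l G y} → (∀ d e → κ · d ≡ κ · e → G (mv l d y) ≡ true → G (mv l e y) ≡ true) →
        InvAt l G y
    invAt-level {l} {G} {y} h = invAt λ d → trans (at d (bool-case (κ · d)))
        (cong (λ e → G y xor (κ · d ∧ e)) (sym (∂-def l G y)))
      where
      same-level : ∀ d e → κ · d ≡ κ · e → G (mv l d y) ≡ G (mv l e y)
      same-level d e eq with bool-case (G (mv l d y)) | bool-case (G (mv l e y))
      ... | inj₁ t | _ = trans t (sym (h d e eq t))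
      ... | inj₂ n | inj₂ n′ = trans n (sym n′)
      ... | inj₂ n | inj₁ t = bool-clash (h e d (sym eq) t) n
      at : ∀ d → κ · d ≡ true ⊎ κ · d ≡ false → G (mv l d y) ≡ G y xor (κ · d ∧ (G y xor G (mv l (unit κ) y)))
      at d (inj₁ t) = trans (same-level d (unit κ) (trans t (sym (·-unit κ κ≢0)))) (trans
        (prove (allᵇ λ a → allᵇ λ b → b ≐ᵇ a xor (a xor b)) (G y) _)
        (cong (λ k → G y xor (k ∧ (G y xor G (mv l (unit κ) y)))) (sym t)))
      at d (inj₂ n) = trans (same-level d 0F (trans n (sym (·-zeroʳ κ)))) (trans (cong G (mv-0 l y)) (trans
        (prove (allᵇ λ a → allᵇ λ b → a ≐ᵇ a xor (false ∧ b)) (G y) true)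
        (cong (λ k → G y xor (k ∧ (G y xor G (mv l (unit κ) y)))) (sym n))))

    -- Two increments on one level of `κ · _` differ by a vector orthogonal to `κ`, and such a move
    -- keeps the colour `κ` on a flat plane.
    colour-inv : ∀ {k} → D k ≡ false → ∀ x → Inv D x (λ y → col k y == κ)
    colour-inv {k} ¬Dk x = inv λ y l _ Dl → invAt-level λ d e eq h →
      let c : col k (mv l d y) ≡ κ
          c = ==-sound (col k (mv l d y)) κ h
      in trans (cong (λ z → col k z == κ)
          (sym (trans (mv-mv l (d ⊕ e) d y) (cong (λ a → mv l a y) (⊕-involutiveˡ d e)))))
        (trans (cong (_== κ) (flat-keep (λ { refl → bool-clash Dl ¬Dk })
            (trans (ν-sym k l _) (flat l k _ Dl ¬Dk)) (κ≢0 ∘ trans (sym c)) (d ⊕ e)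
          (trans (cong (_· (d ⊕ e)) c)
              (prove (all λ κ → all λ d → all λ e → κ · d ≐ᵇ κ · e ⇒ κ · (d ⊕ e) ≐ᵇ false) κ d e eq)))) h)

    keep-active : ∀ {i x G} → D i ≡ true → act i x ≡ true → Inv D x G → ∀ {z} → Agree D x z → G z ≡ true →
      ∃ λ y → Agree D x y × act i y ≡ true × G y ≡ true
    keep-active {i} {x} Di ai h x~z Gz = flip-lemma (λ y → act i y ≡ true)
      (λ y l x~y Dl a → flips y l x~y Dl a (bool-case (κ · ν i l y))) h x~z Gz (agree-refl D x) ai
      where
      flips : ∀ y l → Agree D x y → D l ≡ true → act i y ≡ true → κ · ν i l y ≡ true ⊎ κ · ν i l y ≡ false →
        ∃ λ y′ → act i y′ ≡ true × Flipped D x l y y′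
      flips y l x~y Dl a (inj₁ nonadd) = mv i (col i y) y , trans (act-mv i _ y) a , flipped-linked x~y Dl Di
          a nonadd
      flips y l x~y Dl a (inj₂ add) = mv l (col i y) y , act-keep add a , flipped x~y Dl a

  module _ (W : Mask m) (flat : AdditiveCut.Additive f f-inj W) where

    private
      flat∁ : ∀ i j x → ∁ W i ≡ true → ∁ W j ≡ false → ν i j x ≡ 0F
      flat∁ i j x Wi Wj = trans (ν-sym i j x) (flat j i x (not-false⁻¹ Wj) (not-true⁻¹ Wi))

      skew : ∀ a b → a ≢ 0F → b ≢ 0F → a ≢ b → a · b ≡ true
      skew = prove (all λ a → all λ b → neg (a ≐ 0F) ⇒ neg (b ≐ 0F) ⇒ neg (a ≐ b) ⇒ a · b ≐ᵇ true)

    -- Distinct nonzero vectors are not orthogonal, so for `κ` the colour of `k` at `z`, direction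
    -- `i` is active at `x`. Moving inside `W` only, `keep-active` reaches a point `a` where `i` is
    -- still active and where `k` has colour `κ` once the coordinates outside `W` are taken from
    -- `z`. A second use, outside `W` only, brings two different nonzero colours to one point,
    -- against `flat-equal`.
    cut-colours : ∀ {i k x z} → W i ≡ true → W k ≡ false → col i x ≢ 0F → col k z ≢ 0F → col i x ≡ col k z
    cut-colours {i} {k} {x} {z} Wi Wk ci≢0 ck≢0 with same (col i x) (col k z)
    ... | inj₁ eq = eq
    ... | inj₂ neq = ⊥-elim (first (keep-active κ ck≢0 W flat Wi (skew κ (col i x) ck≢0 ci≢0 (neq ∘ sym))
        G-inv (agree-merge W z x)
        (trans (cong (λ y → col k y == κ) (merge-merge W z x)) (==-refl κ))))
      where
      κ = col k z
      G : Pt m → Bool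
      G y = col k (merge W y z) == κ
      open Functional f f-inj κ ck≢0 using (Inv; inv; invAt; invariant; change; ∂; ∂-def)
      G-inv : Inv W x G
      G-inv = inv λ y l x~y Wl → invAt λ d →
          trans (cong (λ y → col k y == κ) (AdditiveCut.merge-mv f f-inj W flat Wl d y z))
        (trans (change (invariant (colour-inv κ ck≢0 W flat Wk (merge W y z)) (merge W y z) l
            (agree-refl W _) Wl) d)
        (cong (λ e → G y xor (κ · d ∧ e)) (trans (∂-def l (λ y → col k y == κ) (merge W y z))
          (trans (cong (λ v → G y xor (col k v == κ))
              (sym (AdditiveCut.merge-mv f f-inj W flat Wl (unit κ) y z))) (sym (∂-def l G y))))))
      second : ∀ a → κ · col i a ≡ true → G a ≡ true → (p≢0 : col i a ≢ 0F) →
        (∃ λ y → Agree (∁ W) (merge W a z) y × col i a · col k y ≡ true × (col i y == col i a) ≡ true) → ⊥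
      second a act-a Ga p≢0 (y , _ , act-y , Gy) = bool-clash act-y (trans (cong (p ·_) (trans (sym
          (flat-equal (λ { refl → bool-clash Wi Wk }) (flat i k y Wi Wk) (p≢0 ∘ trans (sym col-i))
          λ eq → bool-clash act-y (trans (cong (p ·_) eq) (·-zeroʳ p)))) col-i)) (·-self p))
        where
        p = col i a
        col-i : col i y ≡ p
        col-i = ==-sound (col i y) p Gy
      first : (∃ λ a → Agree W x a × κ · col i a ≡ true × G a ≡ true) → ⊥
      -- The roles are exchanged: the colour `p` of `i` at `a` is now the functional, and `k` the
      -- active direction.
      first (a , _ , act-a , Ga) = second a act-a Ga p≢0 (keep-active p p≢0 (∁ W) flat∁ (not-false Wk)
          (trans (cong (p ·_) (==-sound (col k (merge W a z)) κ Ga)) (trans (·-comm p κ) act-a))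
          (colour-inv p p≢0 (∁ W) flat∁ (not-true Wi) (merge W a z)) (agree-sym (merge-agree W a z))
              (==-refl p))
        where
        p = col i a
        p≢0 : p ≢ 0F
        p≢0 eq = bool-clash act-a (trans (cong (κ ·_) eq) (·-zeroʳ κ))

-- Contraction to a set of coordinates

-- Changing the coordinates outside I acts on the values of f and of g by the same map.
Contractible : ∀ {m} → Mask m → (Pt m → V) → (Pt m → V) → Set
Contractible I f g = ∀ x x′ → Σ (V → V) λ A → ∀ y → Agree I x y →
  f (merge I y x′) ≡ A (f y) × g (merge I y x′) ≡ A (g y)

contract : ∀ {m} (I : Mask m) (f g : Pt m → V) →
  (∀ k w x → I k ≡ false → Σ (V → V) λ A → ∀ y → Agree I x y → f (y [ k ]≔ w) ≡ A (f y) × g (y [ k ]≔ w) ≡ A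
      (g y)) →
  Contractible I f g
contract {m} I f g one x x′ = everywhere P step x x′ start
  where
  P : Pt m → Set
  P x′ = Σ (V → V) λ A → ∀ y → Agree I x y → f (merge I y x′) ≡ A (f y) × g (merge I y x′) ≡ A (g y)
  start : P x
  start = id , λ y x~y → cong f (merge-agreed I x y x~y) , cong g (merge-agreed I x y x~y)
  step : ∀ x′ k w → P x′ → P (x′ [ k ]≔ w)
  step x′ k w (A , h) with bool-case (I k)
  ... | inj₁ Ik = A , λ y x~y → trans (cong f (merge-ignoreʳ I y x′ k w Ik)) (proj₁ (h y x~y)) ,
                              trans (cong g (merge-ignoreʳ I y x′ k w Ik)) (proj₂ (h y x~y))
  ... | inj₂ Ik = let B , h′ = one k w x′ Ik in B ∘ A , λ y x~y →
    let e = merge-updateʳ I y x′ k w Ik ; h″ = h′ (merge I y x′) (agree-merge I y x′) in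
    trans (cong f e) (trans (proj₁ h″) (cong B (proj₁ (h y x~y)))) , trans (cong g e)
        (trans (proj₂ h″) (cong B (proj₂ (h y x~y))))

-- The effect on the values of `f`, in planes of twist `n`, of a fixed change of one coordinate
-- whose increment is `d` where `f` is `c`.
shift : V → V → V → V → V
shift n d c z = z ⊕ d ⊕ twist n d (z ⊕ c)

module Sliding {m : ℕ} (f : Pt m → V) (f-inj : Injective f) where

  open Quasi f f-inj

  slide : ∀ (I : Mask m) {k n x} → I k ≡ false → (∀ l y → I l ≡ true → Agree I x y → ν l k y ≡ n) →
    ∀ w y → Agree I x y → f (y [ k ]≔ w) ≡ shift n (diff k w x) (f x) (f y)
  slide I {k} {n} {x} Ik const w y x~y = proj₂ (walk I P step x y x~y (agree-refl I x ,
      prove (all λ n → all λ a → all λ b → b ≐ shift n (a ⊕ b) a a) n (f x) (f (x [ k ]≔ w))))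
    where
    P : Pt m → Set
    P y = Agree I x y × f (y [ k ]≔ w) ≡ shift n (diff k w x) (f x) (f y)
    step : ∀ y l v → I l ≡ true → P y → P (y [ l ]≔ v)
    step y l v Il (x~y , h) = agree-update l v Il x~y , trans (law (ν-twist (λ { refl → bool-clash Il Ik }) y)
        v w)
      (trans (cong₂ (λ μ b → f (y [ l ]≔ v) ⊕ b ⊕ f y ⊕ twist μ (f y ⊕ f (y [ l ]≔ v)) (f y ⊕ b))
          (const l y Il x~y) h)
      (prove (all λ n → all λ d → all λ c → all λ z → all λ z′ →
        z′ ⊕ shift n d c z ⊕ z ⊕ twist n (z ⊕ z′) (z ⊕ shift n d c z) ≐ shift n d c z′)
        n (diff k w x) (f x) (f y) (f (y [ l ]≔ v))))

-- If the twists between I and an untouched coordinate depended on the coordinate in I, then I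
-- would fall into two parts whose activities never meet, and one of them would be untouched.
module Uniform {m : ℕ} (f : Pt m → V) (f-inj : Injective f) (g : Pt m → V) (g-inj : Injective g)
               (f≢g : ∀ x → f x ≢ g x) (κ : V) (κ≢0 : κ ≢ 0F) where

  open Quasi f f-inj
  open Classes f f-inj κ κ≢0
  open Touching f f-inj g g-inj f≢g κ κ≢0

  module _ (I : Mask m) (I-Sep : Sep I) (quiet : Untouched (∁ I))
           (lively : ∀ D → Sep D → ∀ i → D i ≡ true → (∀ l → D l ≡ true → I l ≡ true) → ¬ Untouched D) where

    private
      -- A move along `k` by the common colour `p` of `l` and `l′` adds `κ` to the colour of `l` and
      -- keeps that of `l′`, although both directions stay active and must have equal colours.
      clash : ∀ {l l′ k y} → l # l′ → l′ # k → N l k y ≡ true → N l′ k y ≡ false → Both l l′ y →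
          act k y ≡ false → ⊥
      clash {l} {l′} {k} {y} l#l′ l′#k n n′ (a , a′) ¬ak =
        κ≢0 (prove (all λ κ → all λ p → κ · p ≐ᵇ true ⇒ p ⊕ (κ · p) ⊛ κ ≐ p ⇒ κ ≐ 0F) κ p a
            (trans (sym col-l) (trans eq col-l′)))
        where
        p = col l y
        y′ = mv k p y
        col-l : col l y′ ≡ p ⊕ (κ · p) ⊛ κ
        col-l = proj₁ (twisted-one n a ¬ak p)
        p≡ : p ≡ col l′ y
        p≡ = act-equal l#l′ a a′
        col-l′ : col l′ y′ ≡ p
        col-l′ = trans (flat-keep (#⇒≢ l′#k) (N-false (#-additive l′#k y) n′) (act⇒≢0 a′) p
            (trans (cong (_· p) (sym p≡)) (·-self p))) (sym p≡)
        eq : col l y′ ≡ col l′ y′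
        eq = act-equal l#l′ (twisted-act n a p) (trans (cong (κ ·_) col-l′) a)

      never-both : ∀ {l l′ k x} → l # l′ → l # k → l′ # k → (∀ y → act k y ≡ false) → N l k x ≢ N l′ k x →
        ∀ y → act l y ≡ true → act l′ y ≡ false
      never-both {l} {l′} {k} {x} l#l′ l#k l′#k ¬ak differ y a = Bool.¬-not λ a′ →
        end (flip-lemma (Both l l′) (λ z j _ _ → flip-both l#l′ y z j) G-Inv (agree-full y x) G-x
            (agree-refl full y) (a , a′))
        where
        G : Pt m → Bool
        G z = N l k z xor N l′ k z
        xor-≢ : ∀ {a b} → a ≢ b → a xor b ≡ true
        xor-≢ {false} {false} h = contradiction refl h
        xor-≢ {false} {true} h = refl
        xor-≢ {true} {false} h = refl
        xor-≢ {true} {true} h = contradiction refl h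
        G-x = xor-≢ differ
        G-Inv : Inv full y G
        G-Inv = inv λ z j _ _ → proj₁ (invAt-intro (∂ j (N l k) z xor ∂ j (N l′ k) z) λ d →
          trans (cong₂ _xor_ (change (invariant (N-Inv l#k z) z j (agree-refl full z) refl) d)
                             (change (invariant (N-Inv l′#k z) z j (agree-refl full z) refl) d))
          (prove (allᵇ λ a → allᵇ λ b → allᵇ λ t → allᵇ λ e → allᵇ λ e′ →
            (a xor (t ∧ e)) xor (b xor (t ∧ e′)) ≐ᵇ (a xor b) xor (t ∧ (e xor e′))) (N l k z) (N l′ k z)
                (κ · d) (∂ j (N l k) z) (∂ j (N l′ k) z)))
        end : (∃ λ z → Agree full y z × Both l l′ z × G z ≡ true) → ⊥
        end (z , _ , both , Gz) with bool-case (N l k z) | bool-case (N l′ k z)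
        ... | inj₁ n | inj₂ n′ = clash l#l′ l′#k n n′ both (¬ak z)
        ... | inj₂ n | inj₁ n′ = clash (#-sym l#l′) l#k n′ n (proj₂ both , proj₁ both) (¬ak z)
        ... | inj₁ n | inj₁ n′ = bool-clash Gz (cong₂ _xor_ n n′)
        ... | inj₂ n | inj₂ n′ = bool-clash Gz (cong₂ _xor_ n n′)

    uniform : ∀ {i j k} → I i ≡ true → I j ≡ true → I k ≡ false → ∀ x → N i k x ≡ N j k x
    uniform {i} {j} {k} Ii Ij Ik = λ x → sym (does-yes (alike? j) (∧-right {I j} (in-U j Ij)) x)
      where
      #k : ∀ {l} → I l ≡ true → l # k
      #k Il = Sep-#′ I-Sep Il Ik
      alike? : ∀ l → Dec (∀ x → N l k x ≡ N i k x)
      alike? l = forall? search-Pt λ x → N l k x Bool.≟ N i k x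
      U : Mask m
      U l = I l ∧ does (alike? l)
      intro : ∀ l → I l ≡ true → (∀ x → N l k x ≡ N i k x) → U l ≡ true
      intro l Il h rewrite Il = dec-true (alike? l) h
      unlike : ∀ l → I l ≡ true → U l ≡ false → ¬ (∀ x → N l k x ≡ N i k x)
      unlike l Il ¬Ul h = bool-clash (intro l Il h) ¬Ul
      apart : ∀ a b → U a ≡ true → U b ≡ false → a # b
      apart a b Ua Ub with bool-case (I b) | a #? b
      ... | _ | yes a#b = a#b
      ... | inj₂ Ib | no _ = Sep-#′ I-Sep (∧-left Ua) Ib
      ... | inj₁ Ib | no ¬a#b = contradiction
        (λ x → trans (N-class k x (#k Ib) (#k (∧-left Ua)) (¬a#b ∘ #-sym))
            (does-yes (alike? a) (∧-right {I a} Ua) x)) (unlike b Ib Ub)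
      U-Sep : Sep U
      U-Sep = separated λ a b x Ua Ub → #-additive (apart a b Ua Ub) x
      U′ : Mask m
      U′ l = I l ∧ not (U l)
      U′-out : ∀ l → U′ l ≡ false → U l ≡ true ⊎ I l ≡ false
      U′-out l h with I l
      ... | true = inj₁ (not-false⁻¹ h)
      ... | false = inj₂ refl
      U′-Sep : Sep U′
      U′-Sep = separated λ a b x U′a U′b →
          #-additive (apart′ a b (∧-left U′a , not-true⁻¹ (∧-right {I a} U′a)) (U′-out b U′b)) x
        where
        apart′ : ∀ a b → I a ≡ true × U a ≡ false → U b ≡ true ⊎ I b ≡ false → a # b
        apart′ a b (_ , Ua) (inj₁ Ub) = #-sym (apart b a Ub Ua)
        apart′ a b (Ia , _) (inj₂ Ib) = Sep-#′ I-Sep Ia Ib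
      exclusive : ∀ a b y → U a ≡ true → U b ≡ false → act a y ≡ true → act b y ≡ false
      exclusive a b y Ua Ub aa with bool-case (I b)
      ... | inj₂ Ib = quiet b (not-false Ib) y
      ... | inj₁ Ib with forall? search-Pt (λ x → N a k x Bool.≟ N b k x)
      ...   | yes eq = contradiction (λ x → trans (sym (eq x)) (does-yes (alike? a) (∧-right {I a} Ua) x))
          (unlike b Ib Ub)
      ...   | no neq with search-Pt (λ x → ¬? (N a k x Bool.≟ N b k x))
      ...     | yes (x , differ) = never-both (apart a b Ua Ub) (#k (∧-left Ua)) (#k Ib)
          (quiet k (not-false Ik)) differ y aa
      ...     | no none = contradiction (λ x → decided (N a k x) (N b k x) (λ h → none (x , h))) neq
        where
        decided : ∀ a b → ¬ (a ≢ b) → a ≡ b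
        decided false false _ = refl
        decided true true _ = refl
        decided false true h = contradiction (λ ()) h
        decided true false h = contradiction (λ ()) h
      in-U : ∀ l → I l ≡ true → U l ≡ true
      in-U l Il with bool-case (U l)
      ... | inj₁ Ul = Ul
      ... | inj₂ ¬Ul = ⊥-elim (lively U U-Sep i (intro i Ii λ _ → refl) (λ _ → ∧-left) λ a Ua x →
          Bool.¬-not λ aa →
          lively U′ U′-Sep l (∧-intro Il (not-false ¬Ul)) (λ _ → ∧-left)
            λ b U′b y → Bool.¬-not λ ab → one-sided U exclusive Ua (not-true⁻¹ (∧-right {I b} U′b)) aa ab)
    -- An update in direction `j` cannot change `ν j k`, and `uniform` passes this on to the other
    -- directions of `I`.
    constant-twist : ∀ {i k x} → I i ≡ true → I k ≡ false → ∀ l y → I l ≡ true → Agree I x y →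
        ν l k y ≡ N i k x ⊛ κ
    constant-twist {i} {k} {x} Ii Ik l y Il x~y = trans (ν-N (#k Il) y) (cong (_⊛ κ)
      (trans (uniform Il Ii Ik y) (walk I (λ y → N i k y ≡ N i k x) step x y x~y refl)))
      where
      #k : ∀ {l} → I l ≡ true → l # k
      #k Il = Sep-#′ I-Sep Il Ik
      step : ∀ y j v → I j ≡ true → N i k y ≡ N i k x → N i k (y [ j ]≔ v) ≡ N i k x
      step y j v Ij h = trans (uniform Ii Ij Ik _) (trans (cong (_== κ) (ν-updateˡ j k y v))
          (trans (uniform Ij Ii Ik y) h))

-- Exchanging `f` and `g`

module Swap {m : ℕ} (f : Pt m → V) (f-inj : Injective f) (g : Pt m → V) (g-inj : Injective g)
            (f≢g : ∀ x → f x ≢ g x) where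

  private
    module F = Quasi f f-inj
    module G = Quasi g g-inj
    module FG = Pair f f-inj g g-inj f≢g
    module GF = Pair g g-inj f f-inj (λ x → f≢g x ∘ sym)

  -- Along a line the increments of `f` and `g` differ by a multiple of the colour `p`, to which
  -- `p · _` is blind.
  col-swap : ∀ i x → GF.col i x ≡ FG.col i x
  col-swap i x = GF.col-unique i x p λ d →
    let v = G.pos i d x
        e = F.diff i v x
        y = x [ i ]≔ v
        y-f : y ≡ F.mv i e x
        y-f = F.update-mv i v x
    in trans (cong GF.u (G.mv-def i d x))
        (prove (all λ a → all λ b → all λ p → all λ a′ → all λ b′ → all λ d → b′ ≐ b ⊕ d ⇒
         a′ ⊕ b′ ≐ a ⊕ b ⊕ shear p (a ⊕ a′) ⇒ b′ ⊕ a′ ≐ b ⊕ a ⊕ shear p d)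
         (f x) (g x) p (f y) (g y) d (trans (cong g (sym (G.mv-def i d x))) (G.f-mv i d x))
             (trans (cong FG.u y-f) (FG.u-mv i e x)))
    where
    p = FG.col i x

·-⊕₄ : ∀ κ a b c d → κ · (a ⊕ b ⊕ c ⊕ d) ≡ ((κ · a xor κ · b) xor κ · c) xor κ · d
·-⊕₄ κ a b c d = trans (·-⊕ κ (a ⊕ b ⊕ c) d)
    (cong (_xor κ · d) (trans (·-⊕ κ (a ⊕ b) c) (cong (_xor κ · c) (·-⊕ κ a b))))

-- Being fixed along `D`, the bit `κ · (f ⊕ g)` drops out of every second difference with a
-- direction in `D`, so those of `κ · f` and `κ · g` coincide.
Sep-transfer : ∀ {m} (f : Pt m → V) (f-inj : Injective f) (g : Pt m → V) (g-inj : Injective g) κ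
    (κ≢0 : κ ≢ 0F) {D} →
  (∀ i x v → D i ≡ true → κ · (f (x [ i ]≔ v) ⊕ g (x [ i ]≔ v)) ≡ κ · (f x ⊕ g x)) →
  Functional.Sep f f-inj κ κ≢0 D → Functional.Sep g g-inj κ κ≢0 D
Sep-transfer f f-inj g g-inj κ κ≢0 {D} same-θ sep = G.separated λ i j x Di Dj → let i≢j = F.sep-≢ {D} Di Dj in
  G.cross⇒additive i≢j x λ v w → let a = (x [ i ]≔ v) [ j ]≔ w ; b = x [ i ]≔ v ; c = x [ j ]≔ w in
  trans (·-⊕₄ κ (g a) (g b) (g c) (g x)) (prove
    (allᵇ λ a → allᵇ λ b → allᵇ λ c → allᵇ λ d → ((a xor b) xor c) xor d ≐ᵇ false ⇒
     allᵇ λ a′ → allᵇ λ c′ → a xor a′ ≐ᵇ c xor c′ ⇒ allᵇ λ b′ → allᵇ λ d′ → b xor b′ ≐ᵇ d xor d′ ⇒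
     ((a′ xor b′) xor c′) xor d′ ≐ᵇ false)
    (κ · f a) (κ · f b) (κ · f c) (κ · f x) (trans (sym (·-⊕₄ κ (f a) (f b) (f c) (f x)))
        (F.cross-add i≢j v w x (F.additive sep i j x Di Dj)))
    (κ · g a) (κ · g c) (trans (sym (·-⊕ κ (f a) (g a)))
        (trans (subst (λ a → κ · (f a ⊕ g a) ≡ κ · (f c ⊕ g c)) ([]≔-commutes x j i (i≢j ∘ sym))
        (same-θ i c v Di)) (·-⊕ κ (f c) (g c))))
    (κ · g b) (κ · g x) (trans (sym (·-⊕ κ (f b) (g b))) (trans (same-θ i x v Di) (·-⊕ κ (f x) (g x)))))
  where
  module F = Functional f f-inj κ κ≢0
  module G = Functional g g-inj κ κ≢0

-- When the twist is `0F` or `κ`, the displacement of `z` under a shift depends only on the bit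
-- `κ · z`. So it is enough to compare displacements once on each level, and adding `κ` does not
-- leave the level.
shift-determined : ∀ κ → κ ≢ 0F → ∀ b b′ d d′ c c′ z₁ z₂ → κ · (z₁ ⊕ z₂) ≡ true →
  (∀ {z} → z ≡ z₁ ⊎ z ≡ z₂ → shift (b′ ⊛ κ) d′ c′ (z ⊕ κ) ≡ shift (b ⊛ κ) d c z ⊕ κ) →
  ∀ z → shift (b′ ⊛ κ) d′ c′ z ≡ shift (b ⊛ κ) d c z
shift-determined κ κ≢0 b b′ d d′ c c′ z₁ z₂ levels h z = at (level κ z₁ z₂ levels z)
  where
  level : ∀ κ z₁ z₂ → κ · (z₁ ⊕ z₂) ≡ true → ∀ z → κ · z ≡ κ · z₁ ⊎ κ · z ≡ κ · z₂
  level = prove (all λ κ → all λ z₁ → all λ z₂ → κ · (z₁ ⊕ z₂) ≐ᵇ true ⇒ all λ z →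
      κ · z ≐ᵇ κ · z₁ ∨ᶜ κ · z ≐ᵇ κ · z₂)
  shift-jump : ∀ n d c z → shift n d c z ≡ z ⊕ (d ⊕ twist n d (z ⊕ c))
  shift-jump n d c z = ⊕-assoc z d _
  same-level : ∀ κ z z′ → κ · z ≡ κ · z′ → ∀ b d c → d ⊕ twist (b ⊛ κ) d (z ⊕ c) ≡ d ⊕ twist (b ⊛ κ) d
      (z′ ⊕ c)
  same-level = prove (all λ κ → all λ z → all λ z′ → κ · z ≐ᵇ κ · z′ ⇒ allᵇ λ b → all λ d → all λ c →
    d ⊕ twist (b ⊛ κ) d (z ⊕ c) ≐ d ⊕ twist (b ⊛ κ) d (z′ ⊕ c))
  conclude : ∀ z₀ → z₀ ≡ z₁ ⊎ z₀ ≡ z₂ → κ · z ≡ κ · z₀ → shift (b′ ⊛ κ) d′ c′ z ≡ shift (b ⊛ κ) d c z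
  conclude z₀ z₀∈ lev = trans (shift-jump (b′ ⊛ κ) d′ c′ z) (trans (cong (z ⊕_) (trans
      (same-level κ z (z₀ ⊕ κ) (trans lev (·-κ κ z₀)) b′ d′ c′)
      (trans (⊕-cancelˡ (z₀ ⊕ κ) _ _ (trans (sym (shift-jump (b′ ⊛ κ) d′ c′ (z₀ ⊕ κ))) (trans (h z₀∈)
        (trans (cong (_⊕ κ) (shift-jump (b ⊛ κ) d c z₀)) (swap z₀ (d ⊕ twist (b ⊛ κ) d (z₀ ⊕ c)) κ)))))
      (same-level κ z₀ z (sym lev) b d c)))) (sym (shift-jump (b ⊛ κ) d c z)))
    where
    ·-κ : ∀ κ z → κ · z ≡ κ · (z ⊕ κ)
    ·-κ = prove (all λ κ → all λ z → κ · z ≐ᵇ κ · (z ⊕ κ))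
    swap : ∀ z e κ → z ⊕ e ⊕ κ ≡ z ⊕ κ ⊕ e
    swap = prove (all λ z → all λ e → all λ κ → z ⊕ e ⊕ κ ≐ z ⊕ κ ⊕ e)
  at : κ · z ≡ κ · z₁ ⊎ κ · z ≡ κ · z₂ → _
  at (inj₁ e) = conclude z₁ (inj₁ refl) e
  at (inj₂ e) = conclude z₂ (inj₂ refl) e

module Contraction {m : ℕ} (f : Pt m → V) (f-inj : Injective f) (g : Pt m → V) (g-inj : Injective g)
                   (f≢g : ∀ x → f x ≢ g x) (κ : V) (κ≢0 : κ ≢ 0F) where

  private
    g≢f : ∀ x → g x ≢ f x
    g≢f x = f≢g x ∘ sym
    module QF = Quasi f f-inj
    module QG = Quasi g g-inj
    module CF = Classes f f-inj κ κ≢0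
    module CG = Classes g g-inj κ κ≢0
    module FG = Touching f f-inj g g-inj f≢g κ κ≢0
    module GF = Touching g g-inj f f-inj g≢f κ κ≢0
    open Swap f f-inj g g-inj f≢g

    untouched-swap : ∀ {D} → FG.Untouched D → GF.Untouched D
    untouched-swap h l Dl x = trans (cong (κ ·_) (col-swap l x)) (h l Dl x)

    untouched-swap⁻¹ : ∀ {D} → GF.Untouched D → FG.Untouched D
    untouched-swap⁻¹ h l Dl x = trans (cong (κ ·_) (sym (col-swap l x))) (h l Dl x)

  module _ (I : Mask m) (I-Sep : CF.Sep I) (quiet : FG.Untouched (∁ I))
           (lively : ∀ D → CF.Sep D → ∀ i → D i ≡ true → (∀ l → D l ≡ true → I l ≡ true) → ¬ FG.Untouched D)
           {i₀ : Fin m} (Ii₀ : I i₀ ≡ true) where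

    private
      I-Sep′ : CG.Sep I
      I-Sep′ = Sep-transfer-∁ (Sep-transfer f f-inj g g-inj κ κ≢0
          (λ i x v Di → FG.θ-inactive (quiet i Di x) v) (CF.Sep-∁ I-Sep))
        where
        Sep-transfer-∁ : CG.Sep (∁ I) → CG.Sep I
        Sep-transfer-∁ s = CG.Sep-cong (λ l → Bool.not-involutive (I l)) (CG.Sep-∁ s)

      lively′ : ∀ D → CG.Sep D → ∀ i → D i ≡ true → (∀ l → D l ≡ true → I l ≡ true) → ¬ GF.Untouched D
      lively′ D sep i Di D⊂I un = lively D
        (Sep-transfer g g-inj f f-inj κ κ≢0 (λ i x v Di → GF.θ-inactive (un i Di x) v) sep) i Di D⊂I
            (untouched-swap⁻¹ un)

      -- Test points for `shift-determined`. They come from an active line in a direction of `I`,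
      -- carried into the slice through coordinates outside `I`, which are never active.
      zeros : ∀ x → ∃ λ y₁ → ∃ λ y₂ → Agree I x y₁ × Agree I x y₂ × FG.u y₁ ≡ κ × FG.u y₂ ≡ κ × κ ·
          (f y₁ ⊕ f y₂) ≡ true
      zeros x with any? (λ l → search-Pt λ z → (I l ∧ FG.act l z) Bool.≟ true)
      ... | no none = contradiction (λ l Il z → Bool.¬-not λ a → none (l , z , ∧-intro Il a))
          (lively I I-Sep i₀ Ii₀ λ _ → id)
      ... | yes (l , z , h) = y₁ , y₂ , x~y₁ , CF.agree-mv l p Il x~y₁ , κ-valued y₁ θ₁ , κ-valued y₂ θ₂ ,
          trans (cong (λ b → κ · (f y₁ ⊕ b)) (QF.f-mv l p y₁))
              (trans (cong (κ ·_) (⊕-involutiveˡ (f y₁) p)) a₁)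
        where
        Il : I l ≡ true
        Il = ∧-left h
        a : FG.act l z ≡ true
        a = ∧-right {I l} h
        z′ = merge I z x
        a′ : FG.act l z′ ≡ true
        a′ = walk (∁ I) (λ y → FG.act l y ≡ true)
          (λ y j v Ij → FG.act-persist (λ { refl → bool-clash Il (not-true⁻¹ Ij) }) (λ y _ → quiet j Ij y) y
              v)
          z z′ (merge-agree I z x) a
        -- A step by `unit` of the colour flips `θ`, so `d` makes it false. A further step by the
        -- colour itself keeps `θ` and changes the level of `κ · f`. A nonzero `u` with `θ` false is
        -- `κ`.
        d : V
        d = FG.θ z′ ⊛ unit (FG.col l z′)
        y₁ = QF.mv l d z′
        p = FG.col l y₁
        y₂ = QF.mv l p y₁
        x~y₁ : Agree I x y₁
        x~y₁ = CF.agree-mv l d Il (agree-merge I z x)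
        a₁ : FG.act l y₁ ≡ true
        a₁ = trans (FG.act-mv l d z′) a′
        θ₁ : FG.θ y₁ ≡ false
        θ₁ = trans (FG.θ-mv l d z′) (prove (all λ p → neg (p ≐ 0F) ⇒ allᵇ λ t → allᵇ λ a → a ≐ᵇ true ⇒
            t xor ((p · t ⊛ unit p) ∧ a) ≐ᵇ false)
          (FG.col l z′) (FG.act⇒≢0 a′) (FG.θ z′) _ a′)
        θ₂ : FG.θ y₂ ≡ false
        θ₂ = trans (FG.θ-mv l p y₁) (trans (cong (λ b → FG.θ y₁ xor (b ∧ FG.act l y₁)) (·-self p))
          (trans (prove (allᵇ λ t → t xor false ≐ᵇ t) (FG.θ y₁)) θ₁))
        κ-valued : ∀ y → FG.θ y ≡ false → FG.u y ≡ κ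
        κ-valued y h = prove (all λ κ → neg (κ ≐ 0F) ⇒ all λ c → neg (c ≐ 0F) ⇒ κ · c ≐ᵇ false ⇒ c ≐ κ) κ κ≢0
            (FG.u y) (FG.u≢0 y) h

      -- Both `f` and `g` undergo shifts. A change of `k` fixes `θ`, so `u` remains `κ` at the
      -- points of `zeros`, and this relates the two shifts there.
      one : ∀ k w x → I k ≡ false → Σ (V → V) λ A → ∀ y → Agree I x y → f (y [ k ]≔ w) ≡ A (f y) × g
          (y [ k ]≔ w) ≡ A (g y)
      one k w x Ik = A , λ y x~y → slide-f y x~y , trans (slide-g y x~y)
          (shift-determined κ κ≢0 b b′ (QF.diff k w x) (QG.diff k w x) (f x) (g x) (f y₁) (f y₂) levels
              (λ { (inj₁ refl) → match y₁ x~y₁ u₁ ; (inj₂ refl) → match y₂ x~y₂ u₂ }) (g y))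
        where
        b = CF.N i₀ k x
        b′ = CG.N i₀ k x
        A = shift (b ⊛ κ) (QF.diff k w x) (f x)
        A′ = shift (b′ ⊛ κ) (QG.diff k w x) (g x)
        slide-f : ∀ y → Agree I x y → f (y [ k ]≔ w) ≡ A (f y)
        slide-f = Sliding.slide f f-inj I Ik (Uniform.constant-twist f f-inj g g-inj f≢g κ κ≢0 I I-Sep quiet
            lively Ii₀ Ik) w
        slide-g : ∀ y → Agree I x y → g (y [ k ]≔ w) ≡ A′ (g y)
        slide-g = Sliding.slide g g-inj I Ik (Uniform.constant-twist g g-inj f f-inj g≢f κ κ≢0 I I-Sep′
            (untouched-swap quiet) lively′ Ii₀ Ik) w
        pts = zeros x
        y₁ = proj₁ pts
        y₂ = proj₁ (proj₂ pts)
        x~y₁ = proj₁ (proj₂ (proj₂ pts))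
        x~y₂ = proj₁ (proj₂ (proj₂ (proj₂ pts)))
        u₁ = proj₁ (proj₂ (proj₂ (proj₂ (proj₂ pts))))
        u₂ = proj₁ (proj₂ (proj₂ (proj₂ (proj₂ (proj₂ pts)))))
        levels = proj₂ (proj₂ (proj₂ (proj₂ (proj₂ (proj₂ pts)))))
        match : ∀ y → Agree I x y → FG.u y ≡ κ → A′ (f y ⊕ κ) ≡ A (f y) ⊕ κ
        match y x~y uy = trans (cong A′ (sym (from-u y uy)))
            (trans (sym (slide-g y x~y)) (trans (from-u (y [ k ]≔ w) u′) (cong (_⊕ κ) (slide-f y x~y))))
          where
          from-u : ∀ y → FG.u y ≡ κ → g y ≡ f y ⊕ κ
          from-u y h = trans (sym (⊕-involutiveˡ (f y) (g y))) (cong (f y ⊕_) h)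
          u′ : FG.u (y [ k ]≔ w) ≡ κ
          u′ = prove (all λ κ → neg (κ ≐ 0F) ⇒ all λ c → neg (c ≐ 0F) ⇒ κ · c ≐ᵇ κ · κ ⇒ c ≐ κ) κ κ≢0
              (FG.u (y [ k ]≔ w)) (FG.u≢0 _)
            (trans (FG.θ-inactive (quiet k (not-false Ik) y) w) (cong (κ ·_) uy))

    contractible : Contractible I f g
    contractible = contract I f g one

-- Across an additive cut a change of `k` translates the values of `f`. The zero colours fix `u`, so
-- `g` is translated by the same vector.
additive-contractible : ∀ {m} (f : Pt m → V) (f-inj : Injective f) (g : Pt m → V) (g-inj : Injective g)
    (f≢g : ∀ x → f x ≢ g x) →
  ∀ (I : Mask m) → (∀ i j x → I i ≡ true → I j ≡ false → Quasi.ν f f-inj i j x ≡ 0F) →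
  (∀ k x → I k ≡ false → Pair.col f f-inj g g-inj f≢g k x ≡ 0F) → Contractible I f g
additive-contractible f f-inj g g-inj f≢g I flat still = contract I f g λ k w x Ik →
  let A = shift 0F (diff k w x) (f x)
      slide-f : ∀ y → Agree I x y → f (y [ k ]≔ w) ≡ A (f y)
      slide-f = Sliding.slide f f-inj I Ik (λ l y Il _ → flat l k y Il Ik) w
      u-k : ∀ y → u (y [ k ]≔ w) ≡ u y
      u-k y = trans (cong u (update-mv k w y))
          (trans (u-mv k (diff k w y) y) (trans (cong (λ p → u y ⊕ shear p (diff k w y)) (still k y Ik))
          (⊕-identityʳ (u y))))
  in A , λ y x~y → slide-f y x~y , prove (all λ d → all λ a → all λ b → all λ a′ → a′ ≐ a ⊕ d ⊕ 0F ⇒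
      all λ b′ →
       a′ ⊕ b′ ≐ a ⊕ b ⇒ b′ ≐ b ⊕ d ⊕ 0F) (diff k w x) (f y) (g y) (f (y [ k ]≔ w)) (slide-f y x~y)
           (g (y [ k ]≔ w)) (u-k y)
  where
  open Quasi f f-inj
  open Pair f f-inj g g-inj f≢g

-- Existence of a separated set

record Cut {m : ℕ} (f : Pt m → V) (f-inj : Injective f) : Set where
  constructor cutting
  field
    κ    : V
    κ≢0  : κ ≢ 0F
    part : Mask m
    part-Sep : Functional.Sep f f-inj κ κ≢0 part
    {inner outer} : Fin m
    inner∈ : part inner ≡ true
    outer∉ : part outer ≡ false

AdditiveSplit : ∀ {m} (f : Pt m → V) → Injective f → Set
AdditiveSplit f f-inj = ∃ λ W → AdditiveCut.Additive f f-inj (lookup W) × ∃ λ i → ∃ λ j →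
    lookup W i ≡ true × lookup W j ≡ false

additiveSplit? : ∀ {m} (f : Pt m → V) (f-inj : Injective f) → Dec (AdditiveSplit f f-inj)
additiveSplit? f f-inj = search-Vec search-Bool λ W →
  additive? (lookup W) ×-dec any? λ i → any? λ j → (lookup W i Bool.≟ true) ×-dec (lookup W j Bool.≟ false)
  where
  additive? : ∀ W → Dec (AdditiveCut.Additive f f-inj W)
  additive? W = forall? any? λ i → forall? any? λ j → forall? search-Pt λ x →
    (W i Bool.≟ true) →-dec ((W j Bool.≟ false) →-dec (Quasi.ν f f-inj i j x ≟ 0F))

module _ {m : ℕ} (f : Pt m → V) (f-inj : Injective f) (κ : V) (κ≢0 : κ ≢ 0F) where

  open Quasi f f-inj
  open Classes f f-inj κ κ≢0

  -- Across a separated set a twist is `0F` or `κ`. If `κ` never occurred, the set would be an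
  -- additive split.
  crossing : ¬ AdditiveSplit f f-inj → ∀ W → Sep W → ∀ a b → W a ≡ true → W b ≡ false →
    ∃ λ i → ∃ λ j → W i ≡ true × W j ≡ false × ∃ λ x → N i j x ≡ true
  crossing none W sep a b Wa Wb with any? (λ i → any? λ j →
    (W i Bool.≟ true) ×-dec ((W j Bool.≟ false) ×-dec (search-Pt λ x → N i j x Bool.≟ true)))
  ... | yes c = c
  ... | no ¬c = contradiction (tabulate W , additive′ , a , b , trans (lookup∘tabulate W a) Wa ,
      trans (lookup∘tabulate W b) Wb) none
    where
    additive′ : AdditiveCut.Additive f f-inj (lookup (tabulate W))
    additive′ i j x Wi Wj = trans (ν-N (Sep-#′ sep Wi′ Wj′) x)
        (cong (_⊛ κ) (Bool.¬-not λ n → ¬c (i , j , Wi′ , Wj′ , x , n)))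
      where
      Wi′ = trans (sym (lookup∘tabulate W i)) Wi
      Wj′ = trans (sym (lookup∘tabulate W j)) Wj

-- Layers of a quasigroup along its first coordinate

module Layers {m : ℕ} (f : Pt (suc m) → V) (f-inj : Injective f) where

  layer : V → Pt m → V
  layer b x = f (b ∷ x)

  layer-inj : ∀ b → Injective (layer b)
  layer-inj b i x = f-inj (suc i) (b ∷ x)

  layer-≢ : ∀ {b} → b ≢ 0F → ∀ x → layer 0F x ≢ layer b x
  layer-≢ {b} b≢0 x eq = b≢0 (sym (f-inj zero (0F ∷ x) 0F b eq))

  f₀ = layer 0F
  f₀-inj = layer-inj 0F

  module D (b : V) (b≢0 : b ≢ 0F) = Pair f₀ f₀-inj (layer b) (layer-inj b) (layer-≢ b≢0)

  open Quasi f₀ f₀-inj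

  col : ∀ b → b ≢ 0F → Fin m → Pt m → V
  col b b≢0 = D.col b b≢0

  u : V → Pt m → V
  u b x = f₀ x ⊕ layer b x

  -- The values of the four layers at a point are distinct, hence sum to zero.
  u-sum : ∀ {b b′} → b ≢ 0F → b′ ≢ 0F → b ≢ b′ → ∀ x → u b x ⊕ u b′ x ≡ u (b ⊕ b′) x
  u-sum {b} {b′} b≢0 b′≢0 b≢b′ x = trans (cong₂ (λ p q → h 0F ⊕ p ⊕ (h 0F ⊕ q)) (tab-correct h b)
      (tab-correct h b′))
    (trans (prove (all λ h₀ → all λ h₁ → all λ h₂ → all λ h₃ → distinct h₀ h₁ h₂ h₃ ⇒ let h = tab h₀ h₁ h₂ h₃ in
      all λ b → neg (b ≐ 0F) ⇒ all λ b′ → neg (b′ ≐ 0F) ⇒ neg (b ≐ b′) ⇒ h₀ ⊕ h b ⊕ (h₀ ⊕ h b′) ≐ h₀ ⊕ h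
          (b ⊕ b′))
      (h 0F) (h 1F) (h 2F) (h 3F) (inj⇒distinct h (f-inj zero (0F ∷ x))) b b≢0 b′ b′≢0 b≢b′)
      (cong (h 0F ⊕_) (sym (tab-correct h (b ⊕ b′)))))
    where
    h : V → V
    h b = layer b x

  ⊕-≢0 : ∀ {b b′ : V} → b ≢ b′ → b ⊕ b′ ≢ 0F
  ⊕-≢0 b≢b′ = b≢b′ ∘ ⊕≡0⇒≡ _ _

  module _ {b b′ : V} (b≢0 : b ≢ 0F) (b′≢0 : b′ ≢ 0F) (b≢b′ : b ≢ b′) (i : Fin m) (x : Pt m) where

    private
      sums : ∀ d → shear (col b b≢0 i x) d ⊕ shear (col b′ b′≢0 i x) d ≡ shear (col (b ⊕ b′) (⊕-≢0 b≢b′) i x)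
          d
      sums d = prove (all λ c → all λ c′ → all λ s → all λ s′ → all λ s″ →
          (c ⊕ s) ⊕ (c′ ⊕ s′) ≐ (c ⊕ c′) ⊕ s″ ⇒ s ⊕ s′ ≐ s″) (u b x) (u b′ x) (shear (col b b≢0 i x) d)
              (shear (col b′ b′≢0 i x) d) (shear (col (b ⊕ b′) (⊕-≢0 b≢b′) i x) d)
        (trans (sym (cong₂ _⊕_ (D.u-mv b b≢0 i d x) (D.u-mv b′ b′≢0 i d x)))
            (trans (u-sum b≢0 b′≢0 b≢b′ (mv i d x))
          (trans (D.u-mv (b ⊕ b′) (⊕-≢0 b≢b′) i d x) (cong (_⊕ shear (col (b ⊕ b′) (⊕-≢0 b≢b′) i x) d)
              (sym (u-sum b≢0 b′≢0 b≢b′ x))))))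

      -- The shears by two distinct nonzero vectors sum to an invertible linear map, which is not a
      -- shear.
      rule : ∀ p q s → (∀ d → shear p d ⊕ shear q d ≡ shear s d) →
          (p ≢ 0F → q ≢ 0F → p ≡ q) × (p ≢ 0F → q ≢ 0F ⊎ s ≢ 0F)
      rule p q s h = prove (all λ p → all λ q → all λ s → let at = λ d → shear p d ⊕ shear q d ≐ shear s d in
        at 1F ∧ᶜ at 2F ∧ᶜ at 3F ⇒ (neg (p ≐ 0F) ⇒ neg (q ≐ 0F) ⇒ p ≐ q) ∧ᶜ
            (neg (p ≐ 0F) ⇒ neg (q ≐ 0F) ∨ᶜ neg (s ≐ 0F))) p q s (h 1F , h 2F , h 3F)

    line-equal′ : col b b≢0 i x ≢ 0F → col b′ b′≢0 i x ≢ 0F → col b b≢0 i x ≡ col b′ b′≢0 i x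
    line-equal′ = proj₁ (rule (col b b≢0 i x) (col b′ b′≢0 i x) (col (b ⊕ b′) (⊕-≢0 b≢b′) i x) sums)

    line-other : col b b≢0 i x ≢ 0F → col b′ b′≢0 i x ≢ 0F ⊎ col (b ⊕ b′) (⊕-≢0 b≢b′) i x ≢ 0F
    line-other = proj₂ (rule (col b b≢0 i x) (col b′ b′≢0 i x) (col (b ⊕ b′) (⊕-≢0 b≢b′) i x) sums)

  line-equal : ∀ {b b′} (b≢0 : b ≢ 0F) (b′≢0 : b′ ≢ 0F) i x → col b b≢0 i x ≢ 0F → col b′ b′≢0 i x ≢ 0F →
    col b b≢0 i x ≡ col b′ b′≢0 i x
  line-equal {b} {b′} b≢0 b′≢0 i x with same b b′
  ... | inj₁ refl = λ _ _ → D.col-unique b b≢0 i x _ (λ d → D.u-mv b b′≢0 i d x)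
  ... | inj₂ b≢b′ = line-equal′ b≢0 b′≢0 b≢b′ i x

  module _ {W : Mask m} (flat : AdditiveCut.Additive f₀ f₀-inj W) where

    -- On a line, none or two of the three layer differences are nonconstant; hence two lines with
    -- nonconstant differences share one.
    all-cut-colours : ∀ {b b′} (b≢0 : b ≢ 0F) (b′≢0 : b′ ≢ 0F) {i k x z} → W i ≡ true → W k ≡ false →
      col b b≢0 i x ≢ 0F → col b′ b′≢0 k z ≢ 0F → col b b≢0 i x ≡ col b′ b′≢0 k z
    all-cut-colours {b} {b′} b≢0 b′≢0 {i} {k} {x} {z} Wi Wk ci ck = cases (same b b′)
      where
      cut : ∀ {b} (b≢0 : b ≢ 0F) → col b b≢0 i x ≢ 0F → col b b≢0 k z ≢ 0F → col b b≢0 i x ≡ col b b≢0 k z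
      cut {b} b≢0 = CutColours.cut-colours f₀ f₀-inj (layer b) (layer-inj b) (layer-≢ b≢0) W flat Wi Wk
      via : ∀ {b″} (b″≢0 : b″ ≢ 0F) → col b″ b″≢0 i x ≢ 0F → col b″ b″≢0 k z ≢ 0F →
          col b b≢0 i x ≡ col b′ b′≢0 k z
      via b″≢0 hi hk = trans (line-equal b≢0 b″≢0 i x ci hi)
          (trans (cut b″≢0 hi hk) (line-equal b″≢0 b′≢0 k z hk ck))
      cases : b ≡ b′ ⊎ b ≢ b′ → col b b≢0 i x ≡ col b′ b′≢0 k z
      cases (inj₁ refl) = via b≢0 ci
          (λ e → ck (trans (D.col-unique b b′≢0 k z _ (λ d → D.u-mv b b≢0 k d z)) e))
      cases (inj₂ b≢b′) with line-other b≢0 b′≢0 b≢b′ i x ci | line-other b′≢0 b≢0 (b≢b′ ∘ sym) k z ck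
      ... | inj₁ hi | _ = via b′≢0 hi ck
      ... | inj₂ _ | inj₁ hk = via b≢0 ci hk
      ... | inj₂ hi | inj₂ hk = via (⊕-≢0 b≢b′) hi (hk ∘ trans (third b b′ (⊕-≢0 (b≢b′ ∘ sym)) (⊕-≢0 b≢b′)))
        where
        third : ∀ b b′ (p : b′ ⊕ b ≢ 0F) (q : b ⊕ b′ ≢ 0F) → col (b′ ⊕ b) p k z ≡ col (b ⊕ b′) q k z
        third b b′ p q with b′ ⊕ b | ⊕-comm b′ b
        ... | _ | refl = D.col-unique _ p k z _ (λ d → D.u-mv _ q k d z)

  headMask : Mask (suc m)
  headMask zero    = true
  headMask (suc _) = false

  tailMask : Mask m → Mask (suc m)
  tailMask Z zero    = false
  tailMask Z (suc i) = Z i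

  module _ (κ : V) (κ≢0 : κ ≢ 0F) where

    private
      module S = Functional f f-inj κ κ≢0
      module S₀ = Functional f₀ f₀-inj κ κ≢0

    Silent : Fin m → Set
    Silent i = ∀ b x v → κ · u b (x [ i ]≔ v) ≡ κ · u b x

    silent : ∀ i → (∀ b (b≢0 : b ≢ 0F) x → κ · col b b≢0 i x ≡ false) → Silent i
    silent i h b x v with same b 0F
    ... | inj₁ refl = cong (κ ·_) (trans (⊕-self (f₀ (x [ i ]≔ v))) (sym (⊕-self (f₀ x))))
    ... | inj₂ b≢0 = Touching.θ-inactive f₀ f₀-inj (layer b) (layer-inj b) (layer-≢ b≢0) κ κ≢0 (h b b≢0 x) v

    private
      -- A second difference in these directions is the sum of the changes of `κ · u b` and
      -- `κ · u c` along `i`, and both vanish.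
      head-tail : ∀ i → Silent i → ∀ x → κ · Quasi.ν f f-inj zero (suc i) x ≡ false
      head-tail i h (b ∷ x) = S.cross⇒additive (λ ()) (b ∷ x) λ c w → trans
        (·-⊕₄ κ (layer c (x [ i ]≔ w)) (layer c x) (layer b (x [ i ]≔ w)) (layer b x))
        (prove (allᵇ λ z → allᵇ λ z′ → allᵇ λ c → allᵇ λ c′ → z xor c ≐ᵇ z′ xor c′ ⇒ allᵇ λ b → allᵇ λ b′ →
            z xor b ≐ᵇ z′ xor b′ ⇒
          ((c xor c′) xor b) xor b′ ≐ᵇ false)
          (κ · f₀ (x [ i ]≔ w)) (κ · f₀ x) (κ · layer c (x [ i ]≔ w)) (κ · layer c x) (split c w)
          (κ · layer b (x [ i ]≔ w)) (κ · layer b x) (split b w))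
        where
        split : ∀ c w → κ · f₀ (x [ i ]≔ w) xor κ · layer c (x [ i ]≔ w) ≡ κ · f₀ x xor κ · layer c x
        split c w = trans (sym (·-⊕ κ (f₀ (x [ i ]≔ w)) (layer c (x [ i ]≔ w))))
            (trans (h c x w) (·-⊕ κ (f₀ x) (layer c x)))

    head-cut : (∀ i → Silent i) → Fin m → Cut f f-inj
    head-cut h i = cutting κ κ≢0 headMask (S.separated λ
      { zero (suc j) x _ _ → head-tail j (h j) x ; zero zero x _ () ; (suc _) _ x () }) {zero} {suc i} refl
          refl

    -- Silence is the hypothesis of `Sep-transfer`, which carries the separation from `f₀` to every
    -- layer; `head-tail` deals with the first coordinate.
    tail-cut : ∀ Z → S₀.Sep Z → ∀ i → Z i ≡ true → (∀ j → Z j ≡ true → Silent j) → Cut f f-inj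
    tail-cut Z sep i Zi h = cutting κ κ≢0 (tailMask Z) (S.separated λ
      { (suc j) zero x Zj _ → trans (cong (κ ·_) (Quasi.ν-sym f f-inj (suc j) zero x))
          (head-tail j (h j Zj) x)
      ; (suc j) (suc k) (b ∷ x) Zj Zk → let module Sb = Functional (layer b) (layer-inj b) κ κ≢0
                                            sep-b = Sep-transfer f₀ f₀-inj (layer b) (layer-inj b) κ κ≢0
                                                (λ j x v Zj → h j Zj b x v) sep in
          S.cross⇒additive (λ { refl → bool-clash Zj Zk }) (b ∷ x) λ v w →
            Sb.cross-add (λ { refl → bool-clash Zj Zk }) v w x (Sb.additive sep-b j k x Zj Zk)
      ; zero _ x () }) {suc i} {zero} Zi refl

module LayerCut {m : ℕ} (f : Pt (suc m) → V) (f-inj : Injective f) where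

  open Layers f f-inj
  open Quasi f₀ f₀-inj

  nz : ∀ {c : Fin 3} → suc c ≢ 0F
  nz ()

  hue : Fin 3 → Fin m → Pt m → V
  hue c = col (suc c) nz

  col-hue : ∀ c (b≢0 : suc c ≢ 0F) i x → col (suc c) b≢0 i x ≡ hue c i x
  col-hue c b≢0 i x = D.col-unique (suc c) b≢0 i x _ (λ d → D.u-mv (suc c) nz i d x)

  hue-equal : ∀ c c′ i x → hue c i x ≢ 0F → hue c′ i x ≢ 0F → hue c i x ≡ hue c′ i x
  hue-equal c c′ = line-equal nz nz

  hue-other : ∀ i x → hue 2F i x ≢ 0F → hue 0F i x ≢ 0F ⊎ hue 1F i x ≢ 0F
  hue-other i x h = Sum.map id (λ k → k ∘ trans (col-hue 1F (⊕-≢0 3≢1) i x))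
      (line-other {3F} {1F} nz nz 3≢1 i x h)
    where
    3≢1 : 3F ≢ 1F
    3≢1 ()

  Silent-hue : ∀ κ (κ≢0 : κ ≢ 0F) i → (∀ c x → κ · hue c i x ≡ false) → Silent κ κ≢0 i
  Silent-hue κ κ≢0 i h = silent κ κ≢0 i λ { zero b≢0 x → contradiction refl b≢0
                                         ; (suc c) b≢0 x → trans (cong (κ ·_) (col-hue c b≢0 i x)) (h c x) }

  Noisy : Mask m → Set
  Noisy M = ∃ λ c → ∃ λ i → ∃ λ x → M i ≡ true × hue c i x ≢ 0F

  noisy? : ∀ M → Dec (Noisy M)
  noisy? M = any? λ c → any? λ i → search-Pt λ x → (M i Bool.≟ true) ×-dec ¬? (hue c i x ≟ 0F)

  quiet-hue : ∀ {M} → ¬ Noisy M → ∀ i → M i ≡ true → ∀ c x → hue c i x ≡ 0F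
  quiet-hue none i Mi c x with same (hue c i x) 0F
  ... | inj₁ eq = eq
  ... | inj₂ neq = contradiction (c , i , x , Mi , neq) none

  -- For the functional `p · _` no line is active, as `0F` and `p` are both orthogonal to `p`.
  one-colour : ∀ p → p ≢ 0F → (∀ c i x → hue c i x ≢ 0F → hue c i x ≡ p) → Fin m → Cut f f-inj
  one-colour p p≢0 h = head-cut p p≢0 λ i → Silent-hue p p≢0 i λ c x → at c i x (same (hue c i x) 0F)
    where
    at : ∀ c i x → hue c i x ≡ 0F ⊎ hue c i x ≢ 0F → p · hue c i x ≡ false
    at c i x (inj₁ eq) = trans (cong (p ·_) eq) (·-zeroʳ p)
    at c i x (inj₂ neq) = trans (cong (p ·_) (h c i x neq)) (·-self p)

  1≢0 : _≢_ {A = V} 1F 0F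
  1≢0 ()

  quiet-cut : ∀ {M} → AdditiveCut.Additive f₀ f₀-inj M → ¬ Noisy M → ∀ i → M i ≡ true → Cut f f-inj
  -- All twists and colours involved are `0F`, so any nonzero vector serves as `κ`.
  quiet-cut {M} flat none i Mi = tail-cut 1F 1≢0 M (Functional.separated λ i j x Mi Mj →
      trans (cong (1F ·_) (flat i j x Mi Mj)) (·-zeroʳ 1F)) i Mi
    λ j Mj → Silent-hue 1F 1≢0 j λ c x → trans (cong (1F ·_) (quiet-hue none j Mj c x)) (·-zeroʳ 1F)

  additive-layer : AdditiveSplit f₀ f₀-inj → Cut f f-inj
  additive-layer (Wv , flat , i , k , Wi , Wk) = cases (noisy? W) (noisy? (∁ W))
    where
    W = lookup Wv
    flat∁ : AdditiveCut.Additive f₀ f₀-inj (∁ W)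
    flat∁ i j x Wi Wj = trans (ν-sym i j x) (flat j i x (not-false⁻¹ Wj) (not-true⁻¹ Wi))
    cases : Dec (Noisy W) → Dec (Noisy (∁ W)) → Cut f f-inj
    cases (no none) _ = quiet-cut flat none i Wi
    cases _ (no none) = quiet-cut flat∁ none k (not-false Wk)
    cases (yes (c , i , x , Wi , hi)) (yes (c′ , k , z , Wk , hk)) = one-colour (hue c i x) hi
      (λ c″ j y hj → at c″ j y hj (bool-case (W j))) i
      where
      at : ∀ c″ j y → hue c″ j y ≢ 0F → W j ≡ true ⊎ W j ≡ false → hue c″ j y ≡ hue c i x
      at c″ j y hj (inj₁ Wj) = trans (all-cut-colours flat nz nz Wj (not-true⁻¹ Wk) hj hk)
          (sym (all-cut-colours flat nz nz Wi (not-true⁻¹ Wk) hi hk))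
      at c″ j y hj (inj₂ Wj) = sym (all-cut-colours flat nz nz Wi Wj hi hj)

  module Nonadditive (none : ¬ AdditiveSplit f₀ f₀-inj) (κ : V) (κ≢0 : κ ≢ 0F) where

    open Classes f₀ f₀-inj κ κ≢0
    module T (c : Fin 3) = Touching f₀ f₀-inj (layer (suc c)) (layer-inj (suc c)) (layer-≢ nz) κ κ≢0

    -- The two layer differences would have different colours on some line of the plane.
    exclusive : ∀ c c′ {i k w} → T.Split₁ c i k w → T.act c′ k w ≡ true → ⊥
    exclusive c c′ {i} {k} {w} (n , ai , ¬ak) ak′ = cases (bool-case (T.act c′ i w))
      where
      q = unit κ
      p = hue c i w
      p′ = hue c′ k w
      n′ : N k i w ≡ true
      n′ = trans (N-sym k i w) n
      κ≠ : ∀ p → p ≢ p ⊕ κ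
      κ≠ p eq = κ≢0 (prove (all λ p → all λ κ → p ≐ p ⊕ κ ⇒ κ ≐ 0F) p κ eq)
      cases : T.act c′ i w ≡ true ⊎ T.act c′ i w ≡ false → ⊥
      cases (inj₁ ai′) = κ≠ p (trans (trans (hue-equal c c′ i w (T.act⇒≢0 c ai) (T.act⇒≢0 c′ ai′)) (sym col′))
          (trans (hue-equal c′ c i x (T.act⇒≢0 c′ (T.twisted-act c′ n ai′ q))
              (T.act⇒≢0 c (T.twisted-act c n ai q)))
            (trans (proj₁ (T.twisted-one c n ai ¬ak q)) (cong (λ b → p ⊕ b ⊛ κ) (·-unit κ κ≢0)))))
        where
        x = mv k q w
        col′ : hue c′ i x ≡ hue c′ i w
        col′ = proj₁ (T.twisted-both c′ n ai′ ak′ q)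
      cases (inj₂ ¬ai′) = bool-clash (T.twisted-act c′ n′ ak′ ξ) (trans (cong (κ ·_) (trans
          (hue-equal c′ c k x (T.act⇒≢0 c′ (T.twisted-act c′ n′ ak′ ξ)) (λ e → κ≢0 (trans (sym col-κ) e)))
              col-κ)) (·-self κ))
        where
        -- `ξ` is chosen to make `θ` true at `x`; the rule for an inactive direction then gives the
        -- line of `k` the colour `κ`, which is orthogonal to `κ`.
        t = T.θ c w
        ξ = not t ⊛ unit p
        x = mv i ξ w
        lit : κ · (T.u c w ⊕ shear p ξ) ≡ true
        lit = prove (all λ κ → all λ p → κ · p ≐ᵇ true ⇒ all λ e → κ · (e ⊕ shear p (not (κ · e) ⊛ unit p)) ≐ᵇ
            true) κ p ai (T.u c w)
        col-κ : hue c k x ≡ κ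
        col-κ = trans (proj₂ (T.twisted-one c n ai ¬ak ξ)) (cong (_⊛ κ) lit)

    both-inactive : ∀ i x → T.act 0F i x ≡ false → T.act 1F i x ≡ false → T.act 2F i x ≡ false
    both-inactive i x h₀ h₁ = Bool.¬-not λ a → cases a (hue-other i x (T.act⇒≢0 2F a))
      where
      cases : T.act 2F i x ≡ true → hue 0F i x ≢ 0F ⊎ hue 1F i x ≢ 0F → ⊥
      cases a (inj₁ h) = bool-clash (trans (cong (κ ·_) (sym (hue-equal 2F 0F i x (T.act⇒≢0 2F a) h))) a) h₀
      cases a (inj₂ h) = bool-clash (trans (cong (κ ·_) (sym (hue-equal 2F 1F i x (T.act⇒≢0 2F a) h))) a) h₁

    cross-W = crossing f₀ f₀-inj κ κ≢0 none

    module _ (part : Mask m) (part-Sep : Sep part) {a₀ b₀ : Fin m} (a∈ : part a₀ ≡ true)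
        (b∉ : part b₀ ≡ false) where

      a#b : a₀ # b₀
      a#b = Sep-#′ part-Sep a∈ b∉

      mono-cut : ∀ c → (∃ λ p → κ · p ≡ true × (∀ i x → hue c i x ≡ p)) → Cut f f-inj
      mono-cut c (p , κp , mono) = one-colour p p≢0
          (λ c′ j y h → trans (hue-equal c′ c j y h (p≢0 ∘ trans (sym (mono j y)))) (mono j y)) a₀
        where
        p≢0 : p ≢ 0F
        p≢0 eq = bool-clash κp (trans (cong (κ ·_) eq) (·-zeroʳ κ))

      touched-cut : ∀ c → (∀ k → ¬ T.Untouched c (class k)) → T.Touched c (class a₀) → Cut f f-inj
      touched-cut c touched (i , x , _ , a) =
          mono-cut c (T.Monochrome.monochrome c cross-W a₀ b₀ a#b touched i x a)

      meeting-⊥ : ∀ {c l l′} → l # l′ → (∃ λ x → T.Split₁ 0F l l′ x) → (∃ λ z → T.act c l′ z ≡ true) → ⊥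
      meeting-⊥ {c} {l} {l′} l#l′ (x , s) (z , a) =
          finish (Meeting.meet f₀ f₀-inj κ κ≢0 (layer 1F) (layer-inj 1F) (layer-≢ nz)
          (layer (suc c)) (layer-inj (suc c)) (layer-≢ nz) l#l′ s a)
        where
        finish : (∃ λ w → T.Split₁ 0F l l′ w × T.act c l′ w ≡ true) → ⊥
        finish (w , sw , aw) = exclusive 0F c sw aw

      -- By `N-class` the link passes to directions `l` and `l′` of the two classes, active for the
      -- differences `0F` and `c`. A split point of the former then meets an active line of the
      -- latter, against `exclusive`.
      linked-⊥ : ∀ {i k} → i # k → (∃ λ x → N i k x ≡ true) → T.Untouched 0F (class k) →
        T.Touched 0F (class i) → (∃ λ c → T.Touched c (class k)) → ⊥
      linked-⊥ {i} {k} i#k (y , n) un-k (l , x , l∈ , al) (c , l′ , z , l′∈ , al′) =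
        meeting-⊥ {c} l#l′ (T.split-linked 0F l#l′ lnk (al , un-k l′ l′∈ x)) (z , al′)
        where
        l#k : l # k
        l#k = #-sym (class-# l∈ (#-sym i#k))
        l#l′ : l # l′
        l#l′ = class-# l′∈ l#k
        lnk : ∃ λ y → N l l′ y ≡ true
        lnk = y , trans (N-sym l l′ y) (trans (N-class l y (#-sym l#l′) (#-sym l#k) (class⇒¬# l′∈))
          (trans (N-sym k l y) (trans (N-class k y l#k i#k (class⇒¬# l∈)) n)))

      -- `U` collects the directions whose class the difference `0F` touches, and `k₀` is not among
      -- them. If `U` is nonempty, a link across it contradicts `linked-⊥`. If it is empty, the
      -- class of `k₁` is untouched by `0F` and `1F`, hence by `2F`.
      shared-⊥ : (∀ k → ∃ λ c → T.Touched c (class k)) → (∃ λ k → T.Untouched 0F (class k)) →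
          (∃ λ k → T.Untouched 1F (class k)) → ⊥
      shared-⊥ touched (k₀ , quiet₀) (k₁ , quiet₁) = cases (any? λ i → U i Bool.≟ true)
        where
        U : Mask m
        U l = not (does (T.untouched? 0F (class l)))
        U-yes : ∀ {l} → U l ≡ true → ¬ T.Untouched 0F (class l)
        U-yes {l} h = does-no (T.untouched? 0F (class l)) (not-true⁻¹ h)
        U-no : ∀ {l} → U l ≡ false → T.Untouched 0F (class l)
        U-no {l} h = does-yes (T.untouched? 0F (class l)) (not-false⁻¹ h)
        U-Sep : Sep U
        U-Sep = separated λ a b x Ua Ub → #-additive (T.touched-apart 0F a b (U-yes Ua) (U-no Ub)) x
        crossed : (∃ λ a → ∃ λ b → U a ≡ true × U b ≡ false × ∃ λ x → N a b x ≡ true) → ⊥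
        crossed (a , b , Ua , Ub , lnk) = linked-⊥ (Sep-#′ U-Sep Ua Ub) lnk (U-no Ub) (T.touch 0F (U-yes Ua))
            (touched b)
        lonely : (∀ l → U l ≡ false) → (∃ λ c → T.Touched c (class k₁)) → ⊥
        lonely ¬U (0F , l , x , l∈ , a) = bool-clash a (U-no (¬U l) l (self-class l) x)
        lonely ¬U (1F , l , x , l∈ , a) = bool-clash a (quiet₁ l l∈ x)
        lonely ¬U (2F , l , x , l∈ , a) = bool-clash a (both-inactive l x (U-no (¬U l) l (self-class l) x)
            (quiet₁ l l∈ x))
        cases : Dec (∃ λ i → U i ≡ true) → ⊥
        cases (yes (i , Ui)) = crossed
            (cross-W U U-Sep i k₀ Ui (not-true (dec-true (T.untouched? 0F (class k₀)) quiet₀)))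
        cases (no none) = lonely (λ l → Bool.¬-not λ Ul → none (l , Ul)) (touched k₁)

      -- A class untouched by all three differences gives a cut of the tail. A difference touching
      -- every class has a single colour, which every nonconstant line of the others must share.
      -- `shared-⊥` excludes the rest.
      layer-cut : Cut f f-inj
      layer-cut = cases (any? λ k → forall? any? λ c → T.untouched? c (class k))
          (any? λ c → forall? any? λ k → ¬? (T.untouched? c (class k)))
        where
        some-touched : ¬ (∃ λ k → ∀ c → T.Untouched c (class k)) → ∀ k → ∃ λ c → T.Touched c (class k)
        some-touched none k with any? (λ c → ¬? (T.untouched? c (class k)))
        ... | yes (c , ¬un) = c , T.touch c ¬un
        ... | no ¬t = contradiction (k , λ c → decidable-stable (T.untouched? c (class k)) λ ¬un →
            ¬t (c , ¬un)) none
        some-untouched : ¬ (∃ λ c → ∀ k → ¬ T.Untouched c (class k)) → ∀ c → ∃ λ k → T.Untouched c (class k)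
        some-untouched none c with any? (λ k → T.untouched? c (class k))
        ... | yes t = t
        ... | no ¬t = contradiction (c , λ k un → ¬t (k , un)) none
        cases : Dec (∃ λ k → ∀ c → T.Untouched c (class k)) → Dec (∃ λ c → ∀ k → ¬ T.Untouched c (class k)) →
            Cut f f-inj
        cases (yes (k , un)) _ = tail-cut κ κ≢0 (class k) (class-Sep k) k (self-class k) λ j j∈ →
            Silent-hue κ κ≢0 j λ c x → un c j j∈ x
        cases (no _) (yes (c , touched)) = touched-cut c touched (T.touch c (touched a₀))
        cases (no none) (no none′) = ⊥-elim (shared-⊥ (some-touched none) (some-untouched none′ 0F)
            (some-untouched none′ 1F))

extend-cut : ∀ {m} (f : Pt (suc m) → V) (f-inj : Injective f) → Cut (Layers.f₀ f f-inj)
    (Layers.f₀-inj f f-inj) → Cut f f-inj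
extend-cut f f-inj (cutting κ κ≢0 part part-Sep inner∈ outer∉) =
    cases (additiveSplit? (Layers.f₀ f f-inj) (Layers.f₀-inj f f-inj))
  where
  cases : Dec (AdditiveSplit (Layers.f₀ f f-inj) (Layers.f₀-inj f f-inj)) → Cut f f-inj
  cases (yes split) = LayerCut.additive-layer f f-inj split
  cases (no none)   = LayerCut.Nonadditive.layer-cut f f-inj none κ κ≢0 part part-Sep inner∈ outer∉

cut-exists : ∀ n (f : Pt (suc (suc n)) → V) (f-inj : Injective f) → Cut f f-inj
cut-exists (suc n) f f-inj = extend-cut f f-inj (cut-exists n (Layers.f₀ f f-inj) (Layers.f₀-inj f f-inj))
cut-exists zero f f-inj = by-twist (same n 0F)
  where
  open Quasi f f-inj
  x₀ : Pt 2
  x₀ = 0F ∷ 0F ∷ []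
  n = ν 0F 1F x₀
  const : ∀ x → ν 0F 1F x ≡ n
  const x = everywhere (λ x → ν 0F 1F x ≡ n)
      (λ { x 0F v h → trans (ν-updateˡ 0F 1F x v) h ; x 1F v h → trans (ν-updateʳ 0F 1F x v) h }) x₀ x refl
  D : Mask 2
  D 0F = true
  D 1F = false
  orthogonal : ∀ κ → κ · n ≡ false → ∀ i j x → D i ≡ true → D j ≡ false → κ · ν i j x ≡ false
  orthogonal κ h 0F 1F x _ _ = trans (cong (κ ·_) (const x)) h
  orthogonal κ h 0F 0F x _ ()
  orthogonal κ h 1F _ x ()
  by-twist : n ≡ 0F ⊎ n ≢ 0F → Cut f f-inj
  by-twist (inj₁ eq) = cutting 1F
      (λ ()) D (Functional.separated (orthogonal 1F (trans (cong (1F ·_) eq) (·-zeroʳ 1F)))) {0F} {1F} refl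
      refl
  -- A vector is orthogonal to itself, so the twist serves as `κ`.
  by-twist (inj₂ neq) = cutting n neq D (Functional.separated (orthogonal n (·-self n))) {0F} {1F} refl refl

-- A third disjoint quasigroup

InjectiveOn : ∀ {m} → Mask m → (Pt m → V) → Set
InjectiveOn D f = ∀ i x v w → D i ≡ true → f (x [ i ]≔ v) ≡ f (x [ i ]≔ w) → v ≡ w

ConstantOff : ∀ {m} → Mask m → (Pt m → V) → Set
ConstantOff D f = ∀ i x v → D i ≡ false → f (x [ i ]≔ v) ≡ f x

-- Functions of the coordinates in `D` are kept as functions of all coordinates that ignore the
-- others. Restriction to a set then needs no renumbering, and `thirds-remove` drops ignored
-- coordinates one at a time.
Third : ∀ {m} → Mask m → (Pt m → V) → (Pt m → V) → Set
Third {m} D f g = Σ (Pt m → V) λ h → InjectiveOn D h × ConstantOff D h × (∀ x → h x ≢ f x) × (∀ x → h x ≢ g x)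

Thirds : ∀ {m} → Mask m → Set
Thirds D = ∀ f g → InjectiveOn D f → InjectiveOn D g → ConstantOff D f → ConstantOff D g → (∀ x → f x ≢ g x) →
    Third D f g

module _ {A : Set} where

  removeAt-update : ∀ {m} (x : Vec A (suc m)) k v → removeAt (x [ k ]≔ v) k ≡ removeAt x k
  removeAt-update (a ∷ x) zero v = refl
  removeAt-update (a ∷ b ∷ x) (suc zero) v = refl
  removeAt-update (a ∷ b ∷ c ∷ x) (suc (suc k)) v = cong (a ∷_) (removeAt-update (b ∷ c ∷ x) (suc k) v)

  removeAt-punchIn : ∀ {m} (x : Vec A (suc m)) k i v → removeAt (x [ punchIn k i ]≔ v) k ≡ removeAt x k [ i ]≔
      v
  removeAt-punchIn (a ∷ x) zero i v = refl
  removeAt-punchIn (a ∷ b ∷ x) (suc k) zero v = refl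
  -- At `suc k`, `removeAt` reduces only once the updated tail is a visible `∷`.
  removeAt-punchIn (a ∷ b ∷ x) (suc k) (suc i) v with (b ∷ x) [ punchIn k i ]≔ v in eq
  ... | c ∷ y = cong (a ∷_) (trans (cong (λ z → removeAt z k) (sym eq)) (removeAt-punchIn (b ∷ x) k i v))

  insertAt-removeAt-update : ∀ {m} (x : Vec A (suc m)) k v → insertAt (removeAt x k) k v ≡ x [ k ]≔ v
  insertAt-removeAt-update (a ∷ x) zero v = refl
  insertAt-removeAt-update (a ∷ b ∷ x) (suc k) v = cong (a ∷_) (insertAt-removeAt-update (b ∷ x) k v)

  insertAt-punchIn-update : ∀ {m} (y : Vec A m) k i a v → insertAt y k a [ punchIn k i ]≔ v ≡ insertAt
      (y [ i ]≔ v) k a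
  insertAt-punchIn-update y zero i a v = refl
  insertAt-punchIn-update (b ∷ y) (suc k) zero a v = refl
  insertAt-punchIn-update (b ∷ y) (suc k) (suc i) a v = cong (b ∷_) (insertAt-punchIn-update y k i a v)

thirds-remove : ∀ {m} (D : Mask (suc m)) k → D k ≡ false → Thirds (D ∘ punchIn k) → Thirds D
thirds-remove {m} D k Dk thirds f g f-inj g-inj f-const g-const f≢g =
  h ∘ drop , inj , const , apart f f-const h≢f , apart g g-const h≢g
  where
  drop : Pt (suc m) → Pt m
  drop x = removeAt x k
  fill : Pt m → Pt (suc m)
  fill y = insertAt y k 0F
  D′ = D ∘ punchIn k
  inj-fill : ∀ f → InjectiveOn D f → InjectiveOn D′ (f ∘ fill)
  inj-fill f f-inj i y v w Di eq = f-inj (punchIn k i) (fill y) v w Di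
    (trans (cong f (insertAt-punchIn-update y k i 0F v))
        (trans eq (cong f (sym (insertAt-punchIn-update y k i 0F w)))))
  const-fill : ∀ f → ConstantOff D f → ConstantOff D′ (f ∘ fill)
  const-fill f f-const i y v Di = trans (cong f (sym (insertAt-punchIn-update y k i 0F v)))
      (f-const (punchIn k i) (fill y) v Di)
  sol = thirds (f ∘ fill) (g ∘ fill) (inj-fill f f-inj) (inj-fill g g-inj) (const-fill f f-const)
      (const-fill g g-const) (f≢g ∘ fill)
  h = proj₁ sol
  h-inj = proj₁ (proj₂ sol)
  h-const = proj₁ (proj₂ (proj₂ sol))
  h≢f = proj₁ (proj₂ (proj₂ (proj₂ sol)))
  h≢g = proj₂ (proj₂ (proj₂ (proj₂ sol)))
  apart : ∀ f → ConstantOff D f → (∀ y → h y ≢ f (fill y)) → ∀ x → h (drop x) ≢ f x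
  apart f f-const h≢ x eq = h≢ (drop x)
      (trans eq (trans (sym (f-const k x 0F Dk)) (cong f (sym (insertAt-removeAt-update x k 0F)))))
  at : ∀ i (k≢i : k ≢ i) x v → drop (x [ i ]≔ v) ≡ drop x [ punchOut k≢i ]≔ v
  at i k≢i x v = trans (cong (λ i → drop (x [ i ]≔ v)) (sym (punchIn-punchOut k≢i)))
      (removeAt-punchIn x k (punchOut k≢i) v)
  inj : InjectiveOn D (h ∘ drop)
  inj i x v w Di eq = h-inj (punchOut k≢i) (drop x) v w (trans (cong D (punchIn-punchOut k≢i)) Di)
    (trans (cong h (sym (at i k≢i x v))) (trans eq (cong h (at i k≢i x w))))
    where
    k≢i : k ≢ i
    k≢i refl = bool-clash Di Dk
  const : ConstantOff D (h ∘ drop)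
  const i x v Di with same k i
  ... | inj₁ refl = cong h (removeAt-update x k v)
  ... | inj₂ k≢i = trans (cong h (at i k≢i x v))
      (h-const (punchOut k≢i) (drop x) v (trans (cong D (punchIn-punchOut k≢i)) Di))

other : V → V → V
other a b = if not (1F == a) ∧ not (1F == b) then 1F else if not (2F == a) ∧ not (2F == b) then 2F else 3F

other-correct : ∀ a b → other a b ≢ 0F × a ≢ other a b × b ≢ other a b
other-correct = prove (all λ a → all λ b → neg (other a b ≐ 0F) ∧ᶜ neg (a ≐ other a b) ∧ᶜ neg (b ≐ other a b))

module _ {m : ℕ} (f : Pt m → V) (f-inj : Injective f) (g : Pt m → V) (g-inj : Injective g)
         (f≢g : ∀ x → f x ≢ g x) where

  open Quasi f f-inj

  -- The coordinates outside `I` act on the values of `f` and `g` by one injective map `A x`, and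
  -- applying it to a solution over `I` keeps it apart from both. In a direction outside `I`,
  -- injectivity is inherited from `f`, since `A x z` is a value of `f`.
  contraction-third : ∀ I {i₀} → I i₀ ≡ true → Thirds I → Contractible I f g → Third (λ _ → true) f g
  contraction-third I {i₀} Ii₀ thirds con = h , (λ i x v w _ → h-inj i x v w (bool-case (I i))) ,
      (λ _ _ _ ()) , h≢f , h≢g
    where
    o : Pt m
    o = replicate m 0F
    π : Pt m → Pt m
    π x = merge I x o
    π-inj : ∀ f → Injective f → InjectiveOn I (f ∘ π)
    π-inj f f-inj i x v w Ii eq = f-inj i (π x) v w (trans (cong f (sym (merge-update I x o i v Ii)))
        (trans eq (cong f (merge-update I x o i w Ii))))
    π-const : ∀ (f : Pt m → V) → ConstantOff I (f ∘ π)
    π-const f i x v Ii = cong f (merge-ignoreˡ I x o i v Ii)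
    sol = thirds (f ∘ π) (g ∘ π) (π-inj f f-inj) (π-inj g g-inj) (π-const f) (π-const g) (f≢g ∘ π)
    h₀ = proj₁ sol
    h₀-inj = proj₁ (proj₂ sol)
    h₀-const = proj₁ (proj₂ (proj₂ sol))
    A : Pt m → V → V
    A x = proj₁ (con o x)
    A-f : ∀ x y → Agree I o y → f (merge I y x) ≡ A x (f y)
    A-f x y o~y = proj₁ (proj₂ (con o x) y o~y)
    A-g : ∀ x y → Agree I o y → g (merge I y x) ≡ A x (g y)
    A-g x y o~y = proj₂ (proj₂ (con o x) y o~y)
    d : V → V
    d z = f o ⊕ z
    -- On a line in direction `i₀` the function `f` takes every value, `z` at the point `y z`; this
    -- determines `A x` on all of `V`.
    y : V → Pt m
    y z = o [ i₀ ]≔ pos i₀ (d z) o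
    o~y : ∀ z → Agree I o (y z)
    o~y z = agree-update i₀ (pos i₀ (d z) o) Ii₀ (agree-refl I o)
    f-y : ∀ z → f (y z) ≡ z
    f-y z = trans (cong f (sym (mv-def i₀ (d z) o))) (trans (f-mv i₀ (d z) o) (⊕-involutiveˡ (f o) z))
    A-y : ∀ x z → A x z ≡ f (merge I (y z) x)
    A-y x z = trans (cong (A x) (sym (f-y z))) (sym (A-f x (y z) (o~y z)))
    A-inj : ∀ x z z′ → A x z ≡ A x z′ → z ≡ z′
    A-inj x z z′ eq = trans (sym (f-y z)) (trans (cong (λ v → f (o [ i₀ ]≔ v)) same-pos) (f-y z′))
      where
      on-line : ∀ z → A x z ≡ f (merge I o x [ i₀ ]≔ pos i₀ (d z) o)
      on-line z = trans (A-y x z) (cong f (merge-update I o x i₀ (pos i₀ (d z) o) Ii₀))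
      same-pos : pos i₀ (d z) o ≡ pos i₀ (d z′) o
      same-pos = f-inj i₀ (merge I o x) _ _ (trans (sym (on-line z)) (trans eq (on-line z′)))
    h : Pt m → V
    h x = A x (h₀ x)
    h-inj : ∀ i x v w → I i ≡ true ⊎ I i ≡ false → h (x [ i ]≔ v) ≡ h (x [ i ]≔ w) → v ≡ w
    h-inj i x v w (inj₁ Ii) eq = h₀-inj i x v w Ii (A-inj x _ _ (trans (sym (A-x v _)) (trans eq (A-x w _))))
      where
      A-x : ∀ v z → A (x [ i ]≔ v) z ≡ A x z
      A-x v z = trans (A-y (x [ i ]≔ v) z) (trans (cong f (merge-ignoreʳ I (y z) x i v Ii)) (sym (A-y x z)))
    h-inj i x v w (inj₂ Ii) eq = f-inj i (merge I (y z) x) v w (trans (sym (A-x v)) (trans eq (A-x w)))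
      where
      z = h₀ x
      A-x : ∀ v → h (x [ i ]≔ v) ≡ f (merge I (y z) x [ i ]≔ v)
      A-x v = trans (cong (A (x [ i ]≔ v)) (h₀-const i x v Ii))
          (trans (A-y (x [ i ]≔ v) z) (cong f (merge-updateʳ I (y z) x i v Ii)))
    h≢f : ∀ x → h x ≢ f x
    h≢f x eq = proj₁ (proj₂ (proj₂ (proj₂ sol))) x
        (A-inj x _ _ (trans eq (trans (cong f (sym (merge-merge I x o))) (A-f x (π x) (agree-merge I x o)))))
    h≢g : ∀ x → h x ≢ g x
    h≢g x eq = proj₂ (proj₂ (proj₂ (proj₂ sol))) x
        (A-inj x _ _ (trans eq (trans (cong g (sym (merge-merge I x o))) (A-g x (π x) (agree-merge I x o)))))

  open Pair f f-inj g g-inj f≢g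

  two-valued-third : ∀ c p → (∀ x → u x ≡ c ⊎ u x ≡ c ⊕ p) → Third (λ _ → true) f g
  two-valued-third c p vals = (λ x → f x ⊕ q) , (λ i x v w _ eq → f-inj i x v w (⊕-cancelʳ _ _ q eq)) ,
      (λ _ _ _ ()) ,
      (λ x eq → q≢0 (⊕-cancelˡ (f x) q 0F (trans eq (sym (⊕-identityʳ (f x)))))) ,
      λ x eq → avoid x (vals x) (trans (cong (f x ⊕_) (sym eq)) (⊕-involutiveˡ (f x) q))
    where
    q = other c (c ⊕ p)
    q≢0 = proj₁ (other-correct c (c ⊕ p))
    ⊕-cancelʳ : ∀ a b q → a ⊕ q ≡ b ⊕ q → a ≡ b
    ⊕-cancelʳ = prove (all λ a → all λ b → all λ q → a ⊕ q ≐ b ⊕ q ⇒ a ≐ b)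
    avoid : ∀ x → u x ≡ c ⊎ u x ≡ c ⊕ p → u x ≢ q
    avoid x (inj₁ e) h = proj₁ (proj₂ (other-correct c (c ⊕ p))) (trans (sym e) h)
    avoid x (inj₂ e) h = proj₂ (proj₂ (other-correct c (c ⊕ p))) (trans (sym e) h)

  one-colour-third : ∀ p → (∀ i x → col i x ≡ 0F ⊎ col i x ≡ p) → Third (λ _ → true) f g
  one-colour-third p h = two-valued-third (u o) p λ x → everywhere P step o x (inj₁ refl)
    where
    o : Pt m
    o = replicate m 0F
    P : Pt m → Set
    P x = u x ≡ u o ⊎ u x ≡ u o ⊕ p
    step : ∀ x i v → P x → P (x [ i ]≔ v)
    step x i v px = subst P (sym (update-mv i v x))
        (subst (λ a → a ≡ u o ⊎ a ≡ u o ⊕ p) (sym (u-mv i (diff i v x) x))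
      (prove (all λ c → all λ p → all λ a → a ≐ c ∨ᶜ a ≐ c ⊕ p ⇒ all λ q → q ≐ 0F ∨ᶜ q ≐ p ⇒ all λ d →
        a ⊕ shear q d ≐ c ∨ᶜ a ⊕ shear q d ≐ c ⊕ p) (u o) p (u x) px (col i x) (h i x) (diff i v x)))

module Completing {m : ℕ} (f : Pt m → V) (f-inj : Injective f) (g : Pt m → V) (g-inj : Injective g)
    (f≢g : ∀ x → f x ≢ g x)
                  (thirds : ∀ (D : Mask m) k → D k ≡ false → Thirds D) where

  open Quasi f f-inj
  open Pair f f-inj g g-inj f≢g

  Noisy : Mask m → Set
  Noisy M = ∃ λ i → ∃ λ x → M i ≡ true × col i x ≢ 0F

  noisy? : ∀ M → Dec (Noisy M)
  noisy? M = any? λ i → search-Pt λ x → (M i Bool.≟ true) ×-dec ¬? (col i x ≟ 0F)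

  quiet : ∀ {M} → ¬ Noisy M → ∀ i x → M i ≡ true → col i x ≡ 0F
  quiet none i x Mi with same (col i x) 0F
  ... | inj₁ eq = eq
  ... | inj₂ neq = contradiction (i , x , Mi , neq) none

  additive-third : AdditiveSplit f f-inj → Third (λ _ → true) f g
  additive-third (Wv , flat , i , k , Wi , Wk) = cases (noisy? W) (noisy? (∁ W))
    where
    W = lookup Wv
    flat∁ : AdditiveCut.Additive f f-inj (∁ W)
    flat∁ i j x Wi Wj = trans (ν-sym i j x) (flat j i x (not-false⁻¹ Wj) (not-true⁻¹ Wi))
    cases : Dec (Noisy W) → Dec (Noisy (∁ W)) → Third (λ _ → true) f g
    cases (no none) _ = contraction-third f f-inj g g-inj f≢g (∁ W) (not-false Wk)
        (thirds (∁ W) i (not-true Wi))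
      (additive-contractible f f-inj g g-inj f≢g (∁ W) flat∁ λ j x Wj → quiet none j x (not-false⁻¹ Wj))
    cases _ (no none) = contraction-third f f-inj g g-inj f≢g W Wi (thirds W k Wk)
      (additive-contractible f f-inj g g-inj f≢g W flat λ j x Wj → quiet none j x (not-false Wj))
    cases (yes (i , x , Wi , hi)) (yes (k , z , Wk , hk)) = one-colour-third f f-inj g g-inj f≢g
        (col i x) λ j y → at j y (same (col j y) 0F) (bool-case (W j))
      where
      cut : ∀ {i k x z} → W i ≡ true → W k ≡ false → col i x ≢ 0F → col k z ≢ 0F → col i x ≡ col k z
      cut = CutColours.cut-colours f f-inj g g-inj f≢g W flat
      at : ∀ j y → col j y ≡ 0F ⊎ col j y ≢ 0F → W j ≡ true ⊎ W j ≡ false → col j y ≡ 0F ⊎ col j y ≡ col i x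
      at j y (inj₁ e) _ = inj₁ e
      at j y (inj₂ hj) (inj₁ Wj) =
          inj₂ (trans (cut Wj (not-true⁻¹ Wk) hj hk) (sym (cut Wi (not-true⁻¹ Wk) hi hk)))
      at j y (inj₂ hj) (inj₂ Wj) = inj₂ (sym (cut Wi Wj hi hj))

  module _ (none : ¬ AdditiveSplit f f-inj) (κ : V) (κ≢0 : κ ≢ 0F) where

    open Classes f f-inj κ κ≢0
    open Touching f f-inj g g-inj f≢g κ κ≢0 using (Untouched; untouched?; touch; touched-apart; act; module
        Monochrome)

    -- `I` is the union of the touched classes. If it is empty, every colour is orthogonal to `κ`,
    -- hence `0F` or `κ`. If it is everything, `Monochrome` applies. Otherwise `f` and `g` contract
    -- to `I`.
    nonadditive-third : ∀ (part : Mask m) → Sep part → ∀ {a₀ b₀} → part a₀ ≡ true → part b₀ ≡ false →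
        Third (λ _ → true) f g
    nonadditive-third part part-Sep {a₀} {b₀} a∈ b∉ = cases (any? λ l → I l Bool.≟ true)
        (any? λ l → I l Bool.≟ false)
      where
      I : Mask m
      I l = not (does (untouched? (class l)))
      lively-class : ∀ {l} → I l ≡ true → ¬ Untouched (class l)
      lively-class {l} h = does-no (untouched? (class l)) (not-true⁻¹ h)
      quiet-class : ∀ {l} → I l ≡ false → Untouched (class l)
      quiet-class {l} h = does-yes (untouched? (class l)) (not-false⁻¹ h)
      I-Sep : Sep I
      I-Sep = separated λ a b x Ia Ib → #-additive (touched-apart a b (lively-class Ia) (quiet-class Ib)) x
      silent : Untouched (∁ I)
      silent l Il x = quiet-class (not-true⁻¹ Il) l (self-class l) x
      lively : ∀ D → Sep D → ∀ i → D i ≡ true → (∀ l → D l ≡ true → I l ≡ true) → ¬ Untouched D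
      lively D sep i Di D⊂I un = lively-class (D⊂I i Di) λ l l∈ → un l (inside l l∈ (bool-case (D l)))
        where
        inside : ∀ l → class i l ≡ true → D l ≡ true ⊎ D l ≡ false → D l ≡ true
        inside l l∈ (inj₁ Dl) = Dl
        inside l l∈ (inj₂ Dl) = contradiction (#-sym (Sep-#′ sep Di Dl)) (class⇒¬# l∈)
      monochrome-third : (∀ l → I l ≡ true) → (∃ λ l → ∃ λ x → class a₀ l ≡ true × act l x ≡ true) →
          Third (λ _ → true) f g
      monochrome-third all-I (l , x , _ , a) =
          finish (Monochrome.monochrome (crossing f f-inj κ κ≢0 none) a₀ b₀ (Sep-#′ part-Sep a∈ b∉)
          (λ k → lively-class (all-I k)) l x a)
        where
        finish : (∃ λ p → κ · p ≡ true × (∀ i x → col i x ≡ p)) → Third (λ _ → true) f g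
        finish (p , _ , mono) = one-colour-third f f-inj g g-inj f≢g p λ i x → inj₂ (mono i x)
      cases : Dec (∃ λ l → I l ≡ true) → Dec (∃ λ l → I l ≡ false) → Third (λ _ → true) f g
      cases (no ¬I) _ = one-colour-third f f-inj g g-inj f≢g κ λ i x →
        prove (all λ κ → neg (κ ≐ 0F) ⇒ all λ c → κ · c ≐ᵇ false ⇒ c ≐ 0F ∨ᶜ c ≐ κ) κ κ≢0 (col i x)
          (silent i (not-false (Bool.¬-not λ Ii → ¬I (i , Ii))) x)
      cases _ (no ¬J) = monochrome-third all-I (touch (lively-class (all-I a₀)))
        where
        all-I : ∀ l → I l ≡ true
        all-I l = Bool.¬-not λ Il → ¬J (l , Il)
      cases (yes (i , Ii)) (yes (j , Ij)) = contraction-third f f-inj g g-inj f≢g I Ii (thirds I j Ij)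
        (Contraction.contractible f f-inj g g-inj f≢g κ κ≢0 I I-Sep silent lively Ii)

  cut-third : Cut f f-inj → Third (λ _ → true) f g
  cut-third (cutting κ κ≢0 part part-Sep inner∈ outer∉) = cases (additiveSplit? f f-inj)
    where
    cases : Dec (AdditiveSplit f f-inj) → Third (λ _ → true) f g
    cases (yes split) = additive-third split
    cases (no none) = nonadditive-third none κ κ≢0 part part-Sep inner∈ outer∉

-- A cut needs two coordinates. In arities 0 and 1 there is at most one line, hence at most one
-- colour.
full-third : ∀ {m} → (∀ (D : Mask m) k → D k ≡ false → Thirds D) → ∀ (f g : Pt m → V) → Injective f →
    Injective g → (∀ x → f x ≢ g x) → Third (λ _ → true) f g
full-third {zero} thirds f g f-inj g-inj f≢g = one-colour-third f f-inj g g-inj f≢g 0F λ ()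
full-third {suc zero} thirds f g f-inj g-inj f≢g = one-colour-third f f-inj g g-inj f≢g
    (col 0F o) λ { 0F x → inj₂ (everywhere (λ x → col 0F x ≡ col 0F o)
    (λ { x 0F v h → trans (cong (col 0F) (update-mv 0F v x)) (trans (col-mv 0F (diff 0F v x) x) h) }) o x
        refl) }
  where
  open Quasi f f-inj
  open Pair f f-inj g g-inj f≢g
  o : Pt 1
  o = 0F ∷ []
full-third {suc (suc n)} thirds f g f-inj g-inj f≢g = Completing.cut-third f f-inj g g-inj f≢g thirds
    (cut-exists n f f-inj)

mutual

  -- The recursion is on the arity: the full mask calls only on proper ones, and a proper mask loses
  -- a coordinate by `thirds-remove`.
  masked-third : ∀ {m} (D : Mask m) → Thirds D
  masked-third {m} D f g f-inj g-inj f-const g-const f≢g = cases (any? λ k → D k Bool.≟ false)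
    where
    cases : Dec (∃ λ k → D k ≡ false) → Third D f g
    cases (yes (k , Dk)) = partial-third D k Dk f g f-inj g-inj f-const g-const f≢g
    cases (no full) = restrict (full-third partial-third f g (inj f f-inj) (inj g g-inj) f≢g)
      where
      D≡ : ∀ i → D i ≡ true
      D≡ i = Bool.¬-not λ Di → full (i , Di)
      inj : ∀ (f : Pt m → V) → InjectiveOn D f → Injective f
      inj f f-inj i x v w = f-inj i x v w (D≡ i)
      restrict : Third (λ _ → true) f g → Third D f g
      restrict (h , h-inj , _ , h≢f , h≢g) = h , (λ i x v w _ → h-inj i x v w refl) ,
          (λ i x v Di → bool-clash (D≡ i) Di) , h≢f , h≢g

  partial-third : ∀ {m} (D : Mask m) k → D k ≡ false → Thirds D
  partial-third {suc m} D k Dk = thirds-remove D k Dk (masked-third (D ∘ punchIn k))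

third-quasigroup : ∀ {m} (f g : Pt m → V) → Injective f → Injective g → (∀ x → f x ≢ g x) →
  Σ (Pt m → V) λ h → Injective h × (∀ x → h x ≢ f x) × (∀ x → h x ≢ g x)
third-quasigroup f g f-inj g-inj f≢g = forget (full-third partial-third f g f-inj g-inj f≢g)
  where
  forget : Third (λ _ → true) f g → _
  forget (h , h-inj , _ , h≢f , h≢g) = h , (λ i x v w → h-inj i x v w refl) , h≢f , h≢g

-- Hypercuboids

hamming-refl : ∀ {n} (x : Word 4 n) → hamming x x ≡ 0
hamming-refl [] = refl
hamming-refl (a ∷ x) with a ≟ a
... | yes _  = hamming-refl x
... | no a≢a = contradiction refl a≢a

hamming-update : ∀ {n} (x : Word 4 n) i {v w} → v ≢ w → hamming (x [ i ]≔ v) (x [ i ]≔ w) ≡ 1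
hamming-update (a ∷ x) zero {v} {w} v≢w with v ≟ w
... | yes v≡w = contradiction v≡w v≢w
... | no _ = cong suc (hamming-refl x)
hamming-update (a ∷ x) (suc i) v≢w with a ≟ a
... | yes _  = hamming-update x i v≢w
... | no a≢a = contradiction refl a≢a

snoc-update : ∀ {n} (y : Word 4 n) s i v → (y ∷ʳ s) [ inject₁ i ]≔ v ≡ (y [ i ]≔ v) ∷ʳ s
snoc-update (a ∷ y) s zero v = refl
snoc-update (a ∷ y) s (suc i) v = cong (a ∷_) (snoc-update y s i v)

snoc-last : ∀ {n} (y : Word 4 n) s t → (y ∷ʳ s) [ fromℕ n ]≔ t ≡ y ∷ʳ t
snoc-last [] s t = refl
snoc-last (a ∷ y) s t = cong (a ∷_) (snoc-last y s t)

inner-or-last : ∀ {n} (i : Fin (suc n)) → (∃ λ j → i ≡ inject₁ j) ⊎ i ≡ fromℕ n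
inner-or-last {zero} zero = inj₂ refl
inner-or-last {suc n} zero = inj₁ (zero , refl)
inner-or-last {suc n} (suc i) = Sum.map (λ { (j , refl) → suc j , refl }) (cong suc) (inner-or-last i)

injective⇒quasigroup : ∀ {n} (q : Word 4 n → V) → Injective q → IsQuasigroup q
injective⇒quasigroup q q-inj zero (b ∷ x) = q x , refl , sym
injective⇒quasigroup q q-inj (suc i) (b ∷ x) = inverse line b , sym (inverse-correct line (q-inj i x) b) ,
    λ {a} eq → q-inj i x _ _ (trans (inverse-correct line (q-inj i x) b) eq)
  where
  line : V → V
  line a = q (x [ i ]≔ a)

-- Adding the missing layers

record Family {m} (L₀ : V → Pt m → V) (P₀ P : V → Bool) : Set where
  constructor family
  field
    layers  : V → Pt m → V
    inj     : ∀ s → P s ≡ true → Injective (layers s)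
    apart   : ∀ s t → P s ≡ true → P t ≡ true → s ≢ t → ∀ y → layers s y ≢ layers t y
    extends : ∀ s → P₀ s ≡ true → P s ≡ true × (∀ y → layers s y ≡ L₀ s y)

xor-quasigroup : ∀ {m} → Σ (Pt m → V) Injective
xor-quasigroup = total , total-inj
  where
  total : ∀ {m} → Pt m → V
  total [] = 0F
  total (a ∷ x) = a ⊕ total x
  total-inj : ∀ {m} → Injective (total {m})
  total-inj zero (a ∷ x) v w eq = prove (all λ v → all λ w → all λ t → v ⊕ t ≐ w ⊕ t ⇒ v ≐ w) v w (total x) eq
  total-inj (suc i) (a ∷ x) v w eq = total-inj i x v w (⊕-cancelˡ a _ _ eq)

-- The elements of `V` sum to zero, so the sum of three distinct values is the fourth. In three
-- disjoint rows each symbol occupies three columns and is missing from exactly one.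
sum-injective : ∀ (f g h : V → V) → InjV f → InjV g → InjV h → (∀ a → f a ≢ g a) → (∀ a → f a ≢ h a) →
    (∀ a → g a ≢ h a) →
  InjV (λ a → f a ⊕ g a ⊕ h a)
sum-injective f g h f-inj g-inj h-inj f≢g f≢h g≢h v w eq =
    check′ v w (subst₂ _≡_ (tab-correct k v) (tab-correct k w) eq)
  where
  k : V → V
  k a = f a ⊕ g a ⊕ h a
  fd = inj⇒distinct f f-inj
  gd = inj⇒distinct g g-inj
  hd = inj⇒distinct h h-inj
  check′ = prove (all λ f₀ → all λ f₁ → neg (f₀ ≐ f₁) ⇒ all λ f₂ → all λ f₃ → distinct f₀ f₁ f₂ f₃ ⇒
    all λ g₀ → neg (f₀ ≐ g₀) ⇒ all λ g₁ → neg (f₁ ≐ g₁) ⇒ neg (g₀ ≐ g₁) ⇒ all λ g₂ → neg (f₂ ≐ g₂) ⇒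
    all λ g₃ → neg (f₃ ≐ g₃) ⇒ distinct g₀ g₁ g₂ g₃ ⇒
    all λ h₀ → neg (f₀ ≐ h₀) ⇒ neg (g₀ ≐ h₀) ⇒ all λ h₁ → neg (f₁ ≐ h₁) ⇒ neg (g₁ ≐ h₁) ⇒ neg (h₀ ≐ h₁) ⇒
    all λ h₂ → neg (f₂ ≐ h₂) ⇒ neg (g₂ ≐ h₂) ⇒ all λ h₃ → neg (f₃ ≐ h₃) ⇒ neg (g₃ ≐ h₃) ⇒
        distinct h₀ h₁ h₂ h₃ ⇒
    let k = tab (f₀ ⊕ g₀ ⊕ h₀) (f₁ ⊕ g₁ ⊕ h₁) (f₂ ⊕ g₂ ⊕ h₂) (f₃ ⊕ g₃ ⊕ h₃) in
    all λ v → all λ w → k v ≐ k w ⇒ v ≐ w)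
    (f 0F) (f 1F) (proj₁ fd) (f 2F) (f 3F) fd
    (g 0F) (f≢g 0F) (g 1F) (f≢g 1F) (proj₁ gd) (g 2F) (f≢g 2F) (g 3F) (f≢g 3F) gd
    (h 0F) (f≢h 0F) (g≢h 0F) (h 1F) (f≢h 1F) (g≢h 1F) (proj₁ hd) (h 2F) (f≢h 2F) (g≢h 2F) (h 3F) (f≢h 3F)
        (g≢h 3F) hd

module _ {m : ℕ} {L₀ : V → Pt m → V} {P₀ P : V → Bool} (F : Family L₀ P₀ P) where

  open Family F

  New : V → Set
  New s = Σ (Pt m → V) λ h → Injective h × (∀ t → P t ≡ true → t ≢ s → ∀ y → h y ≢ layers t y)

  -- The number of layers present besides `s` decides: for none, the sum of the coordinates; for
  -- one, a translate of it; for two, `third-quasigroup`; for three, their sum.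
  new-layer : ∀ s → New s
  new-layer s = cases (bool-case (P a)) (bool-case (P b)) (bool-case (P c))
    where
    a = s ⊕ 1F
    b = s ⊕ 2F
    c = s ⊕ 3F
    cover : ∀ s t → t ≢ s → t ≡ s ⊕ 1F ⊎ t ≡ s ⊕ 2F ⊎ t ≡ s ⊕ 3F
    cover = prove (all λ s → all λ t → neg (t ≐ s) ⇒ t ≐ s ⊕ 1F ∨ᶜ t ≐ s ⊕ 2F ∨ᶜ t ≐ s ⊕ 3F)
    a≢b : a ≢ b
    a≢b = prove (all λ s → neg (s ⊕ 1F ≐ s ⊕ 2F)) s
    a≢c : a ≢ c
    a≢c = prove (all λ s → neg (s ⊕ 1F ≐ s ⊕ 3F)) s
    b≢c : b ≢ c
    b≢c = prove (all λ s → neg (s ⊕ 2F ≐ s ⊕ 3F)) s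
    Off : (Pt m → V) → V → Set
    Off h t = P t ≡ true → ∀ y → h y ≢ layers t y
    void : ∀ {h t} → P t ≡ false → Off h t
    void ¬Pt Pt = bool-clash Pt ¬Pt
    new : ∀ h → Injective h → Off h a → Off h b → Off h c → New s
    new h h-inj ha hb hc = h , h-inj , λ t Pt t≢s y → at t Pt y (cover s t t≢s)
      where
      at : ∀ t → P t ≡ true → ∀ y → t ≡ a ⊎ t ≡ b ⊎ t ≡ c → h y ≢ layers t y
      at t Pt y (inj₁ refl) = ha Pt y
      at t Pt y (inj₂ (inj₁ refl)) = hb Pt y
      at t Pt y (inj₂ (inj₂ refl)) = hc Pt y
    shifted : V → Pt m → V
    shifted t y = layers t y ⊕ 1F
    shifted-inj : ∀ t → P t ≡ true → Injective (shifted t)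
    shifted-inj t Pt i x v w eq = inj t Pt i x v w
        (prove (all λ v → all λ w → v ⊕ 1F ≐ w ⊕ 1F ⇒ v ≐ w) _ _ eq)
    shifted-off : ∀ t → Off (shifted t) t
    shifted-off t _ y = prove (all λ v → neg (v ⊕ 1F ≐ v)) (layers t y)
    two : ∀ s t → P s ≡ true → P t ≡ true → s ≢ t → Σ (Pt m → V) λ h → Injective h × (∀ x → h x ≢ layers s x)
        × (∀ x → h x ≢ layers t x)
    two s t Ps Pt s≢t = third-quasigroup (layers s) (layers t) (inj s Ps) (inj t Pt) (apart s t Ps Pt s≢t)
    cases : P a ≡ true ⊎ P a ≡ false → P b ≡ true ⊎ P b ≡ false → P c ≡ true ⊎ P c ≡ false → New s
    cases (inj₂ ¬a) (inj₂ ¬b) (inj₂ ¬c) = new (proj₁ xor-quasigroup) (proj₂ xor-quasigroup) (void ¬a)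
        (void ¬b) (void ¬c)
    cases (inj₁ Pa) (inj₂ ¬b) (inj₂ ¬c) = new (shifted a) (shifted-inj a Pa) (shifted-off a) (void ¬b)
        (void ¬c)
    cases (inj₂ ¬a) (inj₁ Pb) (inj₂ ¬c) = new (shifted b) (shifted-inj b Pb) (void ¬a) (shifted-off b)
        (void ¬c)
    cases (inj₂ ¬a) (inj₂ ¬b) (inj₁ Pc) = new (shifted c) (shifted-inj c Pc) (void ¬a) (void ¬b)
        (shifted-off c)
    cases (inj₁ Pa) (inj₁ Pb) (inj₂ ¬c) = let h , h-inj , h≢a , h≢b = two a b Pa Pb a≢b in
      new h h-inj (λ _ → h≢a) (λ _ → h≢b) (void ¬c)
    cases (inj₁ Pa) (inj₂ ¬b) (inj₁ Pc) = let h , h-inj , h≢a , h≢c = two a c Pa Pc a≢c in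
      new h h-inj (λ _ → h≢a) (void ¬b) (λ _ → h≢c)
    cases (inj₂ ¬a) (inj₁ Pb) (inj₁ Pc) = let h , h-inj , h≢b , h≢c = two b c Pb Pc b≢c in
      new h h-inj (void ¬a) (λ _ → h≢b) (λ _ → h≢c)
    cases (inj₁ Pa) (inj₁ Pb) (inj₁ Pc) = new (λ y → layers a y ⊕ layers b y ⊕ layers c y)
      (λ i x → sum-injective (λ v → layers a (x [ i ]≔ v)) (λ v → layers b (x [ i ]≔ v))
          (λ v → layers c (x [ i ]≔ v))
        (inj a Pa i x) (inj b Pb i x) (inj c Pc i x) (λ v → ab (x [ i ]≔ v)) (λ v → ac (x [ i ]≔ v))
            (λ v → bc (x [ i ]≔ v)))
      (λ _ y → proj₁ (fresh _ _ _ (ab y) (ac y) (bc y)))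
          (λ _ y → proj₁ (proj₂ (fresh _ _ _ (ab y) (ac y) (bc y))))
          (λ _ y → proj₂ (proj₂ (fresh _ _ _ (ab y) (ac y) (bc y))))
      where
      ab = apart a b Pa Pb a≢b
      ac = apart a c Pa Pc a≢c
      bc = apart b c Pb Pc b≢c
      fresh : ∀ p q r → p ≢ q → p ≢ r → q ≢ r → p ⊕ q ⊕ r ≢ p × p ⊕ q ⊕ r ≢ q × p ⊕ q ⊕ r ≢ r
      fresh = prove (all λ p → all λ q → all λ r → neg (p ≐ q) ⇒ neg (p ≐ r) ⇒ neg (q ≐ r) ⇒
        neg (p ⊕ q ⊕ r ≐ p) ∧ᶜ neg (p ⊕ q ⊕ r ≐ q) ∧ᶜ neg (p ⊕ q ⊕ r ≐ r))

  add-layer : ∀ s → P s ≡ false → New s → Family L₀ P₀ (λ t → (t == s) ∨ P t)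
  add-layer s ¬Ps (h , h-inj , h≢) = family L′ inj′ apart′ extends′
    where
    L′ : V → Pt m → V
    L′ t = if t == s then h else layers t
    in-P : ∀ t → (t == s) ∨ P t ≡ true → (t ≡ s × L′ t ≡ h) ⊎ (t ≢ s × P t ≡ true × L′ t ≡ layers t)
    in-P t h with t == s | ==-reflects t s
    ... | true  | ofʸ e = inj₁ (e , refl)
    ... | false | ofⁿ n = inj₂ (n , h , refl)
    inj′ : ∀ t → (t == s) ∨ P t ≡ true → Injective (L′ t)
    inj′ t Pt with in-P t Pt
    ... | inj₁ (_ , e) = subst Injective (sym e) h-inj
    ... | inj₂ (_ , Pt′ , e) = subst Injective (sym e) (inj t Pt′)
    apart′ : ∀ t r → (t == s) ∨ P t ≡ true → (r == s) ∨ P r ≡ true → t ≢ r → ∀ y → L′ t y ≢ L′ r y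
    apart′ t r Pt Pr t≢r y with in-P t Pt | in-P r Pr
    ... | inj₁ (refl , _) | inj₁ (refl , _) = contradiction refl t≢r
    ... | inj₁ (_ , e) | inj₂ (r≢s , Pr′ , e′) = subst₂ (λ a b → a y ≢ b y) (sym e) (sym e′) (h≢ r Pr′ r≢s y)
    ... | inj₂ (t≢s , Pt′ , e) | inj₁ (_ , e′) = subst₂ (λ a b → a y ≢ b y) (sym e) (sym e′)
        (h≢ t Pt′ t≢s y ∘ sym)
    ... | inj₂ (_ , Pt′ , e) | inj₂ (_ , Pr′ , e′) = subst₂ (λ a b → a y ≢ b y) (sym e) (sym e′)
        (apart t r Pt′ Pr′ t≢r y)
    extends′ : ∀ t → P₀ t ≡ true → (t == s) ∨ P t ≡ true × (∀ y → L′ t y ≡ L₀ t y)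
    extends′ t P₀t with t == s | ==-reflects t s
    ... | true  | ofʸ refl = bool-clash (proj₁ (extends t P₀t)) ¬Ps
    ... | false | _ = extends t P₀t

  complete-layer : ∀ s → Family L₀ P₀ (λ t → (t == s) ∨ P t)
  complete-layer s with bool-case (P s)
  ... | inj₂ ¬Ps = add-layer s ¬Ps (new-layer s)
  ... | inj₁ Ps = family layers (λ t → inj t ∘ old t) (λ t r Pt Pr → apart t r (old t Pt) (old r Pr))
      λ t P₀t → new t (proj₁ (extends t P₀t)) , proj₂ (extends t P₀t)
    where
    old : ∀ t → (t == s) ∨ P t ≡ true → P t ≡ true
    old t h with t == s | ==-reflects t s
    ... | true  | ofʸ refl = Ps
    ... | false | _ = h
    new : ∀ t → P t ≡ true → (t == s) ∨ P t ≡ true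
    new t Pt with t == s
    ... | true  = refl
    ... | false = Pt

complete-family : ∀ {m} {L₀ : V → Pt m → V} {P₀} → Family L₀ P₀ P₀ → Σ (V → Bool) λ P → Family L₀ P₀ P ×
    (∀ s → P s ≡ true)
complete-family F = _ , complete-layer (complete-layer (complete-layer (complete-layer F 0F) 1F) 2F) 3F ,
  λ { 0F → refl ; 1F → refl ; 2F → refl ; 3F → refl }

module _ {m : ℕ} (Σ′ : Subset 4) (f : PartialOp (Cylinder m Σ′))
    (f-part : IsPartialQuasigroup (Cylinder m Σ′) f) where

  value : ∀ s → s ∈ Σ′ → Pt m → V
  value s s∈ y = f (y ∷ʳ s) (subst (_∈ Σ′) (sym (last-∷ʳ s y)) s∈)

  f-cong : ∀ {x x′} → x ≡ x′ → ∀ p p′ → f x p ≡ f x′ p′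
  f-cong {x} refl p p′ = cong (f x) (Cylinder-irrelevant m Σ′ x p p′)

  value-inj : ∀ s s∈ → Injective (value s s∈)
  value-inj s s∈ i x v w eq with same v w
  ... | inj₁ v≡w = v≡w
  ... | inj₂ v≢w = contradiction eq (f-part ((x [ i ]≔ v) ∷ʳ s) ((x [ i ]≔ w) ∷ʳ s) _ _
    (trans (cong₂ hamming (sym (snoc-update x s i v)) (sym (snoc-update x s i w)))
        (hamming-update (x ∷ʳ s) (inject₁ i) v≢w)))

  value-apart : ∀ s t s∈ t∈ → s ≢ t → ∀ y → value s s∈ y ≢ value t t∈ y
  value-apart s t s∈ t∈ s≢t y = f-part (y ∷ʳ s) (y ∷ʳ t) _ _
    (trans (cong₂ hamming (sym (snoc-last y s s)) (sym (snoc-last y s t)))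
        (hamming-update (y ∷ʳ s) (fromℕ m) s≢t))

  L₀ : V → Pt m → V
  L₀ s y with s ∈? Σ′
  ... | yes s∈ = value s s∈ y
  -- A placeholder: `P₀` is false at this `s`.
  ... | no _   = 0F

  P₀ : V → Bool
  P₀ s = does (s ∈? Σ′)

  L₀-value : ∀ s (s∈ : s ∈ Σ′) y → L₀ s y ≡ value s s∈ y
  L₀-value s s∈ y with s ∈? Σ′
  ... | yes s∈′ = f-cong refl _ _
  ... | no s∉   = contradiction s∈ s∉

  P₀-∈ : ∀ s → P₀ s ≡ true → s ∈ Σ′
  P₀-∈ s = does-yes (s ∈? Σ′)

  initial : Family L₀ P₀ P₀
  initial = family L₀
    (λ s Ps i x v w eq → value-inj s (P₀-∈ s Ps) i x v w (trans (sym (L₀-value s (P₀-∈ s Ps) (x [ i ]≔ v)))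
        (trans eq (L₀-value s (P₀-∈ s Ps) (x [ i ]≔ w)))))
    (λ s t Ps Pt s≢t y eq → value-apart s t (P₀-∈ s Ps) (P₀-∈ t Pt) s≢t y
      (trans (sym (L₀-value s (P₀-∈ s Ps) y)) (trans eq (L₀-value t (P₀-∈ t Pt) y))))
    (λ s Ps → Ps , λ y → refl)

  assemble : (Σ (V → Bool) λ P → Family L₀ P₀ P × (∀ s → P s ≡ true)) → Completable (Cylinder m Σ′) f
  assemble (P , family L inj apart extends , all-P) = q , injective⇒quasigroup q q-inj , q-extends
    where
    q : Word 4 (suc m) → V
    q x = L (last x) (init x)
    q-snoc : ∀ y s → q (y ∷ʳ s) ≡ L s y
    q-snoc y s = cong₂ L (last-∷ʳ s y) (init-∷ʳ s y)
    snoc-inj : ∀ i y s v w → q ((y ∷ʳ s) [ i ]≔ v) ≡ q ((y ∷ʳ s) [ i ]≔ w) → v ≡ w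
    snoc-inj i y s v w eq with inner-or-last i
    ... | inj₁ (j , refl) = inj s (all-P s) j y v w (trans (sym (at v)) (trans eq (at w)))
      where
      at : ∀ v → q ((y ∷ʳ s) [ inject₁ j ]≔ v) ≡ L s (y [ j ]≔ v)
      at v = trans (cong q (snoc-update y s j v)) (q-snoc (y [ j ]≔ v) s)
    ... | inj₂ refl = by-layer (same v w)
      where
      at : ∀ v → q ((y ∷ʳ s) [ fromℕ m ]≔ v) ≡ L v y
      at v = trans (cong q (snoc-last y s v)) (q-snoc y v)
      by-layer : v ≡ w ⊎ v ≢ w → v ≡ w
      by-layer (inj₁ v≡w) = v≡w
      by-layer (inj₂ v≢w) = contradiction (trans (sym (at v)) (trans eq (at w)))
          (apart v w (all-P v) (all-P w) v≢w y)
    snoc : ∀ (x : Word 4 (suc m)) → x ≡ init x ∷ʳ last x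
    snoc x = proj₂ (proj₂ (initLast x))
    q-inj : Injective q
    q-inj i x v w = subst (λ z → q (z [ i ]≔ v) ≡ q (z [ i ]≔ w) → v ≡ w) (sym (snoc x))
        (snoc-inj i (init x) (last x) v w)
    q-extends : ∀ x (x∈ : Cylinder m Σ′ x) → q x ≡ f x x∈
    q-extends x x∈ = trans (proj₂ (extends (last x) (dec-true (last x ∈? Σ′) x∈)) (init x))
      (trans (L₀-value (last x) x∈ (init x)) (f-cong (sym (snoc x)) _ _))

theorem1 : ∀ (m : ℕ) (Σ′ : Subset 4) (f : PartialOp (Cylinder m Σ′)) →
    IsPartialQuasigroup (Cylinder m Σ′) f →
    Completable (Cylinder m Σ′) f
theorem1 m Σ′ f f-part = assemble Σ′ f f-part (complete-family (initial Σ′ f f-part))
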